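{- There exists a constant $\epsilon_1>0$ such that for all integers $d\ge 0$ and $n\ge d+1$, and for all functions $f:\mathbb{F}_2^n\to\mathbb{F}_2$, $$\Pr[\,T_{\mathrm{GN}}^f \text{ rejects}\,]\;\ge\;\min\{2^{d}\cdot\delta_d(f),\ \epsilon_1\}.$$
   Context: Every function $f:\mathbb{F}_2^n\to\mathbb{F}_2$ is uniquely a multilinear polynomial over $\mathbb{F}_2$; $\deg f$ is its degree. "Degree $d$ polynomial" means degree at most $d$. $\mathrm{RM}(d,n)=\{g:\mathbb{F}_2^n\to\mathbb{F}_2 : \deg g\le d\}$. For $f,g:\mathbb{F}_2^n\to\mathbb{F}_2$, $\delta(f,g)=\Pr_{x}[f(x)\ne g(x)]$ with $x$ uniform in $\mathbb{F}_2^n$, and $\delta_d(f)=\min_{g\in \mathrm{RM}(d,n)}\delta(f,g)$. A $k$-flat is a $k$-dimensional affine subspace of $\mathbb{F}_2^n$; the restriction of $f$ to a $k$-flat is viewed as a function on $\mathbb{F}_2^k$ through any affine parametrization (its degree does not depend on the parametrization). The test $T_{\mathrm{GN}}^f$ (with degree parameter $d$) picks a uniformly random $(d+1)$-flat $A\subseteq\mathbb{F}_2^n$ and accepts if and only if $f|_A$ has degree at most $d$; otherwise it rejects. -}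

module Defs where

open import Data.Bool.Base using (Bool; true; false; _∧_; _xor_; if_then_else_)
import Data.Bool.Properties as Bool
open import Data.Fin.Subset using (Subset; inside; outside; ∣_∣)
open import Data.Fin.Subset.Properties using (anySubset?)
open import Data.Integer.Base using (+_)
open import Data.List.Base
  using (List; []; _∷_; _++_; map; foldr; filter; length; cartesianProductWith)
open import Data.List.Extrema.Nat using (max)
open import Data.List.Membership.Propositional using (_∈_)
import Data.List.Membership.Propositional.Properties as ∈
import Data.List.Membership.Setoid.Properties as Setoid∈
open import Data.List.Properties using (filter-≐; ++-identityʳ; map-++; map-∘; map-cong; filter-none)
open import Data.List.Relation.Unary.All as All using (All; []; _∷_)
open import Data.List.Relation.Unary.Any as Any using (Any; here; there)
open import Data.List.Relation.Unary.AllPairs using ([]; _∷_)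
import Data.List.Relation.Unary.All.Properties as Allₚ
import Data.List.Relation.Unary.Any.Properties as Anyₚ
import Data.List.Relation.Unary.Unique.Setoid as SetoidUnique
import Data.List.Relation.Unary.Unique.Setoid.Properties as SetoidUniqueₚ
open import Data.List.Relation.Unary.Unique.Propositional using (Unique)
import Data.List.Relation.Unary.Unique.Propositional.Properties as Uniqueₚ
open import Data.Nat.Base using (ℕ; zero; suc; _≤_; z≤n; s≤s; s≤s⁻¹)
open import Data.Nat.Properties using (_≤?_)
open import Data.Product.Base using (∃; _×_; _,_)
open import Data.Rational.Base as ℚ using (ℚ; 0ℚ; _/_)
import Data.Rational.Properties as ℚ
open import Data.Sum.Base using (inj₁; inj₂)
open import Data.Vec.Base as Vec using (Vec; []; _∷_; zipWith; replicate)
open import Data.Vec.Properties using (≡-dec; ∷-injective)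
open import Function.Base using (_∘_; const)
open import Function.Bundles using (_⇔_; mk⇔; Equivalence)
open import Function.Definitions using (Injective)
open import Level using (Level)
open import Relation.Binary.Bundles using (DecTotalOrder; Setoid)
open import Relation.Binary.Definitions using (DecidableEquality)
open import Relation.Binary.PropositionalEquality
  using (_≡_; _≗_; refl; sym; trans; cong; cong₂; subst; _→-setoid_; module ≡-Reasoning)
open import Relation.Nullary using (Dec; does; yes; no; ¬?; contradiction)
open import Relation.Nullary.Decidable using (map′; _×-dec_; _→-dec_; decidable-stable)
open import Relation.Unary using (Pred; Decidable; _≐_)
import Data.List.Extrema (DecTotalOrder.totalOrder ℚ.≤-decTotalOrder) as Minimum

private
  variable
    a p : Level
    A : Set a
    k n : ℕ

F₂ : Set
F₂ = Bool

F₂^_ : ℕ → Set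
F₂^ n = Vec F₂ n

_≟_ : DecidableEquality (F₂^ n)
_≟_ = ≡-dec Bool._≟_

------------------------------------------------------------------------
-- Uniform probability on a finite sample space, given as a list without
-- repetitions.  The value on an empty space is a junk value.

Pr : {P : Pred A p} → Decidable P → List A → ℚ
Pr P? []       = 0ℚ
Pr P? (x ∷ xs) = + length (filter P? (x ∷ xs)) / length (x ∷ xs)

Pr-cong : {P Q : Pred A p} (P? : Decidable P) (Q? : Decidable Q) →
          P ≐ Q → ∀ xs → Pr P? xs ≡ Pr Q? xs
Pr-cong P? Q? P≐Q []       = refl
Pr-cong P? Q? P≐Q (x ∷ xs) =
  cong (λ ys → + length ys / suc (length xs)) (filter-≐ P? Q? P≐Q (x ∷ xs))

cube : ∀ n → List (F₂^ n)
cube zero    = [] ∷ []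
cube (suc n) = cartesianProductWith _∷_ (false ∷ true ∷ []) (cube n)

-- Functions are compared pointwise, so the list of all functions has
-- every function, and no function twice, up to _≗_.

glue : (F₂^ n → F₂) → (F₂^ n → F₂) → F₂^ (suc n) → F₂
glue g h (b ∷ x) = if b then h x else g x

functions : ∀ n → List (F₂^ n → F₂)
functions zero    = const false ∷ const true ∷ []
functions (suc n) = cartesianProductWith glue (functions n) (functions n)

private
  bits-complete : ∀ b → b ∈ (false ∷ true ∷ [])
  bits-complete false = here refl
  bits-complete true  = there (here refl)

  bits-unique : Unique (false ∷ true ∷ [])
  bits-unique = ((λ ()) ∷ []) ∷ [] ∷ []

  Fun : ℕ → Setoid _ _
  Fun n = (F₂^ n) →-setoid F₂

cube-complete : (x : F₂^ n) → x ∈ cube n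
cube-complete []      = here refl
cube-complete (b ∷ x) = ∈.∈-cartesianProductWith⁺ _∷_ (bits-complete b) (cube-complete x)

cube-unique : ∀ n → Unique (cube n)
cube-unique zero    = [] ∷ []
cube-unique (suc n) = Uniqueₚ.cartesianProductWith⁺ _∷_ ∷-injective bits-unique (cube-unique n)

functions-complete : (f : F₂^ n → F₂) → Any (f ≗_) (functions n)
functions-complete {zero} f with f [] in eq
... | false = here λ { [] → eq }
... | true  = there (here λ { [] → eq })
functions-complete {suc n} f =
  Any.map (λ eq x → trans (split x) (eq x))
    (Setoid∈.∈-cartesianProductWith⁺ (Fun n) (Fun n) (Fun (suc n)) glue-cong
      (functions-complete (f ∘ (false ∷_))) (functions-complete (f ∘ (true ∷_))))
  where
  split : f ≗ glue (f ∘ (false ∷_)) (f ∘ (true ∷_))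
  split (false ∷ x) = refl
  split (true  ∷ x) = refl

  glue-cong : ∀ {g g′ h h′ : F₂^ n → F₂} → g ≗ g′ → h ≗ h′ → glue g h ≗ glue g′ h′
  glue-cong g≗g′ h≗h′ (false ∷ x) = g≗g′ x
  glue-cong g≗g′ h≗h′ (true  ∷ x) = h≗h′ x

functions-unique : ∀ n → SetoidUnique.Unique (Fun n) (functions n)
functions-unique zero    = ((λ eq → contradiction (eq []) λ ()) ∷ []) ∷ [] ∷ []
functions-unique (suc n) =
  SetoidUniqueₚ.cartesianProductWith⁺ (Fun n) (Fun n) (Fun (suc n)) glue
    (λ eq → (eq ∘ (false ∷_)) , (eq ∘ (true ∷_)))
    (functions-unique n) (functions-unique n)

------------------------------------------------------------------------
-- Multilinear polynomials over F₂ in n variables: p S is the coefficient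
-- of the monomial ∏_{i ∈ S} xᵢ.

Poly : ℕ → Set
Poly n = Subset n → F₂

monomial : Subset n → F₂^ n → F₂
monomial S x = Vec.foldr _ _∧_ true (zipWith (λ s b → if s then b else true) S x)

sum : List F₂ → F₂
sum = foldr _xor_ false

eval : Poly n → F₂^ n → F₂
eval {n} p x = sum (map (λ S → p S ∧ monomial S x) (cube n))

-- The zero polynomial gets degree 0, which has at most degree d for every
-- natural d, as it would with the convention -∞.

degree : Poly n → ℕ
degree {n} p = max 0 (map ∣_∣ (filter (λ S → p S Bool.≟ true) (cube n)))

-- The unique polynomial representing f, see eval-anf and anf-unique.

anf : (F₂^ n → F₂) → Poly n
anf f []            = f []
anf f (outside ∷ S) = anf (f ∘ (false ∷_)) S
anf f (inside  ∷ S) = anf (λ x → f (false ∷ x) xor f (true ∷ x)) S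

anf-cong : {f g : F₂^ n → F₂} → f ≗ g → anf f ≗ anf g
anf-cong f≗g []            = f≗g []
anf-cong f≗g (outside ∷ S) = anf-cong (f≗g ∘ (false ∷_)) S
anf-cong f≗g (inside  ∷ S) =
  anf-cong (λ x → cong₂ _xor_ (f≗g (false ∷ x)) (f≗g (true ∷ x))) S

private
  sum-++ : ∀ bs cs → sum (bs ++ cs) ≡ sum bs xor sum cs
  sum-++ []       cs = refl
  sum-++ (b ∷ bs) cs =
    trans (cong (b xor_) (sum-++ bs cs)) (sym (Bool.xor-assoc b (sum bs) (sum cs)))

  sum-∧ : ∀ b (c : A → F₂) xs → sum (map (λ x → b ∧ c x) xs) ≡ b ∧ sum (map c xs)
  sum-∧ b c []       = sym (Bool.∧-zeroʳ b)
  sum-∧ b c (x ∷ xs) =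
    trans (cong ((b ∧ c x) xor_) (sum-∧ b c xs)) (sym (Bool.∧-distribˡ-xor b (c x) _))

  ∧-swap : ∀ a b c → a ∧ (b ∧ c) ≡ b ∧ (a ∧ c)
  ∧-swap false b c = sym (Bool.∧-zeroʳ b)
  ∧-swap true  b c = refl

  xor-cancel : ∀ b c → b xor (b xor c) ≡ c
  xor-cancel false c = refl
  xor-cancel true  c = Bool.not-involutive c

  eval-∷ : ∀ (p : Poly (suc n)) b x →
           eval p (b ∷ x) ≡ eval (p ∘ (outside ∷_)) x xor (b ∧ eval (p ∘ (inside ∷_)) x)
  eval-∷ {n} p b x = begin
    sum (map t (map (outside ∷_) Ss ++ (map (inside ∷_) Ss ++ [])))
      ≡⟨ cong sum (map-++ t (map (outside ∷_) Ss) _) ⟩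
    sum (map t (map (outside ∷_) Ss) ++ map t (map (inside ∷_) Ss ++ []))
      ≡⟨ sum-++ (map t (map (outside ∷_) Ss)) _ ⟩
    sum (map t (map (outside ∷_) Ss)) xor sum (map t (map (inside ∷_) Ss ++ []))
      ≡⟨ cong₂ _xor_ (cong sum (sym (map-∘ Ss))) inner ⟩
    eval (p ∘ (outside ∷_)) x xor (b ∧ eval (p ∘ (inside ∷_)) x) ∎
    where
    open ≡-Reasoning
    Ss = cube n
    t : Subset (suc n) → F₂
    t S = p S ∧ monomial S (b ∷ x)
    inner : sum (map t (map (inside ∷_) Ss ++ [])) ≡ b ∧ eval (p ∘ (inside ∷_)) x
    inner = begin
      sum (map t (map (inside ∷_) Ss ++ []))
        ≡⟨ cong (sum ∘ map t) (++-identityʳ (map (inside ∷_) Ss)) ⟩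
      sum (map t (map (inside ∷_) Ss))
        ≡⟨ cong sum (sym (map-∘ Ss)) ⟩
      sum (map (λ S → p (inside ∷ S) ∧ (b ∧ monomial S x)) Ss)
        ≡⟨ cong sum (map-cong (λ S → ∧-swap (p (inside ∷ S)) b (monomial S x)) Ss) ⟩
      sum (map (λ S → b ∧ (p (inside ∷ S) ∧ monomial S x)) Ss)
        ≡⟨ sum-∧ b (λ S → p (inside ∷ S) ∧ monomial S x) Ss ⟩
      b ∧ eval (p ∘ (inside ∷_)) x ∎

eval-anf : (f : F₂^ n → F₂) → eval (anf f) ≗ f
eval-anf f []      = trans (Bool.xor-identityʳ _) (Bool.∧-identityʳ (f []))
eval-anf f (b ∷ x) = trans (eval-∷ (anf f) b x) (trans
  (cong₂ (λ u v → u xor (b ∧ v))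
    (eval-anf (f ∘ (false ∷_)) x)
    (eval-anf (λ y → f (false ∷ y) xor f (true ∷ y)) x))
  (cases b))
  where
  cases : ∀ b → f (false ∷ x) xor (b ∧ (f (false ∷ x) xor f (true ∷ x))) ≡ f (b ∷ x)
  cases false = Bool.xor-identityʳ _
  cases true  = xor-cancel (f (false ∷ x)) (f (true ∷ x))

private
  anf-eval : (p : Poly n) → anf (eval p) ≗ p
  anf-eval p [] = trans (Bool.xor-identityʳ _) (Bool.∧-identityʳ (p []))
  anf-eval p (outside ∷ S) = trans
    (anf-cong (λ x → trans (eval-∷ p false x) (Bool.xor-identityʳ _)) S)
    (anf-eval (p ∘ (outside ∷_)) S)
  anf-eval p (inside ∷ S) = trans
    (anf-cong (λ x → trans
      (cong₂ _xor_ (trans (eval-∷ p false x) (Bool.xor-identityʳ (eval (p ∘ (outside ∷_)) x))) (eval-∷ p true x))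
      (xor-cancel (eval (p ∘ (outside ∷_)) x) _)) S)
    (anf-eval (p ∘ (inside ∷_)) S)

anf-unique : (f : F₂^ n → F₂) (p : Poly n) → eval p ≗ f → p ≗ anf f
anf-unique f p eq S = trans (sym (anf-eval p S)) (anf-cong eq S)

deg : (F₂^ n → F₂) → ℕ
deg f = degree (anf f)

deg-cong : {f g : F₂^ n → F₂} → f ≗ g → deg f ≡ deg g
deg-cong {n} f≗g = cong (max 0 ∘ map ∣_∣)
  (filter-≐ _ _ ( (λ {S} → trans (sym (anf-cong f≗g S)))
                , (λ {S} → trans (anf-cong f≗g S)) ) (cube n))

------------------------------------------------------------------------
-- Distance to the Reed–Muller code

δ : (f g : F₂^ n → F₂) → ℚ
δ {n} f g = Pr (λ x → ¬? (f x Bool.≟ g x)) (cube n)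

RM : ∀ d n → List (F₂^ n → F₂)
RM d n = filter (λ g → deg g ≤? d) (functions n)

-- The zero function, of degree 0, is only there because Minimum.min asks
-- for a starting value; see δ-attained and δ-minimal.

δ[_] : ℕ → (F₂^ n → F₂) → ℚ
δ[_] {n} d f = Minimum.min (δ f (const false)) (map (δ f) (RM d n))

private
  anf-zero : (S : Subset n) → anf (const false) S ≡ false
  anf-zero []            = refl
  anf-zero (outside ∷ S) = anf-zero S
  anf-zero (inside  ∷ S) = anf-zero S

  deg-zero : deg {n} (const false) ≡ 0
  deg-zero {n} = cong (max 0 ∘ map ∣_∣)
    (filter-none _ (All.universal (λ S eq → contradiction (trans (sym (anf-zero S)) eq) λ ()) (cube n)))

  δ-congʳ : (f : F₂^ n → F₂) {g h : F₂^ n → F₂} → g ≗ h → δ f g ≡ δ f h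
  δ-congʳ {n} f {g} {h} g≗h = Pr-cong
    (λ x → ¬? (f x Bool.≟ g x)) (λ x → ¬? (f x Bool.≟ h x))
    ((λ {x} f≢g f≡h → f≢g (trans f≡h (sym (g≗h x)))) ,
     (λ {x} f≢h f≡g → f≢h (trans f≡g (g≗h x)))) (cube n)

δ-attained : ∀ d (f : F₂^ n → F₂) → ∃ λ g → deg g ≤ d × δ[ d ] f ≡ δ f g
δ-attained {n} d f = Minimum.argmin-all (λ q → q)
  {P = λ q → ∃ λ g → deg g ≤ d × q ≡ δ f g}
  (const false , subst (_≤ d) (sym (deg-zero {n})) z≤n , refl)
  (Allₚ.map⁺ (All.map (λ {g} g≤d → g , g≤d , refl)
    (Allₚ.all-filter (λ g → deg g ≤? d) (functions n))))

δ-minimal : ∀ d (f g : F₂^ n → F₂) → deg g ≤ d → δ[ d ] f ℚ.≤ δ f g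
δ-minimal {n} d f g g≤d = Minimum.min≤v⁺ _ (map (δ f) (RM d n)) (inj₂
  (Anyₚ.map⁺ (Any.map (λ g≗h → ℚ.≤-reflexive (sym (δ-congʳ f g≗h)))
    (Setoid∈.∈-filter⁺ (Fun n) (λ h → deg h ≤? d)
      (λ h≗h′ → subst (_≤ d) (deg-cong h≗h′)) (functions-complete g) g≤d))))

------------------------------------------------------------------------
-- Flats

_⊕_ : F₂^ n → F₂^ n → F₂^ n
_⊕_ = zipWith _xor_

_·_ : F₂ → F₂^ n → F₂^ n
b · v = Vec.map (b ∧_) v

AffineMap : ℕ → ℕ → Set
AffineMap k n = F₂^ n × Vec (F₂^ n) k

⟦_⟧ : AffineMap k n → F₂^ k → F₂^ n
⟦ a , vs ⟧ t = a ⊕ Vec.foldr _ _⊕_ (replicate _ false) (zipWith _·_ t vs)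

-- Subsets of F₂^ n are given by their characteristic functions.
-- Injectivity of ⟦ a , vs ⟧ is linear independence of vs.

_Parametrizes_ : AffineMap k n → (F₂^ n → Bool) → Set
φ Parametrizes A = Injective _≡_ _≡_ ⟦ φ ⟧ × (∀ x → A x ≡ true ⇔ ∃ λ t → ⟦ φ ⟧ t ≡ x)

IsFlat : ∀ k → (F₂^ n → Bool) → Set
IsFlat {n} k A = ∃ λ (φ : AffineMap k n) → φ Parametrizes A

-- Degrees do not depend on the parametrization, so that asking for some
-- parametrization or for all of them is the same when A is a (1 + d)-flat.

Accepts : ∀ d → (F₂^ n → F₂) → (F₂^ n → Bool) → Set
Accepts {n} d f A =
  ∃ λ (φ : AffineMap (suc d) n) → φ Parametrizes A × deg (f ∘ ⟦ φ ⟧) ≤ d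

private
  all? : {P : Pred (F₂^ n) p} → Decidable P → Dec (∀ x → P x)
  all? P? = map′ (λ ∄ x → decidable-stable (P? x) λ ¬Px → ∄ (x , ¬Px))
                 (λ ∀P → λ (x , ¬Px) → ¬Px (∀P x))
                 (¬? (anySubset? (¬? ∘ P?)))

  anyVec? : ∀ k {P : Pred (Vec (F₂^ n) k) p} → Decidable P → Dec (∃ P)
  anyVec? zero    P? = map′ ([] ,_) (λ { ([] , P[]) → P[] }) (P? [])
  anyVec? (suc k) P? =
    map′ (λ (v , vs , Pvs) → v ∷ vs , Pvs) (λ { (v ∷ vs , Pvs) → v , vs , Pvs })
         (anySubset? λ v → anyVec? k (P? ∘ (v ∷_)))

  anyAffineMap? : {P : Pred (AffineMap k n) p} → Decidable P → Dec (∃ P)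
  anyAffineMap? {k = k} P? =
    map′ (λ (a , vs , Pφ) → (a , vs) , Pφ) (λ ((a , vs) , Pφ) → a , vs , Pφ)
         (anySubset? λ a → anyVec? k λ vs → P? (a , vs))

  _⇔-dec_ : {P Q : Set} → Dec P → Dec Q → Dec (P ⇔ Q)
  P? ⇔-dec Q? = map′ (λ (p⇒q , q⇒p) → mk⇔ p⇒q q⇒p)
                     (λ p⇔q → Equivalence.to p⇔q , Equivalence.from p⇔q)
                     ((P? →-dec Q?) ×-dec (Q? →-dec P?))

parametrizes? : (φ : AffineMap k n) (A : F₂^ n → Bool) → Dec (φ Parametrizes A)
parametrizes? φ A =
  map′ (λ inj {s} {t} → inj s t) (λ inj s t → inj)
       (all? λ s → all? λ t → (⟦ φ ⟧ s ≟ ⟦ φ ⟧ t) →-dec (s ≟ t))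
  ×-dec
  all? λ x → (A x Bool.≟ true) ⇔-dec anySubset? (λ t → ⟦ φ ⟧ t ≟ x)

isFlat? : ∀ k → Decidable (IsFlat {n} k)
isFlat? k A = anyAffineMap? λ φ → parametrizes? φ A

accepts? : ∀ d (f : F₂^ n → F₂) → Decidable (Accepts d f)
accepts? d f A = anyAffineMap? λ φ → parametrizes? φ A ×-dec (deg (f ∘ ⟦ φ ⟧) ≤? d)

flats : ∀ k n → List (F₂^ n → Bool)
flats k n = filter (isFlat? k) (functions n)

-- For 1 + d ≤ n the sample space is non-empty, see flats-nonEmpty.

Pr[T-GN-rejects] : ∀ d → (F₂^ n → F₂) → ℚ
Pr[T-GN-rejects] {n} d f = Pr (λ A → ¬? (accepts? d f A)) (flats (suc d) n)

private
  isFlat-resp : {A B : F₂^ n → Bool} → A ≗ B → IsFlat k A → IsFlat k B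
  isFlat-resp A≗B (φ , inj , im) = φ , inj , λ x →
    subst (λ b → b ≡ true ⇔ ∃ λ t → ⟦ φ ⟧ t ≡ x) (A≗B x) (im x)

  image : AffineMap k n → F₂^ n → Bool
  image φ x = does (anySubset? λ t → ⟦ φ ⟧ t ≟ x)

  image-isFlat : (φ : AffineMap k n) → Injective _≡_ _≡_ ⟦ φ ⟧ → IsFlat k (image φ)
  image-isFlat φ inj = φ , inj , λ x → does-⇔ (anySubset? λ t → ⟦ φ ⟧ t ≟ x)
    where
    does-⇔ : {P : Set} (P? : Dec P) → does P? ≡ true ⇔ P
    does-⇔ (yes p) = mk⇔ (λ _ → p) (λ _ → refl)
    does-⇔ (no ¬p) = mk⇔ (λ ()) (λ p → contradiction p ¬p)

  ⊕-zeroˡ : (x : F₂^ n) → replicate n false ⊕ x ≡ x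
  ⊕-zeroˡ []      = refl
  ⊕-zeroˡ (b ∷ x) = cong (b ∷_) (⊕-zeroˡ x)

  span : Vec (F₂^ n) k → F₂^ k → F₂^ n
  span vs t = Vec.foldr _ _⊕_ (replicate _ false) (zipWith _·_ t vs)

  -- The first k unit vectors.
  units : k ≤ n → Vec (F₂^ n) k
  units z≤n       = []
  units (s≤s k≤n) = (true ∷ replicate _ false) ∷ Vec.map (false ∷_) (units k≤n)

  span-false∷ : (vs : Vec (F₂^ n) k) (t : F₂^ k) →
                span (Vec.map (false ∷_) vs) t ≡ false ∷ span vs t
  span-false∷ []       []      = refl
  span-false∷ (v ∷ vs) (b ∷ t) = trans
    (cong ((b · (false ∷ v)) ⊕_) (span-false∷ vs t))
    (cong (_∷ ((b · v) ⊕ span vs t)) (trans (Bool.xor-identityʳ _) (Bool.∧-zeroʳ b)))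

  ·-zeroʳ : ∀ b → b · replicate n false ≡ replicate n false
  ·-zeroʳ {zero}  b = refl
  ·-zeroʳ {suc n} b = cong₂ _∷_ (Bool.∧-zeroʳ b) (·-zeroʳ b)

  span-units : (k≤n : suc k ≤ suc n) (b : F₂) (t : F₂^ k) →
               span (units k≤n) (b ∷ t) ≡ b ∷ span (units (s≤s⁻¹ k≤n)) t
  span-units (s≤s k≤n) b t = trans
    (cong ((b · (true ∷ replicate _ false)) ⊕_) (span-false∷ (units k≤n) t))
    (cong₂ _∷_ (trans (Bool.xor-identityʳ _) (Bool.∧-identityʳ b))
      (trans (cong (_⊕ span (units k≤n) t) (·-zeroʳ b)) (⊕-zeroˡ _)))

  span-units-injective : (k≤n : k ≤ n) → Injective _≡_ _≡_ (span (units k≤n))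
  span-units-injective z≤n       {[]}    {[]}    _  = refl
  span-units-injective (s≤s k≤n) {b ∷ s} {c ∷ t} eq
    with b≡c , s≡t ← ∷-injective (trans (sym (span-units (s≤s k≤n) b s))
                                  (trans eq (span-units (s≤s k≤n) c t)))
    = cong₂ _∷_ b≡c (span-units-injective k≤n s≡t)

flats-nonEmpty : k ≤ n → ∃ λ A → A ∈ flats k n
flats-nonEmpty {k} {n} k≤n = satisfying
  (Setoid∈.∈-filter⁺ (Fun n) (isFlat? k) isFlat-resp
    (functions-complete (image φ)) (image-isFlat φ inj))
  where
  φ : AffineMap k n
  φ = replicate n false , units k≤n

  inj : Injective _≡_ _≡_ ⟦ φ ⟧
  inj eq = span-units-injective k≤n (trans (sym (⊕-zeroˡ _)) (trans eq (⊕-zeroˡ _)))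

  satisfying : ∀ {Q : Pred (F₂^ n → Bool) _} {As} → Any Q As → ∃ λ A → A ∈ As
  satisfying (here _)   = _ , here refl
  satisfying (there A∈) = let A , A∈As = satisfying A∈ in A , there A∈As

{-# OPTIONS --safe #-}

-- A function has degree at most d iff all its (d + 1)-fold derivatives D vs f a vanish, and the test
-- rejects the flat a + span vs iff D vs f a = 1.  Linearly dependent vs have D vs f a = 0, so it is
-- enough to bound from below the proportion of all pairs (a , vs) with D vs f a = 1.
--
-- If f differs from a polynomial of degree at most d in at most 2 ^ (n - d - 2) points, a second moment
-- estimate for the number of these points on a + span vs shows that the proportion is at least 2 ^ d δ.
-- Otherwise restrict f to hyperplanes and use induction on n.  Either all but O(2 ^ d) directions
-- consist of hyperplanes on which f is far from degree d, and the proportion for f is bounded from below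
-- by the average of the proportions for the restrictions; or there are more than that many
-- directions with a hyperplane on which f is close to a polynomial.  Since the code has minimum distance
-- 2 ^ (n - d), these polynomials agree on intersections.  Interpolating on d + 2 linearly independent
-- hyperplanes gives one polynomial P of degree at most d, which agrees with all of them because a
-- polynomial of degree at most d that vanishes on d + 1 independent hyperplanes is zero.  By Chebyshev's
-- inequality P is close to f, so that the second moment estimate applies.

module Submission where

open import Defs
import Algebra.Properties.CommutativeSemigroup as CommutativeSemigroupProperties
open import Data.Bool.Base using (Bool; true; false; _∧_; _xor_; not; if_then_else_)
import Data.Bool.Properties as Bool
open import Data.Bool.Solver using (module xor-∧-Solver)
open import Data.Fin.Subset using (Subset; inside; outside; ∣_∣)
open import Data.Fin.Subset.Properties using (anySubset?)
import Data.Integer.Base as ℤ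
import Data.Integer.Properties as ℤ
open import Data.List.Extrema.Nat using (max≤v⁺; xs≤max)
open import Data.List.Base
  using (List; []; _∷_; _++_; map; length; filter; cartesianProductWith)
import Data.List.Properties as Listₚ
open import Data.List.Membership.Propositional using (_∈_; _∉_)
import Data.List.Membership.Propositional.Properties as ∈
open import Data.List.Relation.Unary.All as All using (All; []; _∷_)
import Data.List.Relation.Unary.All.Properties as Allₚ
open import Data.List.Relation.Unary.AllPairs using (AllPairs; []; _∷_)
open import Data.List.Relation.Unary.Any using (Any; here; there)
open import Data.List.Relation.Unary.Unique.Propositional using (Unique)
import Data.List.Relation.Unary.Unique.Propositional.Properties as Uniqueₚ
open import Data.Nat.Base
  using (ℕ; zero; suc; _+_; _*_; _∸_; _^_; _≤_; _<_; z≤n; s≤s; s≤s⁻¹; NonZero)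
import Data.Nat.Properties as ℕ
open import Data.Nat.Solver using (module +-*-Solver)
import Data.Product.Properties as Productₚ
open import Data.Product.Base using (∃; _×_; _,_; proj₁; proj₂)
open import Data.Rational.Base as ℚ using (ℚ; 0ℚ; _/_; _⊓_; _≥_)
import Data.Rational.Properties as ℚ
import Data.Rational.Unnormalised.Base as ℚᵘ
import Data.Rational.Unnormalised.Properties as ℚᵘ
open import Data.Sum.Base using (_⊎_; inj₁; inj₂)
open import Data.Vec.Base as Vec using (Vec; []; _∷_; zipWith; replicate)
import Data.Vec.Properties as Vecₚ
open import Function.Base using (_∘_; const; id)
open import Function.Bundles using (_⇔_; Equivalence; mk⇔)
open import Function.Definitions using (Injective)
open import Relation.Binary.Definitions using (DecidableEquality)
open import Relation.Binary.PropositionalEquality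
  using (_≡_; _≢_; _≗_; refl; sym; trans; cong; cong₂; subst; subst₂; module ≡-Reasoning)
open import Relation.Nullary using (Dec; does; yes; no; ¬_; ¬?; contradiction)
open import Relation.Unary using (Decidable)
open import Relation.Nullary.Decidable using (dec-true; dec-false; toWitness; _×-dec_)

-- The obstacle is that gluing loses accuracy while the induction has unboundedly many steps. Close
-- means at most `T` errors, with `T` proportional to `2 ^ (n - d)`, so `T` may only double when the
-- dimension grows by one; but Chebyshev's inequality returns a polynomial with up to `8 * T`
-- errors. The second moment estimate repairs this: it is still valid at `8 * T` errors, and more
-- than `2 * T` errors already force a constant rejection probability. So either the threshold is
-- restored or the test rejects often, and no error accumulates. The other branch loses a share of
-- the directions of order `2 ^ d / 2 ^ n`. These shares are summable, but near `n = d + 1` they are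
-- too large, so small codimensions get a cruder step, which allows no errors and costs a factor 4
-- each time. The factor `2 ^ d` has no constant in front because a flat has `2 ^ (d + 1)` points:
-- the mean number of errors on it is `2 ^ (d + 1)` times the distance, and the quadratic term takes
-- away at most half of that. All probabilities are kept as cross-multiplied counts until the very
-- end.

private
  variable
    A B : Set
    k m n : ℕ

-- Finite sums of natural numbers

𝟙 : Bool → ℕ
𝟙 b = if b then 1 else 0

∑ : List A → (A → ℕ) → ℕ
∑ []       h = 0
∑ (x ∷ xs) h = h x + ∑ xs h

∑-cong : ∀ (xs : List A) {h h′ : A → ℕ} → h ≗ h′ → ∑ xs h ≡ ∑ xs h′
∑-cong []       eq = refl
∑-cong (x ∷ xs) eq = cong₂ _+_ (eq x) (∑-cong xs eq)

∑-mono : ∀ (xs : List A) {h h′ : A → ℕ} → (∀ x → h x ≤ h′ x) → ∑ xs h ≤ ∑ xs h′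
∑-mono []       le = z≤n
∑-mono (x ∷ xs) le = ℕ.+-mono-≤ (le x) (∑-mono xs le)

∑-zero : ∀ (xs : List A) → ∑ xs (const 0) ≡ 0
∑-zero []       = refl
∑-zero (x ∷ xs) = ∑-zero xs

∑-+ : ∀ (xs : List A) (h h′ : A → ℕ) → ∑ xs (λ x → h x + h′ x) ≡ ∑ xs h + ∑ xs h′
∑-+ []       h h′ = refl
∑-+ (x ∷ xs) h h′ = trans (cong (_+_ (h x + h′ x)) (∑-+ xs h h′))
  (CommutativeSemigroupProperties.interchange ℕ.+-commutativeSemigroup (h x) (h′ x) (∑ xs h) (∑ xs h′))

∑-* : ∀ (xs : List A) c (h : A → ℕ) → ∑ xs (λ x → c * h x) ≡ c * ∑ xs h
∑-* []       c h = sym (ℕ.*-zeroʳ c)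
∑-* (x ∷ xs) c h = trans (cong (_+_ (c * h x)) (∑-* xs c h)) (sym (ℕ.*-distribˡ-+ c (h x) (∑ xs h)))

∑-*ʳ : ∀ (xs : List A) c (h : A → ℕ) → ∑ xs (λ x → h x * c) ≡ ∑ xs h * c
∑-*ʳ xs c h = trans (∑-cong xs λ x → ℕ.*-comm (h x) c) (trans (∑-* xs c h) (ℕ.*-comm c (∑ xs h)))

∑-const : ∀ (xs : List A) c → ∑ xs (const c) ≡ length xs * c
∑-const []       c = refl
∑-const (x ∷ xs) c = cong (c +_) (∑-const xs c)

∑-1 : (xs : List A) → ∑ xs (const 1) ≡ length xs
∑-1 xs = trans (∑-const xs 1) (ℕ.*-identityʳ (length xs))

∑-swap : ∀ (xs : List A) (ys : List B) (h : A → B → ℕ) →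
         ∑ xs (λ x → ∑ ys (h x)) ≡ ∑ ys (λ y → ∑ xs (λ x → h x y))
∑-swap []       ys h = sym (∑-zero ys)
∑-swap (x ∷ xs) ys h = trans (cong (∑ ys (h x) +_) (∑-swap xs ys h)) (sym (∑-+ ys (h x) _))

∑-++ : ∀ (xs ys : List A) (h : A → ℕ) → ∑ (xs ++ ys) h ≡ ∑ xs h + ∑ ys h
∑-++ []       ys h = refl
∑-++ (x ∷ xs) ys h = trans (cong (h x +_) (∑-++ xs ys h)) (sym (ℕ.+-assoc (h x) (∑ xs h) (∑ ys h)))

∑-map : ∀ (φ : A → B) (xs : List A) (h : B → ℕ) → ∑ (map φ xs) h ≡ ∑ xs (h ∘ φ)
∑-map φ []       h = refl
∑-map φ (x ∷ xs) h = cong (h (φ x) +_) (∑-map φ xs h)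

∑-cartesianProductWith : ∀ {C : Set} (φ : A → B → C) xs ys (h : C → ℕ) →
  ∑ (cartesianProductWith φ xs ys) h ≡ ∑ xs (λ x → ∑ ys (λ y → h (φ x y)))
∑-cartesianProductWith φ []       ys h = refl
∑-cartesianProductWith φ (x ∷ xs) ys h = trans (∑-++ (map (φ x) ys) _ h)
  (cong₂ _+_ (∑-map (φ x) ys h) (∑-cartesianProductWith φ xs ys h))

∑-cube-suc : ∀ n (h : F₂^ (suc n) → ℕ) →
  ∑ (cube (suc n)) h ≡ ∑ (cube n) (h ∘ (false ∷_)) + ∑ (cube n) (h ∘ (true ∷_))
∑-cube-suc n h = trans (∑-cartesianProductWith _∷_ (false ∷ true ∷ []) (cube n) h)
  (cong (∑ (cube n) (h ∘ (false ∷_)) +_) (ℕ.+-identityʳ _))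

∑-cube-1 : ∀ n → ∑ (cube n) (const 1) ≡ 2 ^ n
∑-cube-1 zero    = refl
∑-cube-1 (suc n) = trans (∑-cube-suc n (const 1))
  (cong₂ _+_ (∑-cube-1 n) (trans (∑-cube-1 n) (sym (ℕ.+-identityʳ _))))

length-cube : ∀ n → length (cube n) ≡ 2 ^ n
length-cube n = trans (sym (∑-1 (cube n))) (∑-cube-1 n)

∑-cube-const : ∀ n c → ∑ (cube n) (const c) ≡ 2 ^ n * c
∑-cube-const n c = trans (∑-cong (cube n) (λ _ → sym (ℕ.*-identityˡ c)))
  (trans (∑-*ʳ (cube n) c (const 1)) (cong (_* c) (∑-cube-1 n)))

term≤∑ : ∀ {xs : List A} (h : A → ℕ) {x} → x ∈ xs → h x ≤ ∑ xs h
term≤∑ h (here refl) = ℕ.m≤m+n _ _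
term≤∑ {xs = y ∷ xs} h (there x∈) = ℕ.≤-trans (term≤∑ h x∈) (ℕ.m≤n+m _ (h y))

-- Change of variables in sums over enumerated types

record Enumeration (A : Set) : Set where
  infix 4 _≈?_
  field
    elements : List A
    unique   : Unique elements
    complete : ∀ x → x ∈ elements
    _≈?_     : DecidableEquality A

  private
    not-in : ∀ {xs z} → z ∉ xs → (h : A → ℕ) → ∑ xs (λ x → 𝟙 (does (x ≈? z)) * h x) ≡ 0
    not-in {[]}     z∉ h = refl
    not-in {x ∷ xs} {z} z∉ h with x ≈? z
    ... | yes refl = contradiction (here refl) z∉
    ... | no _     = not-in (z∉ ∘ there) h

    is-in : ∀ {xs z} → Unique xs → z ∈ xs → (h : A → ℕ) →
            ∑ xs (λ x → 𝟙 (does (x ≈? z)) * h x) ≡ h z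
    is-in {x ∷ xs} {z} (x∉ ∷ uniq) z∈ h with x ≈? z
    ... | yes refl = trans (cong (1 * h x +_) (not-in (λ x∈ → All.lookup x∉ x∈ refl) h))
                           (trans (ℕ.+-identityʳ _) (ℕ.+-identityʳ _))
    is-in {x ∷ xs} {z} (x∉ ∷ uniq) (here z≡x) h | no x≢z = contradiction (sym z≡x) x≢z
    is-in {x ∷ xs} {z} (x∉ ∷ uniq) (there z∈) h | no x≢z = is-in uniq z∈ h

  ∑-delta : ∀ z (h : A → ℕ) → ∑ elements (λ x → 𝟙 (does (x ≈? z)) * h x) ≡ h z
  ∑-delta z h = is-in unique (complete z) h

open Enumeration

does-cong : ∀ {P Q : Set} (P? : Dec P) (Q? : Dec Q) → (P → Q) → (Q → P) → does P? ≡ does Q?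
does-cong P? (yes q) f g = dec-true P? (g q)
does-cong P? (no ¬q) f g = dec-false P? (¬q ∘ f)

does-true : ∀ {P : Set} (P? : Dec P) → does P? ≡ true → P
does-true (yes p) _ = p

does-false : ∀ {P : Set} (P? : Dec P) → does P? ≡ false → ¬ P
does-false (no ¬p) _ = ¬p

-- Each `h (φ x)` is expanded as a sum over `y` against the indicator of `y ≡ φ x`. After exchanging
-- the sums, injectivity leaves at most one `x` over each `y`, and the last hypothesis says that the
-- points missed by `φ` have weight zero.
∑-transport : (EA : Enumeration A) (EB : Enumeration B) (φ : A → B) → Injective _≡_ _≡_ φ →
  (h : B → ℕ) → (∀ y → h y ≡ 0 ⊎ ∃ λ x → φ x ≡ y) → ∑ (elements EA) (h ∘ φ) ≡ ∑ (elements EB) h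
∑-transport EA EB φ inj h support = begin
  ∑ xs (h ∘ φ)                                               ≡⟨ ∑-cong xs (λ x → sym (∑-delta EB (φ x) h)) ⟩
  ∑ xs (λ x → ∑ ys (λ y → 𝟙 (does (y ≟ᴮ φ x)) * h y))        ≡⟨ ∑-swap xs ys _ ⟩
  ∑ ys (λ y → ∑ xs (λ x → 𝟙 (does (y ≟ᴮ φ x)) * h y))        ≡⟨ ∑-cong ys (λ y → fibre y (support y)) ⟩
  ∑ ys h                                                     ∎
  where
  open ≡-Reasoning
  xs = elements EA
  ys = elements EB
  _≟ᴮ_ = _≈?_ EB

  fibre : ∀ y → (h y ≡ 0 ⊎ ∃ λ x → φ x ≡ y) → ∑ xs (λ x → 𝟙 (does (y ≟ᴮ φ x)) * h y) ≡ h y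
  fibre y (inj₁ hy≡0) = trans
    (∑-cong xs (λ x → trans (cong (𝟙 (does (y ≟ᴮ φ x)) *_) hy≡0) (ℕ.*-zeroʳ (𝟙 (does (y ≟ᴮ φ x))))))
    (trans (∑-zero xs) (sym hy≡0))
  fibre y (inj₂ (x₀ , refl)) = trans
    (∑-cong xs (λ x → cong (λ b → 𝟙 b * h (φ x₀))
      (does-cong (φ x₀ ≟ᴮ φ x) (_≈?_ EA x x₀) (sym ∘ inj) (cong φ ∘ sym))))
    (∑-delta EA x₀ (const (h (φ x₀))))

∑-reindex : (EA : Enumeration A) (EB : Enumeration B) (φ : A → B) → Injective _≡_ _≡_ φ →
  (p : B → Bool) → (∀ x → p (φ x) ≡ true) → (∀ y → p y ≡ true → ∃ λ x → φ x ≡ y) →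
  (h : B → ℕ) → ∑ (elements EA) (h ∘ φ) ≡ ∑ (elements EB) (λ y → 𝟙 (p y) * h y)
∑-reindex EA EB φ inj p p-φ φ-p h = trans
  (∑-cong (elements EA) (λ x → sym (trans (cong (λ b → 𝟙 b * h (φ x)) (p-φ x)) (ℕ.+-identityʳ (h (φ x))))))
  (∑-transport EA EB φ inj (λ y → 𝟙 (p y) * h y) (λ y → support y (p y) refl))
  where
  support : ∀ y b → p y ≡ b → 𝟙 (p y) * h y ≡ 0 ⊎ ∃ λ x → φ x ≡ y
  support y false py = inj₁ (cong (λ b → 𝟙 b * h y) py)
  support y true  py = inj₂ (φ-p y py)

∑-permute : (E : Enumeration A) (φ : A → A) → (∀ x → φ (φ x) ≡ x) →
            (h : A → ℕ) → ∑ (elements E) (h ∘ φ) ≡ ∑ (elements E) h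
∑-permute E φ φφ h = trans
  (∑-reindex E E φ (λ {x} {y} eq → trans (sym (φφ x)) (trans (cong φ eq) (φφ y)))
    (const true) (λ _ → refl) (λ y _ → φ y , φφ y) h)
  (∑-cong (elements E) (λ x → ℕ.+-identityʳ (h x)))

cubeᴱ : ∀ n → Enumeration (F₂^ n)
cubeᴱ n = record
  { elements = cube n ; unique = cube-unique n ; complete = cube-complete ; _≈?_ = _≟_ }

tuples : ∀ k n → List (Vec (F₂^ n) k)
tuples zero    n = [] ∷ []
tuples (suc k) n = cartesianProductWith _∷_ (cube n) (tuples k n)

tuplesᴱ : ∀ k n → Enumeration (Vec (F₂^ n) k)
tuplesᴱ k n = record
  { elements = tuples k n ; unique = uniq k ; complete = comp ; _≈?_ = Vecₚ.≡-dec _≟_ }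
  where
  uniq : ∀ k → Unique (tuples k n)
  uniq zero    = [] ∷ []
  uniq (suc k) = Uniqueₚ.cartesianProductWith⁺ _∷_ Vecₚ.∷-injective (cube-unique n) (uniq k)
  comp : ∀ {k} (vs : Vec (F₂^ n) k) → vs ∈ tuples k n
  comp []       = here refl
  comp (v ∷ vs) = ∈.∈-cartesianProductWith⁺ _∷_ (cube-complete v) (comp vs)

∑-tuples-suc : ∀ k n (h : Vec (F₂^ n) (suc k) → ℕ) →
  ∑ (tuples (suc k) n) h ≡ ∑ (cube n) (λ v → ∑ (tuples k n) (λ vs → h (v ∷ vs)))
∑-tuples-suc k n h = ∑-cartesianProductWith _∷_ (cube n) (tuples k n) h

∑-tuples-const : ∀ k n c → ∑ (tuples k n) (const c) ≡ (2 ^ n) ^ k * c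
∑-tuples-const zero    n c = refl
∑-tuples-const (suc k) n c = trans (∑-tuples-suc k n (const c)) (trans
  (∑-cong (cube n) (λ _ → ∑-tuples-const k n c)) (trans
  (∑-cube-const n _) (sym (ℕ.*-assoc (2 ^ n) ((2 ^ n) ^ k) c))))

-- Vectors, the bilinear form and hyperplanes over F₂

𝟎 : F₂^ n
𝟎 = replicate _ false

⊕-comm : (x y : F₂^ n) → x ⊕ y ≡ y ⊕ x
⊕-comm = Vecₚ.zipWith-comm Bool.xor-comm

⊕-assoc : (x y z : F₂^ n) → (x ⊕ y) ⊕ z ≡ x ⊕ (y ⊕ z)
⊕-assoc = Vecₚ.zipWith-assoc Bool.xor-assoc

⊕-identityˡ : (x : F₂^ n) → 𝟎 ⊕ x ≡ x
⊕-identityˡ = Vecₚ.zipWith-identityˡ Bool.xor-identityˡ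

⊕-identityʳ : (x : F₂^ n) → x ⊕ 𝟎 ≡ x
⊕-identityʳ = Vecₚ.zipWith-identityʳ Bool.xor-identityʳ

⊕-self : (x : F₂^ n) → x ⊕ x ≡ 𝟎
⊕-self []      = refl
⊕-self (b ∷ x) = cong₂ _∷_ (Bool.xor-same b) (⊕-self x)

⊕-cancelʳ : (x y : F₂^ n) → (x ⊕ y) ⊕ y ≡ x
⊕-cancelʳ x y = trans (⊕-assoc x y y) (trans (cong (x ⊕_) (⊕-self y)) (⊕-identityʳ x))

⊕-cancelˡ : (x y : F₂^ n) → x ⊕ (x ⊕ y) ≡ y
⊕-cancelˡ x y = trans (sym (⊕-assoc x x y)) (trans (cong (_⊕ y) (⊕-self x)) (⊕-identityˡ y))

⊕-swap : (x y z : F₂^ n) → (x ⊕ y) ⊕ z ≡ (x ⊕ z) ⊕ y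
⊕-swap x y z = trans (⊕-assoc x y z) (trans (cong (x ⊕_) (⊕-comm y z)) (sym (⊕-assoc x z y)))

⊕-interchange : (w x y z : F₂^ n) → (w ⊕ x) ⊕ (y ⊕ z) ≡ (w ⊕ y) ⊕ (x ⊕ z)
⊕-interchange w x y z = trans (sym (⊕-assoc (w ⊕ x) y z))
  (trans (cong (_⊕ z) (⊕-swap w x y)) (⊕-assoc (w ⊕ y) x z))

⊕≡𝟎⇒≡ : (x y : F₂^ n) → x ⊕ y ≡ 𝟎 → x ≡ y
⊕≡𝟎⇒≡ x y eq = trans (sym (⊕-cancelʳ x y)) (trans (cong (_⊕ y) eq) (⊕-identityˡ y))

∑-translate : ∀ (v : F₂^ n) (h : F₂^ n → ℕ) → ∑ (cube n) (λ x → h (x ⊕ v)) ≡ ∑ (cube n) h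
∑-translate v h = ∑-permute (cubeᴱ _) (_⊕ v) (λ x → ⊕-cancelʳ x v) h

∑-translateˡ : ∀ (v : F₂^ n) (h : F₂^ n → ℕ) → ∑ (cube n) (λ x → h (v ⊕ x)) ≡ ∑ (cube n) h
∑-translateˡ v h = ∑-permute (cubeᴱ _) (v ⊕_) (⊕-cancelˡ v) h

xor-interchange : ∀ a b c d → (a xor b) xor (c xor d) ≡ (a xor c) xor (b xor d)
xor-interchange = solve 4 (λ a b c d → (a :+ b) :+ (c :+ d) := (a :+ c) :+ (b :+ d)) refl
  where open xor-∧-Solver

xor-cancelˡ : ∀ a b → a xor (a xor b) ≡ b
xor-cancelˡ false b = refl
xor-cancelˡ true  b = Bool.not-involutive b

xor-sandwich : ∀ a b → a xor (b xor a) ≡ b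
xor-sandwich a b = trans (cong (a xor_) (Bool.xor-comm b a)) (xor-cancelˡ a b)

infix 8 _∙_
_∙_ : F₂^ n → F₂^ n → F₂
[]      ∙ []      = false
(a ∷ x) ∙ (b ∷ y) = (a ∧ b) xor (x ∙ y)

∙-comm : (x y : F₂^ n) → x ∙ y ≡ y ∙ x
∙-comm []      []      = refl
∙-comm (a ∷ x) (b ∷ y) = cong₂ _xor_ (Bool.∧-comm a b) (∙-comm x y)

∙-⊕ʳ : (x y z : F₂^ n) → x ∙ (y ⊕ z) ≡ x ∙ y xor x ∙ z
∙-⊕ʳ []      []      []      = refl
∙-⊕ʳ (a ∷ x) (b ∷ y) (c ∷ z) = trans
  (cong₂ _xor_ (Bool.∧-distribˡ-xor a b c) (∙-⊕ʳ x y z))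
  (xor-interchange (a ∧ b) (a ∧ c) (x ∙ y) (x ∙ z))

∙-⊕ˡ : (x y z : F₂^ n) → (x ⊕ y) ∙ z ≡ x ∙ z xor y ∙ z
∙-⊕ˡ x y z = trans (∙-comm (x ⊕ y) z) (trans (∙-⊕ʳ z x y) (cong₂ _xor_ (∙-comm z x) (∙-comm z y)))

∙-𝟎ˡ : (x : F₂^ n) → 𝟎 ∙ x ≡ false
∙-𝟎ˡ []      = refl
∙-𝟎ˡ (_ ∷ x) = ∙-𝟎ˡ x

∙-𝟎ʳ : (x : F₂^ n) → x ∙ 𝟎 ≡ false
∙-𝟎ʳ x = trans (∙-comm x 𝟎) (∙-𝟎ˡ x)

on : F₂^ n → F₂ → F₂^ n → Bool
on l b x = not (b xor l ∙ x)

on⁺ : ∀ (l : F₂^ n) b x → l ∙ x ≡ b → on l b x ≡ true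
on⁺ l b x refl = cong not (Bool.xor-same (l ∙ x))

on⁻ : ∀ (l : F₂^ n) b x → on l b x ≡ true → l ∙ x ≡ b
on⁻ l false x eq with false ← l ∙ x = refl
on⁻ l true  x eq with true ← l ∙ x = refl

𝟙-not : ∀ b → 𝟙 (not b) + 𝟙 b ≡ 1
𝟙-not false = refl
𝟙-not true  = refl

∑-hyperplane : ∀ (l : F₂^ n) b → l ≢ 𝟎 → 2 * ∑ (cube n) (𝟙 ∘ on l b) ≡ 2 ^ n
∑-hyperplane []          b l≢𝟎 = contradiction refl l≢𝟎
∑-hyperplane {suc n} (false ∷ l) b l≢𝟎 = trans (cong (2 *_) (∑-cube-suc n _))
  (cong (2 *_) (trans (cong (s +_) (sym (ℕ.+-identityʳ s)))
    (∑-hyperplane l b (l≢𝟎 ∘ cong (false ∷_)))))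
  where s = ∑ (cube n) (𝟙 ∘ on l b)
∑-hyperplane {suc n} (true ∷ l) b _ = cong (2 *_) (trans (∑-cube-suc n _) (trans
  (sym (∑-+ (cube n) _ _)) (trans (∑-cong (cube n) (λ x → halves b (l ∙ x))) (∑-cube-1 n))))
  where
  halves : ∀ b c → 𝟙 (not (b xor c)) + 𝟙 (not (b xor not c)) ≡ 1
  halves false false = refl
  halves false true  = refl
  halves true  false = refl
  halves true  true  = refl

-- The third hyperplane, with direction `l ⊕ m`, contains a point iff it lies on both or neither of
-- the given ones. Hence the three indicators add up to one plus twice the product of the first two,
-- and only counts of single hyperplanes are needed.
∑-two-hyperplanes : ∀ (l m : F₂^ n) b c → l ≢ 𝟎 → m ≢ 𝟎 → l ≢ m →
  4 * ∑ (cube n) (λ x → 𝟙 (on l b x) * 𝟙 (on m c x)) ≡ 2 ^ n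
∑-two-hyperplanes {n} l m b c l≢𝟎 m≢𝟎 l≢m = ℕ.+-cancelˡ-≡ (2 * 2 ^ n) _ _ (begin
  2 * N + 4 * S                      ≡⟨ solve 2 (λ N S → con 2 :* N :+ con 4 :* S := con 2 :* (N :+ con 2 :* S)) refl N S ⟩
  2 * (N + 2 * S)                    ≡⟨ cong (2 *_) (sym sums) ⟩
  2 * ((X + Y) + Z)                  ≡⟨ solve 3 (λ X Y Z → con 2 :* ((X :+ Y) :+ Z) := con 2 :* X :+ con 2 :* Y :+ con 2 :* Z) refl X Y Z ⟩
  2 * X + 2 * Y + 2 * Z              ≡⟨ cong₂ _+_ (cong₂ _+_ (∑-hyperplane l b l≢𝟎) (∑-hyperplane m c m≢𝟎))
                                          (∑-hyperplane (l ⊕ m) (b xor c) (l≢m ∘ ⊕≡𝟎⇒≡ l m)) ⟩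
  N + N + N                          ≡⟨ solve 1 (λ N → N :+ N :+ N := con 2 :* N :+ N) refl N ⟩
  2 * N + N                          ∎)
  where
  open ≡-Reasoning
  open +-*-Solver
  N = 2 ^ n
  X = ∑ (cube n) (𝟙 ∘ on l b)
  Y = ∑ (cube n) (𝟙 ∘ on m c)
  Z = ∑ (cube n) (𝟙 ∘ on (l ⊕ m) (b xor c))
  S = ∑ (cube n) (λ x → 𝟙 (on l b x) * 𝟙 (on m c x))

  bits : ∀ p q → 𝟙 (not p) + 𝟙 (not q) + 𝟙 (not (p xor q)) ≡ 1 + 2 * (𝟙 (not p) * 𝟙 (not q))
  bits false false = refl
  bits false true  = refl
  bits true  false = refl
  bits true  true  = refl

  sums : (X + Y) + Z ≡ N + 2 * S
  sums = begin
    (X + Y) + Z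
      ≡⟨ cong (_+ Z) (sym (∑-+ (cube n) _ _)) ⟩
    ∑ (cube n) (λ x → 𝟙 (on l b x) + 𝟙 (on m c x)) + Z
      ≡⟨ sym (∑-+ (cube n) _ _) ⟩
    ∑ (cube n) (λ x → 𝟙 (on l b x) + 𝟙 (on m c x) + 𝟙 (on (l ⊕ m) (b xor c) x))
      ≡⟨ ∑-cong (cube n) (λ x → trans
           (cong (λ q → 𝟙 (on l b x) + 𝟙 (on m c x) + 𝟙 (not q))
             (trans (cong ((b xor c) xor_) (∙-⊕ˡ l m x)) (xor-interchange b c (l ∙ x) (m ∙ x))))
           (bits (b xor l ∙ x) (c xor m ∙ x))) ⟩
    ∑ (cube n) (λ x → 1 + 2 * (𝟙 (on l b x) * 𝟙 (on m c x)))
      ≡⟨ ∑-+ (cube n) _ _ ⟩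
    ∑ (cube n) (const 1) + ∑ (cube n) (λ x → 2 * (𝟙 (on l b x) * 𝟙 (on m c x)))
      ≡⟨ cong₂ _+_ (∑-cube-1 n) (∑-* (cube n) 2 _) ⟩
    N + 2 * S ∎

-- Iterated derivatives, degree and minimum distance

D : Vec (F₂^ n) k → (F₂^ n → F₂) → F₂^ n → F₂
D []       f a = f a
D (v ∷ vs) f a = D vs f a xor D vs f (a ⊕ v)

D-cong : ∀ (vs : Vec (F₂^ n) k) {f g : F₂^ n → F₂} → f ≗ g → ∀ a → D vs f a ≡ D vs g a
D-cong []       f≗g a = f≗g a
D-cong (v ∷ vs) f≗g a = cong₂ _xor_ (D-cong vs f≗g a) (D-cong vs f≗g (a ⊕ v))

D-false : ∀ (vs : Vec (F₂^ n) k) a → D vs (const false) a ≡ false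
D-false []       a = refl
D-false (v ∷ vs) a = cong₂ _xor_ (D-false vs a) (D-false vs (a ⊕ v))

D-xor : ∀ (vs : Vec (F₂^ n) k) (f g : F₂^ n → F₂) a →
        D vs (λ x → f x xor g x) a ≡ D vs f a xor D vs g a
D-xor []       f g a = refl
D-xor (v ∷ vs) f g a = trans (cong₂ _xor_ (D-xor vs f g a) (D-xor vs f g (a ⊕ v)))
  (xor-interchange (D vs f a) (D vs g a) (D vs f (a ⊕ v)) (D vs g (a ⊕ v)))

-- `φ₀` is the linear part of `φ`. This form covers translations, halves of the cube, charts of
-- hyperplanes and the projections used for interpolation.
D-affine : ∀ {φ φ₀ : F₂^ m → F₂^ n} → (∀ x v → φ (x ⊕ v) ≡ φ x ⊕ φ₀ v) →
           ∀ (vs : Vec (F₂^ m) k) (f : F₂^ n → F₂) a →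
           D vs (f ∘ φ) a ≡ D (Vec.map φ₀ vs) f (φ a)
D-affine φ-⊕ []       f a = refl
D-affine {φ = φ} {φ₀} φ-⊕ (v ∷ vs) f a = cong₂ _xor_ (D-affine φ-⊕ vs f a)
  (trans (D-affine φ-⊕ vs f (a ⊕ v)) (cong (D (Vec.map φ₀ vs) f) (φ-⊕ a v)))

D-translate : ∀ (vs : Vec (F₂^ n) k) (f : F₂^ n → F₂) v a →
              D vs (λ x → f (x ⊕ v)) a ≡ D vs f (a ⊕ v)
D-translate vs f v a = trans (D-affine {φ = _⊕ v} {id} (λ x u → ⊕-swap x u v) vs f a)
  (cong (λ us → D us f (a ⊕ v)) (Vecₚ.map-id vs))

∂ : F₂^ n → (F₂^ n → F₂) → F₂^ n → F₂
∂ v f x = f x xor f (x ⊕ v)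

D-∂ : ∀ (vs : Vec (F₂^ n) k) v (f : F₂^ n → F₂) a → D vs (∂ v f) a ≡ D (v ∷ vs) f a
D-∂ vs v f a = trans (D-xor vs f (λ x → f (x ⊕ v)) a) (cong (D vs f a xor_) (D-translate vs f v a))

-- Degree less than k: all k-th derivatives vanish.
Lo : ∀ k → (F₂^ n → F₂) → Set
Lo {n} k f = ∀ (vs : Vec (F₂^ n) k) a → D vs f a ≡ false

Lo-cong : {f g : F₂^ n → F₂} → f ≗ g → Lo k f → Lo k g
Lo-cong f≗g Lf vs a = trans (sym (D-cong vs f≗g a)) (Lf vs a)

Lo-false : ∀ k → Lo {n} k (const false)
Lo-false k vs a = D-false vs a

Lo-xor : {f g : F₂^ n → F₂} → Lo k f → Lo k g → Lo k (λ x → f x xor g x)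
Lo-xor Lf Lg vs a = trans (D-xor vs _ _ a) (cong₂ _xor_ (Lf vs a) (Lg vs a))

Lo-affine : {φ φ₀ : F₂^ m → F₂^ n} → (∀ x v → φ (x ⊕ v) ≡ φ x ⊕ φ₀ v) →
            {f : F₂^ n → F₂} → Lo k f → Lo k (f ∘ φ)
Lo-affine φ-⊕ {f} Lf vs a = trans (D-affine φ-⊕ vs f a) (Lf (Vec.map _ vs) _)

Lo-∂ : {f : F₂^ n → F₂} → Lo (suc k) f → ∀ v → Lo k (∂ v f)
Lo-∂ Lf v vs a = trans (D-∂ vs v _ a) (Lf (v ∷ vs) a)

-- By the Leibniz rule a derivative of the product splits in two: the affine factor times a
-- derivative of `f`, which is handled by induction on `k`, and the constant `l ∙ v` times a
-- translate of `f`, which has degree less than `k` already.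
Lo-on : ∀ k (l : F₂^ n) b {f : F₂^ n → F₂} → Lo k f → Lo (suc k) (λ x → on l b x ∧ f x)
Lo-on k l b {f} Lf (v ∷ vs) a = trans (sym (D-∂ vs v _ a)) (trans
  (D-cong vs leibniz a) (trans
  (D-xor vs (λ x → on l b x ∧ ∂ v f x) (λ x → l ∙ v ∧ f (x ⊕ v)) a)
  (cong₂ _xor_ (first k Lf vs) second)))
  where
  leibniz : ∀ x → (on l b x ∧ f x) xor (on l b (x ⊕ v) ∧ f (x ⊕ v))
                ≡ (on l b x ∧ ∂ v f x) xor (l ∙ v ∧ f (x ⊕ v))
  leibniz x = trans (cong (λ c → (on l b x ∧ f x) xor (not (b xor c) ∧ f (x ⊕ v))) (∙-⊕ʳ l x v))
                    (bits b (l ∙ x) (l ∙ v) (f x) (f (x ⊕ v)))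
    where
    bits : ∀ b p q s t → (not (b xor p) ∧ s) xor (not (b xor (p xor q)) ∧ t)
                       ≡ (not (b xor p) ∧ (s xor t)) xor (q ∧ t)
    bits = solve 5 (λ b p q s t →
        ((con true :+ (b :+ p)) :* s) :+ ((con true :+ (b :+ (p :+ q))) :* t)
        := ((con true :+ (b :+ p)) :* (s :+ t)) :+ (q :* t)) refl
      where open xor-∧-Solver

  first : ∀ k → Lo k f → (vs : Vec _ k) → D vs (λ x → on l b x ∧ ∂ v f x) a ≡ false
  first zero    Lf [] = trans (cong (on l b a ∧_) (cong₂ _xor_ (Lf [] a) (Lf [] (a ⊕ v)))) (Bool.∧-zeroʳ _)
  first (suc k) Lf vs = Lo-on k l b (Lo-∂ Lf v) vs a

  D-∧ : ∀ {k} (vs : Vec _ k) c g a → D vs (λ x → c ∧ g x) a ≡ c ∧ D vs g a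
  D-∧ []       c g a = refl
  D-∧ (u ∷ us) c g a = trans (cong₂ _xor_ (D-∧ us c g a) (D-∧ us c g (a ⊕ u)))
    (sym (Bool.∧-distribˡ-xor c (D us g a) (D us g (a ⊕ u))))

  second : D vs (λ x → l ∙ v ∧ f (x ⊕ v)) a ≡ false
  second = trans (D-∧ vs (l ∙ v) (λ x → f (x ⊕ v)) a) (trans
    (cong (l ∙ v ∧_) (trans (D-translate vs f v a) (Lf vs (a ⊕ v)))) (Bool.∧-zeroʳ _))

count : (F₂^ n → F₂) → ℕ
count {n} f = ∑ (cube n) (𝟙 ∘ f)

search : (f : F₂^ n → F₂) → (∃ λ x → f x ≡ true) ⊎ (f ≗ const false)
search f with anySubset? (λ x → f x Bool.≟ true)
... | yes ∃x = inj₁ ∃x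
... | no  ∄x = inj₂ (λ x → Bool.¬-not (λ fx → ∄x (x , fx)))

count-const-false : {f : F₂^ n → F₂} → f ≗ const false → count f ≡ 0
count-const-false {n} f≗ = trans (∑-cong (cube n) (λ x → cong 𝟙 (f≗ x))) (∑-zero (cube n))

count-suc : (f : F₂^ (suc n) → F₂) → count f ≡ count (f ∘ (false ∷_)) + count (f ∘ (true ∷_))
count-suc f = ∑-cube-suc _ (𝟙 ∘ f)

Lo-half : ∀ b {f : F₂^ (suc n) → F₂} → Lo k f → Lo k (f ∘ (b ∷_))
Lo-half b = Lo-affine {φ = b ∷_} {false ∷_} (λ x v → cong (_∷ (x ⊕ v)) (sym (Bool.xor-identityʳ b)))

-- The minimum distance of the Reed–Muller code.
weight-bound : ∀ k n {f : F₂^ n → F₂} → Lo (suc k) f → ∀ x → f x ≡ true → 2 ^ n ≤ count f * 2 ^ k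
weight-bound k zero {f} Lf [] fx = ℕ.≤-trans (ℕ.^-monoʳ-≤ 2 {y = k} z≤n)
  (ℕ.≤-reflexive (sym (trans (cong (λ b → (𝟙 b + 0) * 2 ^ k) fx) (ℕ.*-identityˡ (2 ^ k)))))
weight-bound k (suc n) {f} Lf (b ∷ x) fx = split b x fx (search (f ∘ (not b ∷_)))
  where
  open ℕ.≤-Reasoning
  flip : F₂^ (suc n)
  flip = true ∷ 𝟎

  halves : ∀ b → f ∘ (not b ∷_) ≗ const false → ∀ y → f (b ∷ y) ≡ ∂ flip f (b ∷ y)
  halves b z y = sym (trans (cong (f (b ∷ y) xor_) (trans (cong f (cong₂ _∷_ (Bool.xor-comm b true) (⊕-identityʳ y)))
    (z y))) (Bool.xor-identityʳ _))

  count-halves : ∀ b → count f ≡ count (f ∘ (b ∷_)) + count (f ∘ (not b ∷_))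
  count-halves false = count-suc f
  count-halves true  = trans (count-suc f) (ℕ.+-comm (count (f ∘ (false ∷_))) _)

  -- As the other half vanishes, `f` agrees on this half with `∂ flip f`, whose degree is one lower;
  -- this makes up for seeing only half of the cube.
  one-half : ∀ k → Lo (suc k) f → ∀ b x → f (b ∷ x) ≡ true →
             f ∘ (not b ∷_) ≗ const false → 2 ^ suc n ≤ count (f ∘ (b ∷_)) * 2 ^ k
  one-half zero Lf b x fx z = contradiction
    (trans (sym (Lf (flip ∷ []) (b ∷ x))) (trans (sym (halves b z x)) fx)) λ ()
  one-half (suc k) Lf b x fx z = begin
    2 * 2 ^ n               ≤⟨ ℕ.*-monoʳ-≤ 2 (weight-bound k n
                                 (Lo-cong (λ y → sym (halves b z y)) (Lo-half b (Lo-∂ Lf flip))) x fx) ⟩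
    2 * (c * 2 ^ k)         ≡⟨ solve 2 (λ c K → con 2 :* (c :* K) := c :* (con 2 :* K)) refl c (2 ^ k) ⟩
    c * 2 ^ suc k           ∎
    where
    open +-*-Solver
    c = count (f ∘ (b ∷_))

  split : ∀ b x → f (b ∷ x) ≡ true →
          (∃ λ y → f (not b ∷ y) ≡ true) ⊎ (f ∘ (not b ∷_) ≗ const false) →
          2 ^ suc n ≤ count f * 2 ^ k
  split b x fx (inj₁ (y , fy)) = begin
    2 ^ n + (2 ^ n + 0)         ≡⟨ cong (2 ^ n +_) (ℕ.+-identityʳ (2 ^ n)) ⟩
    2 ^ n + 2 ^ n               ≤⟨ ℕ.+-mono-≤ (weight-bound k n (Lo-half b Lf) x fx)
                                              (weight-bound k n (Lo-half (not b) Lf) y fy) ⟩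
    count (f ∘ (b ∷_)) * 2 ^ k + count (f ∘ (not b ∷_)) * 2 ^ k
                                ≡⟨ sym (ℕ.*-distribʳ-+ (2 ^ k) (count (f ∘ (b ∷_))) _) ⟩
    (count (f ∘ (b ∷_)) + count (f ∘ (not b ∷_))) * 2 ^ k
                                ≡⟨ cong (_* 2 ^ k) (sym (count-halves b)) ⟩
    count f * 2 ^ k             ∎
  split b x fx (inj₂ z) = ℕ.≤-trans (one-half k Lf b x fx z)
    (ℕ.*-monoˡ-≤ (2 ^ k) (ℕ.≤-trans (ℕ.m≤m+n (count (f ∘ (b ∷_))) (count (f ∘ (not b ∷_)))) (ℕ.≤-reflexive (sym (count-halves b)))))

-- The tuples vs need not be linearly independent: dependent ones have D vs f a ≡ false.
R : ∀ k → (F₂^ n → F₂) → ℕ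
R {n} k f = ∑ (tuples k n) (λ vs → ∑ (cube n) (λ a → 𝟙 (D vs f a)))

-- Second moment of the number of errors on a random flat

odd : ℕ → Bool
odd zero    = false
odd (suc m) = not (odd m)

odd-+ : ∀ p q → odd (p + q) ≡ odd p xor odd q
odd-+ zero    q = refl
odd-+ (suc p) q = trans (cong not (odd-+ p q)) (sym (Bool.xor-assoc true (odd p) (odd q)))

odd-𝟙 : ∀ b → odd (𝟙 b) ≡ b
odd-𝟙 false = refl
odd-𝟙 true  = refl

double≤square+odd : ∀ x → 2 * x ≤ x * x + 𝟙 (odd x)
double≤square+odd 0             = z≤n
double≤square+odd 1             = ℕ.≤-refl
double≤square+odd (suc (suc x)) = ℕ.≤-trans (ℕ.*-monoˡ-≤ (2 + x) (s≤s (s≤s (z≤n {x})))) (ℕ.m≤m+n _ _)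

weightOn : Vec (F₂^ n) k → (F₂^ n → F₂) → F₂^ n → ℕ
weightOn []       e a = 𝟙 (e a)
weightOn (v ∷ vs) e a = weightOn vs e a + weightOn vs e (a ⊕ v)

odd-weightOn : ∀ (vs : Vec (F₂^ n) k) e a → odd (weightOn vs e a) ≡ D vs e a
odd-weightOn []       e a = odd-𝟙 (e a)
odd-weightOn (v ∷ vs) e a = trans (odd-+ (weightOn vs e a) _)
  (cong₂ _xor_ (odd-weightOn vs e a) (odd-weightOn vs e (a ⊕ v)))

∑-weightOn : ∀ (vs : Vec (F₂^ n) k) e → ∑ (cube n) (weightOn vs e) ≡ 2 ^ k * count e
∑-weightOn []       e = sym (ℕ.+-identityʳ _)
∑-weightOn {n} {suc k} (v ∷ vs) e = begin
  ∑ (cube n) (λ a → w a + w (a ⊕ v))            ≡⟨ ∑-+ (cube n) w _ ⟩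
  ∑ (cube n) w + ∑ (cube n) (λ a → w (a ⊕ v))   ≡⟨ cong (∑ (cube n) w +_) (∑-translate v w) ⟩
  ∑ (cube n) w + ∑ (cube n) w                   ≡⟨ cong₂ _+_ (∑-weightOn vs e) (∑-weightOn vs e) ⟩
  2 ^ k * count e + 2 ^ k * count e             ≡⟨ solve 2 (λ p E → p :* E :+ p :* E := (con 2 :* p) :* E) refl (2 ^ k) (count e) ⟩
  2 ^ suc k * count e                           ∎
  where
  open ≡-Reasoning
  open +-*-Solver
  w = weightOn vs e

-- For uniform `v` the points `a` and `a ⊕ v` are independent, so the cross terms contribute the
-- square of the total sum.
∑-squares : ∀ n (x : F₂^ n → ℕ) →
  ∑ (cube n) (λ v → ∑ (cube n) (λ a → (x a + x (a ⊕ v)) * (x a + x (a ⊕ v))))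
  ≡ 2 * (2 ^ n * ∑ (cube n) (λ a → x a * x a)) + 2 * (∑ (cube n) x * ∑ (cube n) x)
∑-squares n x = begin
  ∑ (cube n) (λ v → ∑ (cube n) (λ a → (x a + x (a ⊕ v)) * (x a + x (a ⊕ v))))
    ≡⟨ ∑-cong (cube n) (λ v → expand v) ⟩
  ∑ (cube n) (λ v → (S₂ + S₂) + ∑ (cube n) (λ a → (2 * x a) * x (a ⊕ v)))
    ≡⟨ ∑-+ (cube n) _ _ ⟩
  ∑ (cube n) (const (S₂ + S₂)) + ∑ (cube n) (λ v → ∑ (cube n) (λ a → (2 * x a) * x (a ⊕ v)))
    ≡⟨ cong₂ _+_ (∑-cube-const n _) cross ⟩
  2 ^ n * (S₂ + S₂) + (2 * S) * S
    ≡⟨ solve 3 (λ N S₂ S → N :* (S₂ :+ S₂) :+ (con 2 :* S) :* S := con 2 :* (N :* S₂) :+ con 2 :* (S :* S)) refl (2 ^ n) S₂ S ⟩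
  2 * (2 ^ n * S₂) + 2 * (S * S) ∎
  where
  open ≡-Reasoning
  open +-*-Solver
  S  = ∑ (cube n) x
  S₂ = ∑ (cube n) (λ a → x a * x a)

  expand : ∀ v → ∑ (cube n) (λ a → (x a + x (a ⊕ v)) * (x a + x (a ⊕ v)))
               ≡ (S₂ + S₂) + ∑ (cube n) (λ a → (2 * x a) * x (a ⊕ v))
  expand v = begin
    ∑ (cube n) (λ a → (x a + x (a ⊕ v)) * (x a + x (a ⊕ v)))
      ≡⟨ ∑-cong (cube n) (λ a → solve 2 (λ p q → (p :+ q) :* (p :+ q) := (p :* p :+ q :* q) :+ (con 2 :* p) :* q)
           refl (x a) (x (a ⊕ v))) ⟩
    ∑ (cube n) (λ a → (x a * x a + x (a ⊕ v) * x (a ⊕ v)) + (2 * x a) * x (a ⊕ v))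
      ≡⟨ ∑-+ (cube n) _ _ ⟩
    ∑ (cube n) (λ a → x a * x a + x (a ⊕ v) * x (a ⊕ v)) + ∑ (cube n) (λ a → (2 * x a) * x (a ⊕ v))
      ≡⟨ cong (_+ ∑ (cube n) (λ a → (2 * x a) * x (a ⊕ v))) (trans (∑-+ (cube n) _ _) (cong (S₂ +_) (∑-translate v (λ a → x a * x a)))) ⟩
    (S₂ + S₂) + ∑ (cube n) (λ a → (2 * x a) * x (a ⊕ v)) ∎

  cross : ∑ (cube n) (λ v → ∑ (cube n) (λ a → (2 * x a) * x (a ⊕ v))) ≡ (2 * S) * S
  cross = begin
    ∑ (cube n) (λ v → ∑ (cube n) (λ a → (2 * x a) * x (a ⊕ v)))  ≡⟨ ∑-swap (cube n) (cube n) _ ⟩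
    ∑ (cube n) (λ a → ∑ (cube n) (λ v → (2 * x a) * x (a ⊕ v)))  ≡⟨ ∑-cong (cube n) (λ a →
      trans (∑-* (cube n) (2 * x a) _) (cong (2 * x a *_) (∑-translateˡ a x))) ⟩
    ∑ (cube n) (λ a → (2 * x a) * S)                             ≡⟨ ∑-*ʳ (cube n) S _ ⟩
    ∑ (cube n) (λ a → 2 * x a) * S                               ≡⟨ cong (_* S) (∑-* (cube n) 2 x) ⟩
    (2 * S) * S                                                  ∎

-- With mean `w / 2 ^ n` this bounds the second moment by the mean plus its square, as for pairwise
-- independent points. Adding a direction doubles `w`, and the cross terms from `∑-squares` supply
-- exactly what the square of the doubled mean needs.
second-moment : ∀ k (e : F₂^ n → F₂) → let w = 2 ^ k * count e in
  2 ^ n * ∑ (tuples k n) (λ vs → ∑ (cube n) (λ a → weightOn vs e a * weightOn vs e a))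
  ≤ (2 ^ n) ^ k * (2 ^ n * w + w * w)
second-moment {n} zero e = ℕ.≤-trans (ℕ.≤-reflexive (cong (2 ^ n *_)
    (trans (ℕ.+-identityʳ _) (trans (∑-cong (cube n) (λ a → idem (e a))) (sym (ℕ.+-identityʳ _))))))
  (ℕ.≤-trans (ℕ.m≤m+n (2 ^ n * (count e + 0)) _) (ℕ.≤-reflexive (sym (ℕ.+-identityʳ _))))
  where
  idem : ∀ b → 𝟙 b * 𝟙 b ≡ 𝟙 b
  idem false = refl
  idem true  = refl
second-moment {n} (suc k) e = begin
  N * ∑ (tuples (suc k) n) (λ vs → ∑ (cube n) (λ a → weightOn vs e a * weightOn vs e a))
    ≡⟨ cong (N *_) recurrence ⟩
  N * (2 * (N * Q) + 2 * (N ^ k * (w * w)))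
    ≡⟨ solve 4 (λ N Q K w → N :* (con 2 :* (N :* Q) :+ con 2 :* (K :* (w :* w)))
         := (con 2 :* N) :* (N :* Q) :+ (con 2 :* N) :* (K :* (w :* w))) refl N Q (N ^ k) w ⟩
  (2 * N) * (N * Q) + (2 * N) * (N ^ k * (w * w))
    ≤⟨ ℕ.+-monoˡ-≤ _ (ℕ.*-monoʳ-≤ (2 * N) (second-moment k e)) ⟩
  (2 * N) * (N ^ k * (N * w + w * w)) + (2 * N) * (N ^ k * (w * w))
    ≡⟨ solve 4 (λ N K p E → let w = p :* E in let w′ = (con 2 :* p) :* E in
         (con 2 :* N) :* (K :* (N :* w :+ w :* w)) :+ (con 2 :* N) :* (K :* (w :* w))
         := (N :* K) :* (N :* w′ :+ w′ :* w′)) refl N (N ^ k) (2 ^ k) (count e) ⟩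
  N ^ suc k * (N * w′ + w′ * w′) ∎
  where
  open ℕ.≤-Reasoning
  open +-*-Solver
  N  = 2 ^ n
  w  = 2 ^ k * count e
  w′ = 2 ^ suc k * count e
  Q  = ∑ (tuples k n) (λ vs → ∑ (cube n) (λ a → weightOn vs e a * weightOn vs e a))

  recurrence : ∑ (tuples (suc k) n) (λ vs → ∑ (cube n) (λ a → weightOn vs e a * weightOn vs e a))
             ≡ 2 * (N * Q) + 2 * (N ^ k * (w * w))
  recurrence = ≡.begin
    ∑ (tuples (suc k) n) (λ vs → ∑ (cube n) (λ a → weightOn vs e a * weightOn vs e a))
      ≡.≡⟨ ∑-tuples-suc k n _ ⟩
    ∑ (cube n) (λ v → ∑ (tuples k n) (λ vs → ∑ (cube n) (λ a →
      (weightOn vs e a + weightOn vs e (a ⊕ v)) * (weightOn vs e a + weightOn vs e (a ⊕ v)))))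
      ≡.≡⟨ ∑-swap (cube n) (tuples k n) _ ⟩
    ∑ (tuples k n) (λ vs → ∑ (cube n) (λ v → ∑ (cube n) (λ a →
      (weightOn vs e a + weightOn vs e (a ⊕ v)) * (weightOn vs e a + weightOn vs e (a ⊕ v)))))
      ≡.≡⟨ ∑-cong (tuples k n) (λ vs → trans (∑-squares n (weightOn vs e))
           (cong₂ (λ s t → 2 * (N * ∑ (cube n) (λ a → weightOn vs e a * weightOn vs e a)) + 2 * (s * t))
             (∑-weightOn vs e) (∑-weightOn vs e))) ⟩
    ∑ (tuples k n) (λ vs → 2 * (N * ∑ (cube n) (λ a → weightOn vs e a * weightOn vs e a)) + 2 * (w * w))
      ≡.≡⟨ ∑-+ (tuples k n) _ _ ⟩
    ∑ (tuples k n) (λ vs → 2 * (N * ∑ (cube n) (λ a → weightOn vs e a * weightOn vs e a)))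
      + ∑ (tuples k n) (const (2 * (w * w)))
      ≡.≡⟨ cong₂ _+_
           (trans (∑-* (tuples k n) 2 _) (cong (2 *_) (∑-* (tuples k n) N _)))
           (trans (∑-tuples-const k n _)
             (solve 2 (λ K x → K :* (con 2 :* x) := con 2 :* (K :* x)) refl (N ^ k) (w * w))) ⟩
    2 * (N * Q) + 2 * (N ^ k * (w * w)) ≡.∎
    where module ≡ = ≡-Reasoning

-- Second moment method: x ↦ 2x − x² bounds the parity of x from below, where x counts the points
-- of a random flat at which f and P differ.
R-near : ∀ k (f P : F₂^ n → F₂) → Lo k P → let E = count (λ x → f x xor P x) in
         2 ^ suc k * E ≤ 2 ^ n → (2 ^ n) ^ k * (2 ^ k * E) ≤ 2 * R k f
R-near {n} k f P LP small = ℕ.*-cancelˡ-≤ N {{ℕ.m^n≢0 2 n}} (ℕ.+-cancelˡ-≤ (3 * (N * (N ^ k * w))) _ _ (begin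
  3 * (N * (N ^ k * w)) + N * (N ^ k * w)
    ≡⟨ solve 3 (λ N K w → con 3 :* (N :* (K :* w)) :+ N :* (K :* w) := con 2 :* (N :* (con 2 :* (K :* w)))) refl N (N ^ k) w ⟩
  2 * (N * (2 * (N ^ k * w)))
    ≤⟨ ℕ.*-monoʳ-≤ 2 (ℕ.*-monoʳ-≤ N parity) ⟩
  2 * (N * (Q + R k f))
    ≡⟨ solve 3 (λ N Q R → con 2 :* (N :* (Q :+ R)) := con 2 :* (N :* Q) :+ N :* (con 2 :* R)) refl N Q (R k f) ⟩
  2 * (N * Q) + N * (2 * R k f)
    ≤⟨ ℕ.+-monoˡ-≤ (N * (2 * R k f)) (ℕ.*-monoʳ-≤ 2 (second-moment k e)) ⟩
  2 * (N ^ k * (N * w + w * w)) + N * (2 * R k f)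
    ≡⟨ cong (_+ N * (2 * R k f)) (solve 3 (λ N K w → con 2 :* (K :* (N :* w :+ w :* w))
         := K :* (con 2 :* (N :* w) :+ (con 2 :* w) :* w)) refl N (N ^ k) w) ⟩
  N ^ k * (2 * (N * w) + (2 * w) * w) + N * (2 * R k f)
    ≤⟨ ℕ.+-monoˡ-≤ (N * (2 * R k f)) (ℕ.*-monoʳ-≤ (N ^ k) (ℕ.+-monoʳ-≤ (2 * (N * w)) (ℕ.*-monoˡ-≤ w 2w≤N))) ⟩
  N ^ k * (2 * (N * w) + N * w) + N * (2 * R k f)
    ≡⟨ cong (_+ N * (2 * R k f)) (solve 3 (λ N K w → K :* (con 2 :* (N :* w) :+ N :* w) := con 3 :* (N :* (K :* w))) refl N (N ^ k) w) ⟩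
  3 * (N * (N ^ k * w)) + N * (2 * R k f) ∎))
  where
  open ℕ.≤-Reasoning
  open +-*-Solver
  e : F₂^ n → F₂
  e x = f x xor P x
  N = 2 ^ n
  w = 2 ^ k * count e
  Q = ∑ (tuples k n) (λ vs → ∑ (cube n) (λ a → weightOn vs e a * weightOn vs e a))

  -- `w / N` is the mean number of errors on a flat; as it is at most one half, its square costs at
  -- most half of it.
  2w≤N : 2 * w ≤ N
  2w≤N = ℕ.≤-trans (ℕ.≤-reflexive (sym (ℕ.*-assoc 2 (2 ^ k) (count e)))) small

  D-e : ∀ vs a → odd (weightOn vs e a) ≡ D {k = k} vs f a
  D-e vs a = trans (odd-weightOn vs e a) (trans (D-xor vs f P a)
    (trans (cong (D vs f a xor_) (LP vs a)) (Bool.xor-identityʳ _)))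

  parity : 2 * (N ^ k * w) ≤ Q + R k f
  parity = begin
    2 * (N ^ k * w)
      ≡⟨ cong (2 *_) (sym (trans (∑-cong (tuples k n) (λ vs → ∑-weightOn vs e)) (∑-tuples-const k n w))) ⟩
    2 * ∑ (tuples k n) (λ vs → ∑ (cube n) (weightOn vs e))
      ≡⟨ sym (trans (∑-cong (tuples k n) (λ vs → ∑-* (cube n) 2 _)) (∑-* (tuples k n) 2 _)) ⟩
    ∑ (tuples k n) (λ vs → ∑ (cube n) (λ a → 2 * weightOn vs e a))
      ≤⟨ ∑-mono (tuples k n) (λ vs → ∑-mono (cube n) (λ a → ℕ.≤-trans (double≤square+odd (weightOn vs e a))
           (ℕ.≤-reflexive (cong (λ b → weightOn vs e a * weightOn vs e a + 𝟙 b) (D-e vs a))))) ⟩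
    ∑ (tuples k n) (λ vs → ∑ (cube n) (λ a → weightOn vs e a * weightOn vs e a + 𝟙 (D vs f a)))
      ≡⟨ trans (∑-cong (tuples k n) (λ vs → ∑-+ (cube n) _ _)) (∑-+ (tuples k n) _ _) ⟩
    Q + R k f ∎

-- Linear combinations, independence and orthogonality

combo : Vec (F₂^ n) k → F₂^ k → F₂^ n
combo vs t = Vec.foldr _ _⊕_ (replicate _ false) (zipWith _·_ t vs)

·-identity : (v : F₂^ n) → true · v ≡ v
·-identity = Vecₚ.map-id

·-zero : (v : F₂^ n) → false · v ≡ 𝟎
·-zero []      = refl
·-zero (_ ∷ v) = cong (false ∷_) (·-zero v)

·-distribʳ : ∀ b c (v : F₂^ n) → (b xor c) · v ≡ (b · v) ⊕ (c · v)
·-distribʳ false c     v = sym (trans (cong (_⊕ (c · v)) (·-zero v)) (⊕-identityˡ (c · v)))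
·-distribʳ true  false v = sym (trans (cong ((true · v) ⊕_) (·-zero v)) (⊕-identityʳ (true · v)))
·-distribʳ true  true  v = trans (·-zero v) (sym (⊕-self (true · v)))

∙-· : ∀ (l : F₂^ n) b v → l ∙ (b · v) ≡ b ∧ l ∙ v
∙-· l false v = trans (cong (l ∙_) (·-zero v)) (∙-𝟎ʳ l)
∙-· l true  v = cong (l ∙_) (·-identity v)

combo-⊕ : ∀ (vs : Vec (F₂^ n) k) s t → combo vs (s ⊕ t) ≡ combo vs s ⊕ combo vs t
combo-⊕ []       []      []      = sym (⊕-identityˡ 𝟎)
combo-⊕ (v ∷ vs) (b ∷ s) (c ∷ t) = trans
  (cong₂ _⊕_ (·-distribʳ b c v) (combo-⊕ vs s t))
  (⊕-interchange (b · v) (c · v) (combo vs s) (combo vs t))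

combo-𝟎 : ∀ (vs : Vec (F₂^ n) k) → combo vs 𝟎 ≡ 𝟎
combo-𝟎 []       = refl
combo-𝟎 (v ∷ vs) = trans (cong₂ _⊕_ (·-zero v) (combo-𝟎 vs)) (⊕-identityˡ 𝟎)

∙-combo : ∀ (l : F₂^ n) (vs : Vec (F₂^ n) k) t → l ∙ combo vs t ≡ Vec.map (l ∙_) vs ∙ t
∙-combo l []       []      = ∙-𝟎ʳ l
∙-combo l (v ∷ vs) (b ∷ t) = trans (∙-⊕ʳ l (b · v) (combo vs t))
  (cong₂ _xor_ (trans (∙-· l b v) (Bool.∧-comm b (l ∙ v))) (∙-combo l vs t))

-- Shifting the base point by `v` only exchanges the two summands of `D (v ∷ vs) f`. This is why
-- dependent tuples contribute nothing to `R`.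
D-combo : ∀ (vs : Vec (F₂^ n) k) f t a → D vs f (a ⊕ combo vs t) ≡ D vs f a
D-combo []       f []      a = cong f (⊕-identityʳ a)
D-combo (v ∷ vs) f (b ∷ t) a = trans
  (cong₂ _xor_
    (trans (cong (D vs f) (sym (⊕-assoc a (b · v) c))) (D-combo vs f t (a ⊕ (b · v))))
    (trans (cong (D vs f) (trans (cong (_⊕ v) (sym (⊕-assoc a (b · v) c))) (⊕-swap (a ⊕ (b · v)) c v)))
           (D-combo vs f t ((a ⊕ (b · v)) ⊕ v))))
  (shift b)
  where
  c = combo vs t
  shift : ∀ b → D vs f (a ⊕ (b · v)) xor D vs f ((a ⊕ (b · v)) ⊕ v) ≡ D vs f a xor D vs f (a ⊕ v)
  shift false = cong (λ x → D vs f x xor D vs f (x ⊕ v)) (trans (cong (a ⊕_) (·-zero v)) (⊕-identityʳ a))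
  shift true  = trans
    (cong (λ x → D vs f (a ⊕ x) xor D vs f ((a ⊕ x) ⊕ v)) (·-identity v))
    (trans (cong (λ x → D vs f (a ⊕ v) xor D vs f x) (⊕-cancelʳ a v))
           (Bool.xor-comm (D vs f (a ⊕ v)) (D vs f a)))

Independent : Vec (F₂^ n) k → Set
Independent vs = ∀ t → combo vs t ≡ 𝟎 → t ≡ 𝟎

D-dependent : ∀ (vs : Vec (F₂^ n) k) v f t → v ≡ combo vs t → ∀ a → D (v ∷ vs) f a ≡ false
D-dependent vs v f t refl a = trans (cong (D vs f a xor_) (D-combo vs f t a)) (Bool.xor-same (D vs f a))

D⇒Independent : ∀ (vs : Vec (F₂^ n) k) f a → D vs f a ≡ true → Independent vs
D⇒Independent []       f a Da []          _  = refl
D⇒Independent (v ∷ vs) f a Da (true ∷ t)  eq = contradiction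
  (trans (sym Da) (D-dependent vs v f t (trans (sym (·-identity v)) (⊕≡𝟎⇒≡ (true · v) (combo vs t) eq)) a)) λ ()
D⇒Independent (v ∷ vs) f a Da (false ∷ t) eq = cong (false ∷_) (either (D vs f a) refl)
  where
  eq′ : combo vs t ≡ 𝟎
  eq′ = trans (sym (trans (cong (_⊕ combo vs t) (·-zero v)) (⊕-identityˡ _))) eq
  either : ∀ b → D vs f a ≡ b → t ≡ 𝟎
  either true  Da′ = D⇒Independent vs f a Da′ t eq′
  either false Da′ = D⇒Independent vs f (a ⊕ v) (trans (cong (_xor D vs f (a ⊕ v)) (sym Da′)) Da) t eq′

-- A single formula for zero and nonzero `l`, so that both orders of summation in the double count
-- of `∑-perp` can use it under a sum.
∑-kernel : ∀ (l : F₂^ n) → 2 * ∑ (cube n) (𝟙 ∘ on l false) ≡ 2 ^ n + 2 ^ n * 𝟙 (does (l ≟ 𝟎))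
∑-kernel {n} l with l ≟ 𝟎
... | yes refl = trans (cong (2 *_) (trans (∑-cong (cube n) (λ x → cong (𝟙 ∘ not) (∙-𝟎ˡ x))) (∑-cube-1 n)))
                       (cong (2 ^ n +_) (trans (ℕ.+-identityʳ _) (sym (ℕ.*-identityʳ _))))
... | no l≢𝟎   = trans (∑-hyperplane l false l≢𝟎) (sym (trans (cong (2 ^ n +_) (ℕ.*-zeroʳ (2 ^ n))) (ℕ.+-identityʳ _)))

perp : F₂^ n → Vec (F₂^ n) k → Bool
perp l vs = does (Vec.map (l ∙_) vs ≟ 𝟎)

-- Double counting of the pairs (l , t) such that l is orthogonal to combo vs t.
∑-perp : ∀ (vs : Vec (F₂^ n) k) → Independent vs → 2 ^ k * ∑ (cube n) (λ l → 𝟙 (perp l vs)) ≡ 2 ^ n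
∑-perp {n} {k} vs ind = ℕ.+-cancelˡ-≡ (2 ^ n * 2 ^ k) _ _ (begin
  2 ^ n * 2 ^ k + 2 ^ k * ∑ (cube n) (λ l → 𝟙 (perp l vs))
    ≡⟨ sym (cong₂ _+_ (∑-cube-const n (2 ^ k)) (∑-* (cube n) (2 ^ k) _)) ⟩
  ∑ (cube n) (const (2 ^ k)) + ∑ (cube n) (λ l → 2 ^ k * 𝟙 (perp l vs))
    ≡⟨ sym (∑-+ (cube n) _ _) ⟩
  ∑ (cube n) (λ l → 2 ^ k + 2 ^ k * 𝟙 (perp l vs))
    ≡⟨ sym (∑-cong (cube n) (λ l → ∑-kernel (Vec.map (l ∙_) vs))) ⟩
  ∑ (cube n) (λ l → 2 * ∑ (cube k) (𝟙 ∘ on (Vec.map (l ∙_) vs) false))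
    ≡⟨ ∑-* (cube n) 2 _ ⟩
  2 * ∑ (cube n) (λ l → ∑ (cube k) (𝟙 ∘ on (Vec.map (l ∙_) vs) false))
    ≡⟨ cong (2 *_) (∑-swap (cube n) (cube k) _) ⟩
  2 * ∑ (cube k) (λ t → ∑ (cube n) (λ l → 𝟙 (on (Vec.map (l ∙_) vs) false t)))
    ≡⟨ sym (∑-* (cube k) 2 _) ⟩
  ∑ (cube k) (λ t → 2 * ∑ (cube n) (λ l → 𝟙 (on (Vec.map (l ∙_) vs) false t)))
    ≡⟨ ∑-cong (cube k) (λ t → cong (2 *_) (∑-cong (cube n) (λ l → cong (𝟙 ∘ not)
         (trans (sym (∙-combo l vs t)) (∙-comm l (combo vs t)))))) ⟩
  ∑ (cube k) (λ t → 2 * ∑ (cube n) (𝟙 ∘ on (combo vs t) false))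
    ≡⟨ ∑-cong (cube k) (λ t → ∑-kernel (combo vs t)) ⟩
  ∑ (cube k) (λ t → 2 ^ n + 2 ^ n * 𝟙 (does (combo vs t ≟ 𝟎)))
    ≡⟨ ∑-+ (cube k) _ _ ⟩
  ∑ (cube k) (const (2 ^ n)) + ∑ (cube k) (λ t → 2 ^ n * 𝟙 (does (combo vs t ≟ 𝟎)))
    ≡⟨ cong₂ _+_ (trans (∑-cube-const k (2 ^ n)) (ℕ.*-comm (2 ^ k) (2 ^ n))) (begin
         ∑ (cube k) (λ t → 2 ^ n * 𝟙 (does (combo vs t ≟ 𝟎)))
           ≡⟨ ∑-cong (cube k) (λ t → trans (ℕ.*-comm (2 ^ n) _) (cong (λ b → 𝟙 b * 2 ^ n)
                (does-cong (combo vs t ≟ 𝟎) (t ≟ 𝟎) (ind t) (λ { refl → combo-𝟎 vs })))) ⟩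
         ∑ (cube k) (λ t → 𝟙 (does (t ≟ 𝟎)) * 2 ^ n)
           ≡⟨ ∑-delta (cubeᴱ k) 𝟎 (const (2 ^ n)) ⟩
         2 ^ n ∎) ⟩
  2 ^ n * 2 ^ k + 2 ^ n ∎)
  where open ≡-Reasoning

-- Restriction to hyperplanes and averaging

-- Linear coordinates for the hyperplane orthogonal to l, with inverse ρ and a transversal u.
record Chart (l : F₂^ (suc n)) : Set where
  field
    ι       : F₂^ n → F₂^ (suc n)
    ρ       : F₂^ (suc n) → F₂^ n
    u       : F₂^ (suc n)
    ι-⊕     : ∀ x y → ι (x ⊕ y) ≡ ι x ⊕ ι y
    ρ-⊕     : ∀ x y → ρ (x ⊕ y) ≡ ρ x ⊕ ρ y
    l∙u     : l ∙ u ≡ true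
    l∙ι     : ∀ y → l ∙ ι y ≡ false
    ρ-ι     : ∀ y → ρ (ι y) ≡ y
    ι-ρ     : ∀ x → l ∙ x ≡ false → ι (ρ x) ≡ x

  ψ : F₂ → F₂^ n → F₂^ (suc n)
  ψ b y = ι y ⊕ (b · u)

  ψ-⊕ : ∀ b x y → ψ b (x ⊕ y) ≡ ψ b x ⊕ ι y
  ψ-⊕ b x y = trans (cong (_⊕ (b · u)) (ι-⊕ x y)) (⊕-swap (ι x) (ι y) (b · u))

  l∙ψ : ∀ b y → l ∙ ψ b y ≡ b
  l∙ψ b y = trans (∙-⊕ʳ l (ι y) (b · u)) (trans
    (cong₂ _xor_ (l∙ι y) (trans (∙-· l b u) (cong (b ∧_) l∙u))) (Bool.∧-identityʳ b))

  χ : F₂ → F₂^ (suc n) → F₂^ n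
  χ b x = ρ (x ⊕ (b · u))

  χ-⊕ : ∀ b x y → χ b (x ⊕ y) ≡ χ b x ⊕ ρ y
  χ-⊕ b x y = trans (cong ρ (⊕-swap x y (b · u))) (ρ-⊕ (x ⊕ (b · u)) y)

  χ-ψ : ∀ b y → χ b (ψ b y) ≡ y
  χ-ψ b y = trans (cong ρ (⊕-cancelʳ (ι y) (b · u))) (ρ-ι y)

  ψ-injective : ∀ b → Injective _≡_ _≡_ (ψ b)
  ψ-injective b {x} {y} eq = trans (sym (χ-ψ b x)) (trans (cong (χ b) eq) (χ-ψ b y))

  ψ-χ : ∀ b x → l ∙ x ≡ b → ψ b (χ b x) ≡ x
  ψ-χ b x refl = trans (cong (_⊕ (b · u)) (ι-ρ (x ⊕ (b · u)) (trans (∙-⊕ʳ l x (b · u))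
    (trans (cong (b xor_) (trans (∙-· l b u) (trans (cong (b ∧_) l∙u) (Bool.∧-identityʳ b)))) (Bool.xor-same b)))))
    (⊕-cancelʳ x (b · u))

xor-false : ∀ a b → a xor b ≡ false → b ≡ a
xor-false false b eq = eq
xor-false true  true eq = refl

chart : (l : F₂^ (suc n)) → l ≢ 𝟎 → Chart l
chart (true ∷ l) _ = record
  { ι   = λ y → l ∙ y ∷ y
  ; ρ   = λ { (_ ∷ x) → x }
  ; u   = true ∷ 𝟎
  ; ι-⊕ = λ x y → cong (_∷ (x ⊕ y)) (∙-⊕ʳ l x y)
  ; ρ-⊕ = λ { (_ ∷ x) (_ ∷ y) → refl }
  ; l∙u = cong not (∙-𝟎ʳ l)
  ; l∙ι = λ y → Bool.xor-same (l ∙ y)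
  ; ρ-ι = λ y → refl
  ; ι-ρ = λ { (b ∷ x) eq → cong (_∷ x) (xor-false b (l ∙ x) eq) }
  }
chart {zero} (false ∷ []) l≢𝟎 = contradiction refl l≢𝟎
chart {suc n} (false ∷ l) l≢𝟎 = record
  { ι   = λ { (b ∷ y) → b ∷ ι y }
  ; ρ   = λ { (b ∷ x) → b ∷ ρ x }
  ; u   = false ∷ u
  ; ι-⊕ = λ { (b ∷ x) (c ∷ y) → cong ((b xor c) ∷_) (ι-⊕ x y) }
  ; ρ-⊕ = λ { (b ∷ x) (c ∷ y) → cong ((b xor c) ∷_) (ρ-⊕ x y) }
  ; l∙u = l∙u
  ; l∙ι = λ { (b ∷ y) → l∙ι y }
  ; ρ-ι = λ { (b ∷ y) → cong (b ∷_) (ρ-ι y) }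
  ; ι-ρ = λ { (b ∷ x) eq → cong (b ∷_) (ι-ρ x eq) }
  }
  where open Chart (chart l (l≢𝟎 ∘ cong (false ∷_)))

R⊥ : F₂^ n → ∀ k → (F₂^ n → F₂) → ℕ
R⊥ {n} l k f = ∑ (tuples k n) (λ vs → 𝟙 (perp l vs) * ∑ (cube n) (λ a → 𝟙 (D vs f a)))

map-𝟎 : ∀ {k} (φ : F₂^ n → F₂) → (∀ x → φ x ≡ false) → (vs : Vec (F₂^ n) k) → Vec.map φ vs ≡ 𝟎
map-𝟎 φ φ≡ []       = refl
map-𝟎 φ φ≡ (v ∷ vs) = cong₂ _∷_ (φ≡ v) (map-𝟎 φ φ≡ vs)

-- A pair `(a , vs)` lives inside one of the two hyperplanes with direction `l` exactly when `vs` is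
-- orthogonal to `l`; then `l ∙ a` decides which of the two it is.
R-restrict : ∀ k {l : F₂^ (suc n)} (c : Chart l) (f : F₂^ (suc n) → F₂) → let open Chart c in
             R k (f ∘ ψ false) + R k (f ∘ ψ true) ≡ R⊥ l k f
R-restrict {n} k {l} c f = begin
  R k (f ∘ ψ false) + R k (f ∘ ψ true)
    ≡⟨ cong₂ _+_ (restrict false) (restrict true) ⟩
  ∑ (tuples k (suc n)) (λ vs → 𝟙 (perp l vs) * S false vs) + ∑ (tuples k (suc n)) (λ vs → 𝟙 (perp l vs) * S true vs)
    ≡⟨ sym (∑-+ (tuples k (suc n)) _ _) ⟩
  ∑ (tuples k (suc n)) (λ vs → 𝟙 (perp l vs) * S false vs + 𝟙 (perp l vs) * S true vs)
    ≡⟨ ∑-cong (tuples k (suc n)) (λ vs → trans (sym (ℕ.*-distribˡ-+ (𝟙 (perp l vs)) (S false vs) (S true vs)))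
         (cong (𝟙 (perp l vs) *_) (trans (sym (∑-+ (cube (suc n)) _ _))
           (∑-cong (cube (suc n)) (λ a → halves (l ∙ a) (𝟙 (D vs f a))))))) ⟩
  R⊥ l k f ∎
  where
  open ≡-Reasoning
  open Chart c
  S : F₂ → Vec (F₂^ (suc n)) k → ℕ
  S b vs = ∑ (cube (suc n)) (λ a → 𝟙 (on l b a) * 𝟙 (D vs f a))

  halves : ∀ b x → 𝟙 (not b) * x + 𝟙 (not (not b)) * x ≡ x
  halves false x = trans (ℕ.+-identityʳ _) (ℕ.+-identityʳ x)
  halves true  x = ℕ.+-identityʳ x

  map-ι-injective : ∀ {j} {us vs : Vec (F₂^ n) j} → Vec.map ι us ≡ Vec.map ι vs → us ≡ vs
  map-ι-injective {us = []}     {[]}     _  = refl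
  map-ι-injective {us = u ∷ us} {v ∷ vs} eq with p , q ← Vecₚ.∷-injective eq =
    cong₂ _∷_ (trans (sym (ρ-ι u)) (trans (cong ρ p) (ρ-ι v))) (map-ι-injective q)

  perp-ι : ∀ {j} (vs : Vec (F₂^ n) j) → Vec.map (l ∙_) (Vec.map ι vs) ≡ 𝟎
  perp-ι vs = trans (sym (Vecₚ.map-∘ (l ∙_) ι vs)) (map-𝟎 (λ v → l ∙ ι v) l∙ι vs)

  map-ι-surjective : ∀ {j} (vs : Vec (F₂^ (suc n)) j) → Vec.map (l ∙_) vs ≡ 𝟎 → Vec.map ι (Vec.map ρ vs) ≡ vs
  map-ι-surjective []       _  = refl
  map-ι-surjective (v ∷ vs) eq with p , q ← Vecₚ.∷-injective eq = cong₂ _∷_ (ι-ρ v p) (map-ι-surjective vs q)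

  restrict : ∀ b → R k (f ∘ ψ b) ≡ ∑ (tuples k (suc n)) (λ vs → 𝟙 (perp l vs) * S b vs)
  restrict b = begin
    ∑ (tuples k n) (λ vs → ∑ (cube n) (λ a → 𝟙 (D vs (f ∘ ψ b) a)))
      ≡⟨ ∑-cong (tuples k n) (λ vs → trans
           (∑-cong (cube n) (λ a → cong 𝟙 (D-affine (ψ-⊕ b) vs f a)))
           (∑-reindex (cubeᴱ n) (cubeᴱ (suc n)) (ψ b)
             (ψ-injective b)
             (on l b) (λ y → on⁺ l b (ψ b y) (l∙ψ b y)) (λ x onx → χ b x , ψ-χ b x (on⁻ l b x onx))
             (λ a → 𝟙 (D (Vec.map ι vs) f a)))) ⟩
    ∑ (tuples k n) (λ vs → S b (Vec.map ι vs))
      ≡⟨ ∑-reindex (tuplesᴱ k n) (tuplesᴱ k (suc n)) (Vec.map ι) map-ι-injective (perp l)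
           (λ vs → dec-true (_ ≟ 𝟎) (perp-ι vs))
           (λ vs p → Vec.map ρ vs , map-ι-surjective vs (does-true (_ ≟ 𝟎) p)) (S b) ⟩
    ∑ (tuples k (suc n)) (λ vs → 𝟙 (perp l vs) * S b vs) ∎

-- Only independent tuples have a nonzero derivative, and by `∑-perp` all of these are orthogonal to
-- equally many `l`. The averaging over directions is therefore exact, with `𝟎` counted among them.
∑-R⊥ : ∀ k (f : F₂^ n → F₂) → 2 ^ k * ∑ (cube n) (λ l → R⊥ l k f) ≡ 2 ^ n * R k f
∑-R⊥ {n} k f = begin
  2 ^ k * ∑ (cube n) (λ l → R⊥ l k f)
    ≡⟨ cong (2 ^ k *_) (trans (∑-swap (cube n) (tuples k n) _) (∑-cong (tuples k n) (λ vs → ∑-*ʳ (cube n) (r vs) _))) ⟩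
  2 ^ k * ∑ (tuples k n) (λ vs → ∑ (cube n) (λ l → 𝟙 (perp l vs)) * r vs)
    ≡⟨ sym (∑-* (tuples k n) (2 ^ k) _) ⟩
  ∑ (tuples k n) (λ vs → 2 ^ k * (∑ (cube n) (λ l → 𝟙 (perp l vs)) * r vs))
    ≡⟨ ∑-cong (tuples k n) (λ vs → trans (sym (ℕ.*-assoc (2 ^ k) (z vs) (r vs)))
         (trans (sym (∑-* (cube n) (2 ^ k * z vs) (λ a → 𝟙 (D vs f a)))) (trans (∑-cong (cube n) (λ a → pointwise vs a (D vs f a) refl)) (∑-* (cube n) (2 ^ n) _)))) ⟩
  ∑ (tuples k n) (λ vs → 2 ^ n * r vs)
    ≡⟨ ∑-* (tuples k n) (2 ^ n) r ⟩
  2 ^ n * R k f ∎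
  where
  open ≡-Reasoning
  r : Vec (F₂^ n) k → ℕ
  r vs = ∑ (cube n) (λ a → 𝟙 (D vs f a))
  z : Vec (F₂^ n) k → ℕ
  z vs = ∑ (cube n) (λ l → 𝟙 (perp l vs))

  pointwise : ∀ vs a b → D vs f a ≡ b →
    (2 ^ k * ∑ (cube n) (λ l → 𝟙 (perp l vs))) * 𝟙 (D vs f a) ≡ 2 ^ n * 𝟙 (D vs f a)
  pointwise vs a true  Da = cong (_* 𝟙 (D vs f a)) (∑-perp vs (D⇒Independent vs f a Da))
  pointwise vs a false Da rewrite Da = trans (ℕ.*-zeroʳ (2 ^ k * ∑ (cube n) (λ l → 𝟙 (perp l vs)))) (sym (ℕ.*-zeroʳ (2 ^ n)))

-- Pairwise independence of hyperplanes

amgm : ∀ p q → 2 * (p * q) ≤ p * p + q * q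
amgm p q with ℕ.≤-total p q
... | inj₁ p≤q = ordered p q p≤q
  where
  ordered : ∀ p q → p ≤ q → 2 * (p * q) ≤ p * p + q * q
  ordered p q p≤q with t , refl ← ℕ.m≤n⇒∃[o]m+o≡n p≤q = ℕ.≤-trans (ℕ.m≤m+n _ (t * t)) (ℕ.≤-reflexive
    (solve 2 (λ p t → con 2 :* (p :* (p :+ t)) :+ t :* t := p :* p :+ (p :+ t) :* (p :+ t)) refl p t))
    where open +-*-Solver
... | inj₂ q≤p with t , refl ← ℕ.m≤n⇒∃[o]m+o≡n q≤p = ℕ.≤-trans (ℕ.m≤m+n _ (t * t)) (ℕ.≤-reflexive
    (solve 2 (λ q t → con 2 :* ((q :+ t) :* q) :+ t :* t := (q :+ t) :* (q :+ t) :+ q :* q) refl q t))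
    where open +-*-Solver

-- Families of hyperplanes { x : dir g ∙ x ≡ off g }.
module Hyperplanes {n} {G : Set} (dir : G → F₂^ n) (off : G → F₂) where

  infix 4 _∋_
  _∋_ : G → F₂^ n → Bool
  g ∋ x = on (dir g) (off g) x

  covering : List G → F₂^ n → ℕ
  covering gs x = ∑ gs (λ g → 𝟙 (g ∋ x))

  ∑-covering : ∀ gs → All (λ g → dir g ≢ 𝟎) gs → 2 * ∑ (cube n) (covering gs) ≡ length gs * 2 ^ n
  ∑-covering []       []         = cong (2 *_) (∑-zero (cube n))
  ∑-covering (g ∷ gs) (g≢ ∷ gs≢) = begin
    2 * ∑ (cube n) (covering (g ∷ gs))                               ≡⟨ cong (2 *_) (∑-+ (cube n) _ _) ⟩
    2 * (∑ (cube n) (λ x → 𝟙 (g ∋ x)) + ∑ (cube n) (covering gs))    ≡⟨ ℕ.*-distribˡ-+ 2 (∑ (cube n) (λ x → 𝟙 (g ∋ x))) _ ⟩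
    2 * ∑ (cube n) (λ x → 𝟙 (g ∋ x)) + 2 * ∑ (cube n) (covering gs)
      ≡⟨ cong₂ _+_ (∑-hyperplane (dir g) (off g) g≢) (∑-covering gs gs≢) ⟩
    2 ^ n + length gs * 2 ^ n                                        ∎
    where open ≡-Reasoning

  ∑-cross : ∀ g gs → dir g ≢ 𝟎 → All (λ h → dir h ≢ 𝟎) gs → All (dir g ≢_) (map dir gs) →
            4 * ∑ (cube n) (λ x → 𝟙 (g ∋ x) * covering gs x) ≡ length gs * 2 ^ n
  ∑-cross g []       g≢ []         []       =
    cong (4 *_) (trans (∑-cong (cube n) (λ x → ℕ.*-zeroʳ (𝟙 (g ∋ x)))) (∑-zero (cube n)))
  ∑-cross g (h ∷ gs) g≢ (h≢ ∷ gs≢) (g≢h ∷ g∉) = begin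
    4 * ∑ (cube n) (λ x → 𝟙 (g ∋ x) * (𝟙 (h ∋ x) + covering gs x))
      ≡⟨ cong (4 *_) (trans (∑-cong (cube n) (λ x → ℕ.*-distribˡ-+ (𝟙 (g ∋ x)) (𝟙 (h ∋ x)) _)) (∑-+ (cube n) _ _)) ⟩
    4 * (S + ∑ (cube n) (λ x → 𝟙 (g ∋ x) * covering gs x))
      ≡⟨ ℕ.*-distribˡ-+ 4 S _ ⟩
    4 * S + 4 * ∑ (cube n) (λ x → 𝟙 (g ∋ x) * covering gs x)
      ≡⟨ cong₂ _+_ (∑-two-hyperplanes (dir g) (dir h) (off g) (off h) g≢ h≢ g≢h) (∑-cross g gs g≢ gs≢ g∉) ⟩
    2 ^ n + length gs * 2 ^ n ∎
    where
    open ≡-Reasoning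
    S = ∑ (cube n) (λ x → 𝟙 (g ∋ x) * 𝟙 (h ∋ x))

  ∑-covering² : ∀ gs → All (λ g → dir g ≢ 𝟎) gs → Unique (map dir gs) → let K = length gs in
                4 * ∑ (cube n) (λ x → covering gs x * covering gs x) ≡ K * K * 2 ^ n + K * 2 ^ n
  ∑-covering² []       []         []         = cong (4 *_) (∑-zero (cube n))
  ∑-covering² (g ∷ gs) (g≢ ∷ gs≢) (g∉ ∷ uniq) = begin
    4 * ∑ (cube n) (λ x → (𝟙 (g ∋ x) + covering gs x) * (𝟙 (g ∋ x) + covering gs x))
      ≡⟨ cong (4 *_) (∑-cong (cube n) (λ x → expand (g ∋ x) (covering gs x))) ⟩
    4 * ∑ (cube n) (λ x → 𝟙 (g ∋ x) + (2 * (𝟙 (g ∋ x) * covering gs x) + covering gs x * covering gs x))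
      ≡⟨ cong (4 *_) (trans (∑-+ (cube n) _ _) (cong (X +_) (trans (∑-+ (cube n) _ _) (cong (_+ Z) (∑-* (cube n) 2 _))))) ⟩
    4 * (X + (2 * Y + Z))
      ≡⟨ solve 3 (λ X Y Z → con 4 :* (X :+ (con 2 :* Y :+ Z)) := con 2 :* (con 2 :* X) :+ (con 2 :* (con 4 :* Y) :+ con 4 :* Z)) refl X Y Z ⟩
    2 * (2 * X) + (2 * (4 * Y) + 4 * Z)
      ≡⟨ cong₂ _+_ (cong (2 *_) (∑-hyperplane (dir g) (off g) g≢))
           (cong₂ _+_ (cong (2 *_) (∑-cross g gs g≢ gs≢ g∉)) (∑-covering² gs gs≢ uniq)) ⟩
    2 * 2 ^ n + (2 * (K * 2 ^ n) + (K * K * 2 ^ n + K * 2 ^ n))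
      ≡⟨ solve 2 (λ K N → con 2 :* N :+ (con 2 :* (K :* N) :+ (K :* K :* N :+ K :* N))
           := (con 1 :+ K) :* (con 1 :+ K) :* N :+ (con 1 :+ K) :* N) refl K (2 ^ n) ⟩
    suc K * suc K * 2 ^ n + suc K * 2 ^ n ∎
    where
    open ≡-Reasoning
    open +-*-Solver
    K = length gs
    X = ∑ (cube n) (λ x → 𝟙 (g ∋ x))
    Y = ∑ (cube n) (λ x → 𝟙 (g ∋ x) * covering gs x)
    Z = ∑ (cube n) (λ x → covering gs x * covering gs x)

    expand : ∀ b c → (𝟙 b + c) * (𝟙 b + c) ≡ 𝟙 b + (2 * (𝟙 b * c) + c * c)
    expand false c = refl
    expand true  = solve 1 (λ c → (con 1 :+ c) :* (con 1 :+ c) := con 1 :+ (con 2 :* (con 1 :* c) :+ c :* c)) refl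

  -- Chebyshev's inequality: by pairwise independence most points lie on about half of the hyperplanes.
  count-bound : ∀ gs → All (λ g → dir g ≢ 𝟎) gs → Unique (map dir gs) → (e : F₂^ n → F₂) →
    length gs * count e ≤ 4 * ∑ (cube n) (λ x → covering gs x * 𝟙 (e x)) + 2 ^ n
  count-bound []           _   _    e = z≤n
  count-bound gs@(_ ∷ _) gs≢ uniq e = ℕ.*-cancelˡ-≤ K (ℕ.+-cancelʳ-≤ (2 * (K * (K * N))) _ _ (begin
    K * (K * count e) + 2 * (K * (K * N))
      ≡⟨ cong₂ _+_ (sym (ℕ.*-assoc K K (count e))) (cong (2 *_) (cong (K *_) (sym (∑-covering gs gs≢)))) ⟩
    K * K * count e + 2 * (K * (2 * C))
      ≡⟨ cong₂ _+_ (sym (∑-* (cube n) (K * K) _))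
           (trans (solve 2 (λ K C → con 2 :* (K :* (con 2 :* C)) := (con 4 :* K) :* C) refl K C) (sym (∑-* (cube n) (4 * K) _))) ⟩
    ∑ (cube n) (λ x → K * K * 𝟙 (e x)) + ∑ (cube n) (λ x → 4 * K * covering gs x)
      ≡⟨ sym (∑-+ (cube n) _ _) ⟩
    ∑ (cube n) (λ x → K * K * 𝟙 (e x) + 4 * K * covering gs x)
      ≤⟨ ∑-mono (cube n) (λ x → pointwise (e x) (covering gs x)) ⟩
    ∑ (cube n) (λ x → 4 * K * (covering gs x * 𝟙 (e x)) + (K * K + 4 * (covering gs x * covering gs x)))
      ≡⟨ trans (∑-+ (cube n) _ _) (cong₂ _+_ (∑-* (cube n) (4 * K) _) (trans (∑-+ (cube n) _ _)
           (cong₂ _+_ (∑-cube-const n (K * K)) (trans (∑-* (cube n) 4 _) (∑-covering² gs gs≢ uniq))))) ⟩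
    4 * K * S + (N * (K * K) + (K * K * N + K * N))
      ≡⟨ solve 3 (λ K S N → con 4 :* K :* S :+ (N :* (K :* K) :+ (K :* K :* N :+ K :* N))
           := K :* (con 4 :* S :+ N) :+ con 2 :* (K :* (K :* N))) refl K S N ⟩
    K * (4 * S + N) + 2 * (K * (K * N)) ∎))
    where
    open ℕ.≤-Reasoning
    open +-*-Solver
    K = length gs
    N = 2 ^ n
    C = ∑ (cube n) (covering gs)
    S = ∑ (cube n) (λ x → covering gs x * 𝟙 (e x))

    -- Rearranged: `K * K - 4 * K * c` on the points of `e`, and zero elsewhere, is at most the
    -- square of `K - 2 * c`. By pairwise independence these squares sum to `K * N`.
    pointwise : ∀ b c → K * K * 𝟙 b + 4 * K * c ≤ 4 * K * (c * 𝟙 b) + (K * K + 4 * (c * c))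
    pointwise false c = begin
      K * K * 0 + 4 * K * c    ≡⟨ solve 2 (λ K c → K :* K :* con 0 :+ con 4 :* K :* c := con 2 :* (K :* (con 2 :* c))) refl K c ⟩
      2 * (K * (2 * c))        ≤⟨ amgm K (2 * c) ⟩
      K * K + 2 * c * (2 * c)  ≡⟨ solve 2 (λ K c → K :* K :+ con 2 :* c :* (con 2 :* c)
                                    := con 4 :* K :* (c :* con 0) :+ (K :* K :+ con 4 :* (c :* c))) refl K c ⟩
      4 * K * (c * 0) + (K * K + 4 * (c * c)) ∎
    pointwise true c = begin
      K * K * 1 + 4 * K * c    ≤⟨ ℕ.m≤m+n _ (4 * (c * c)) ⟩
      K * K * 1 + 4 * K * c + 4 * (c * c)
        ≡⟨ solve 2 (λ K c → K :* K :* con 1 :+ con 4 :* K :* c :+ con 4 :* (c :* c)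
             := con 4 :* K :* (c :* con 1) :+ (K :* K :+ con 4 :* (c :* c))) refl K c ⟩
      4 * K * (c * 1) + (K * K + 4 * (c * c)) ∎

-- Many distinct directions contain many independent ones

∑-mono-∈ : ∀ (xs : List A) {h h′ : A → ℕ} → (∀ {x} → x ∈ xs → h x ≤ h′ x) → ∑ xs h ≤ ∑ xs h′
∑-mono-∈ []       le = z≤n
∑-mono-∈ (x ∷ xs) le = ℕ.+-mono-≤ (le (here refl)) (∑-mono-∈ xs (le ∘ there))

Unique⇒length≤ : (_≟ᴬ_ : DecidableEquality A) → ∀ {xs : List A} → Unique xs →
                 ∀ ys → (∀ {x} → x ∈ xs → x ∈ ys) → length xs ≤ length ys
Unique⇒length≤ _≟ᴬ_ {xs} uniq ys xs⊆ys = ℕ.≤-trans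
  (ℕ.≤-reflexive (sym (∑-1 xs)))
  (ℕ.≤-trans (∑-mono-∈ xs (λ x∈ → occurs (xs⊆ys x∈))) (ℕ.≤-trans
    (ℕ.≤-reflexive (∑-swap xs ys (λ x y → 𝟙 (does (x ≟ᴬ y)))))
    (ℕ.≤-trans (∑-mono ys (λ y → once y uniq)) (ℕ.≤-reflexive (∑-1 ys)))))
  where
  occurs : ∀ {x} → x ∈ ys → 1 ≤ ∑ ys (λ y → 𝟙 (does (x ≟ᴬ y)))
  occurs {x} x∈ = ℕ.≤-trans (ℕ.≤-reflexive (sym (cong 𝟙 (dec-true (x ≟ᴬ x) refl))))
                            (term≤∑ (λ y → 𝟙 (does (x ≟ᴬ y))) x∈)

  never : ∀ y {xs} → y ∉ xs → ∑ xs (λ x → 𝟙 (does (x ≟ᴬ y))) ≡ 0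
  never y {[]}     y∉ = refl
  never y {x ∷ xs} y∉ = cong₂ _+_ (cong 𝟙 (dec-false (x ≟ᴬ y) λ { refl → y∉ (here refl) })) (never y (y∉ ∘ there))

  once : ∀ y {xs} → Unique xs → ∑ xs (λ x → 𝟙 (does (x ≟ᴬ y))) ≤ 1
  once y {[]} [] = z≤n
  once y {x ∷ xs} (x∉ ∷ uniq) with x ≟ᴬ y
  ... | yes refl = ℕ.≤-reflexive (cong suc (never y (λ y∈ → All.lookup x∉ y∈ refl)))
  ... | no _     = once y uniq

∙-nondegenerate : (w : F₂^ n) → (∀ x → w ∙ x ≡ false) → w ≡ 𝟎
∙-nondegenerate []      _ = refl
∙-nondegenerate (a ∷ w) w⊥ = cong₂ _∷_
  (trans (sym (trans (cong₂ _xor_ (Bool.∧-identityʳ a) (∙-𝟎ʳ w)) (Bool.xor-identityʳ a))) (w⊥ (true ∷ 𝟎)))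
  (∙-nondegenerate w (λ x → trans (cong (_xor w ∙ x) (sym (Bool.∧-zeroʳ a))) (w⊥ (false ∷ x))))

-- Linear independence of the directions, certified by a triangular system of dual vectors.
module TriangularSystems {n} {G : Set} (dir : G → F₂^ n) where

  infix 4 _⊥ᵈ_ _⊥ᵘ_
  _⊥ᵈ_ : F₂^ n → List (G × F₂^ n) → Set
  u ⊥ᵈ ps = All (λ p → dir (proj₁ p) ∙ u ≡ false) ps

  _⊥ᵘ_ : F₂^ n → List (G × F₂^ n) → Set
  l ⊥ᵘ ps = All (λ p → l ∙ proj₂ p ≡ false) ps

  data Triangular : List (G × F₂^ n) → Set where
    []  : Triangular []
    add : ∀ {g u ps} → dir g ∙ u ≡ true → u ⊥ᵈ ps → Triangular ps → Triangular ((g , u) ∷ ps)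

  -- For a triangular system this is the linear projection onto the common kernel of the directions
  -- along the dual vectors.
  eliminate : List (G × F₂^ n) → F₂^ n → F₂^ n
  eliminate []             x = x
  eliminate ((g , u) ∷ ps) x = let y = eliminate ps x in y ⊕ ((dir g ∙ y) · u)

  eliminate-⊥ : ∀ {ps} → Triangular ps → ∀ x → eliminate ps x ⊥ᵈ ps
  eliminate-⊥ []                         x = []
  eliminate-⊥ (add {g} {u} {ps} gu u⊥ t) x =
    trans (∙-⊕ʳ (dir g) y _) (trans (cong (c xor_) (trans (∙-· (dir g) c u)
      (trans (cong (c ∧_) gu) (Bool.∧-identityʳ c)))) (Bool.xor-same c))
    ∷ All.zipWith (λ {p} (y⊥ , u⊥) → trans (∙-⊕ʳ (dir (proj₁ p)) y _) (cong₂ _xor_ y⊥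
        (trans (∙-· (dir (proj₁ p)) c u) (trans (cong (c ∧_) u⊥) (Bool.∧-zeroʳ c)))))
        (eliminate-⊥ t x , u⊥)
    where
    y = eliminate ps x
    c = dir g ∙ y

  ∙-eliminate : ∀ w ps → w ⊥ᵘ ps → ∀ x → w ∙ eliminate ps x ≡ w ∙ x
  ∙-eliminate w []             []        x = refl
  ∙-eliminate w ((g , u) ∷ ps) (wu ∷ w⊥) x = trans (∙-⊕ʳ w y _) (trans (cong₂ _xor_ (∙-eliminate w ps w⊥ x)
    (trans (∙-· w (dir g ∙ y) u) (trans (cong (dir g ∙ y ∧_) wu) (Bool.∧-zeroʳ (dir g ∙ y))))) (Bool.xor-identityʳ (w ∙ x)))
    where y = eliminate ps x

  -- Equivalently, l is in the span of the directions.
  Saturated : List (G × F₂^ n) → F₂^ n → Set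
  Saturated ps l = ∀ u → u ⊥ᵈ ps → l ∙ u ≡ false

  signature : (ps : List (G × F₂^ n)) → F₂^ n → F₂^ (length ps)
  signature []             l = []
  signature ((_ , u) ∷ ps) l = l ∙ u ∷ signature ps l

  -- Equal signatures make `l ⊕ m` vanish on the dual vectors, so `eliminate` does not change its
  -- pairing with any `x`. But `eliminate` lands in the common kernel, where saturated vectors
  -- vanish, and the form is nondegenerate.
  signature-injective : ∀ {ps} → Triangular ps → ∀ {l m} → Saturated ps l → Saturated ps m →
                        signature ps l ≡ signature ps m → l ≡ m
  signature-injective {ps} t {l} {m} sat-l sat-m eq = ⊕≡𝟎⇒≡ l m (∙-nondegenerate (l ⊕ m) (λ x →
    trans (sym (∙-eliminate (l ⊕ m) ps (orthogonal ps eq) x)) (trans (∙-⊕ˡ l m (eliminate ps x))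
      (cong₂ _xor_ (sat-l _ (eliminate-⊥ t x)) (sat-m _ (eliminate-⊥ t x))))))
    where
    orthogonal : ∀ ps → signature ps l ≡ signature ps m → l ⊕ m ⊥ᵘ ps
    orthogonal []             _  = []
    orthogonal ((_ , u) ∷ ps) eq with p , q ← Vecₚ.∷-injective eq =
      trans (∙-⊕ˡ l m u) (trans (cong (_xor m ∙ u) p) (Bool.xor-same (m ∙ u))) ∷ orthogonal ps q

  saturated-length : ∀ {ps} → Triangular ps → ∀ {ls} → Unique ls → All (Saturated ps) ls → length ls ≤ 2 ^ length ps
  saturated-length {ps} t {ls} uniq sat = ℕ.≤-trans
    (ℕ.≤-reflexive (sym (Listₚ.length-map (signature ps) ls)))
    (ℕ.≤-trans (Unique⇒length≤ _≟_ (unique-map uniq sat) (cube (length ps)) (λ {x} _ → cube-complete x))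
      (ℕ.≤-reflexive (length-cube (length ps))))
    where
    unique-map : ∀ {ls} → Unique ls → All (Saturated ps) ls → Unique (map (signature ps) ls)
    unique-map []            []          = []
    unique-map (l∉ ∷ uniq) (sl ∷ sat) =
      Allₚ.map⁺ (All.zipWith (λ (l≢ , sm) eq → l≢ (signature-injective t sl sm eq)) (l∉ , sat)) ∷ unique-map uniq sat

  extend : ∀ ps gs → (∃ λ g → g ∈ gs × ∃ λ u → dir g ∙ u ≡ true × u ⊥ᵈ ps) ⊎ All (Saturated ps) (map dir gs)
  extend ps []       = inj₂ []
  extend ps (g ∷ gs) with anySubset? (λ u → (dir g ∙ u Bool.≟ true) ×-dec All.all? (λ p → dir (proj₁ p) ∙ u Bool.≟ false) ps)
  ... | yes (u , found) = inj₁ (g , here refl , u , found)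
  ... | no none with extend ps gs
  ...   | inj₁ (h , h∈ , found) = inj₁ (h , there h∈ , found)
  ...   | inj₂ sat = inj₂ ((λ u u⊥ → Bool.¬-not (λ gu → none (u , gu , u⊥))) ∷ sat)

  -- At most 2 ^ length ps directions, including 𝟎, are saturated.
  triangulate : ∀ {gs} → All (λ g → dir g ≢ 𝟎) gs → Unique (map dir gs) → ∀ r → 2 ^ r ≤ length gs →
                ∀ j → j ≤ suc r → ∃ λ ps → Triangular ps × length ps ≡ j × All (λ p → proj₁ p ∈ gs) ps
  triangulate gs≢ uniq r big zero    _         = [] , [] , refl , []
  triangulate {gs} gs≢ uniq r big (suc j) (s≤s j≤r)
    with ps , t , len , ps∈ ← triangulate gs≢ uniq r big j (ℕ.m≤n⇒m≤1+n j≤r)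
    with extend ps gs
  ... | inj₁ (g , g∈ , u , gu , u⊥) = (g , u) ∷ ps , add gu u⊥ t , cong suc len , g∈ ∷ ps∈
  ... | inj₂ sat = contradiction
    (ℕ.≤-trans (s≤s (ℕ.≤-trans (ℕ.^-monoʳ-≤ 2 (ℕ.≤-trans (ℕ.≤-reflexive len) j≤r))
                 (ℕ.≤-trans big (ℕ.≤-reflexive (sym (Listₚ.length-map dir gs))))))
      (saturated-length t (Allₚ.map⁺ (All.map (λ g≢ eq → g≢ (sym eq)) gs≢) ∷ uniq) ((λ u _ → ∙-𝟎ˡ u) ∷ sat)))
    (ℕ.1+n≰n {2 ^ length ps})

-- Interpolation on independent hyperplanes

xor-injective : ∀ {a b} → a xor b ≡ false → a ≡ b
xor-injective {a} {b} eq = sym (xor-false a b eq)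

module Interpolation {n} {G : Set} (dir : G → F₂^ n) (off : G → F₂) where

  open TriangularSystems dir

  -- Degree less than `k` of the restriction to the hyperplane of `g`, stated without coordinates on
  -- it, so that one `F` on the whole space can be tested against many hyperplanes.
  LoOn : ∀ k → G → (F₂^ n → F₂) → Set
  LoOn k g F = ∀ (vs : Vec (F₂^ n) k) a → Vec.map (dir g ∙_) vs ≡ 𝟎 → dir g ∙ a ≡ off g → D vs F a ≡ false

  -- When `dir g ∙ u` is `true`, this is the affine projection onto the hyperplane of `g` along `u`,
  -- and `π₀` is its linear part.
  π : G → F₂^ n → F₂^ n → F₂^ n
  π g u x = x ⊕ ((off g xor dir g ∙ x) · u)

  π₀ : G → F₂^ n → F₂^ n → F₂^ n
  π₀ g u v = v ⊕ ((dir g ∙ v) · u)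

  π-⊕ : ∀ g u x v → π g u (x ⊕ v) ≡ π g u x ⊕ π₀ g u v
  π-⊕ g u x v = trans
    (cong (λ b → (x ⊕ v) ⊕ (b · u)) (trans (cong (off g xor_) (∙-⊕ʳ (dir g) x v))
      (sym (Bool.xor-assoc (off g) (dir g ∙ x) (dir g ∙ v)))))
    (trans (cong ((x ⊕ v) ⊕_) (·-distribʳ (off g xor dir g ∙ x) (dir g ∙ v) u))
           (⊕-interchange x v _ _))

  ∙-π : ∀ g {u} → dir g ∙ u ≡ true → ∀ x → dir g ∙ π g u x ≡ off g
  ∙-π g {u} gu x = trans (∙-⊕ʳ (dir g) x _) (trans (cong (dir g ∙ x xor_)
    (trans (∙-· (dir g) (off g xor dir g ∙ x) u) (trans (cong ((off g xor dir g ∙ x) ∧_) gu) (Bool.∧-identityʳ _))))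
    (xor-sandwich (dir g ∙ x) (off g)))

  ∙-π₀ : ∀ g {u} → dir g ∙ u ≡ true → ∀ v → dir g ∙ π₀ g u v ≡ false
  ∙-π₀ g {u} gu v = trans (∙-⊕ʳ (dir g) v _) (trans (cong (dir g ∙ v xor_)
    (trans (∙-· (dir g) (dir g ∙ v) u) (trans (cong (dir g ∙ v ∧_) gu) (Bool.∧-identityʳ _)))) (Bool.xor-same (dir g ∙ v)))

  ∙-π-other : ∀ g {u} h → dir h ∙ u ≡ false → ∀ x → dir h ∙ π g u x ≡ dir h ∙ x
  ∙-π-other g {u} h hu x = trans (∙-⊕ʳ (dir h) x _) (trans (cong (dir h ∙ x xor_)
    (trans (∙-· (dir h) (off g xor dir g ∙ x) u) (trans (cong ((off g xor dir g ∙ x) ∧_) hu) (Bool.∧-zeroʳ (off g xor dir g ∙ x))))) (Bool.xor-identityʳ _))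

  π-fixed : ∀ g u x → dir g ∙ x ≡ off g → π g u x ≡ x
  π-fixed g u x eq = trans (cong (λ b → x ⊕ (b · u)) (trans (cong (_xor dir g ∙ x) (sym eq)) (Bool.xor-same (dir g ∙ x))))
    (trans (cong (x ⊕_) (·-zero u)) (⊕-identityʳ x))

  -- The projection π g u maps every hyperplane of ps to itself.
  interpolant : List (G × F₂^ n) → (F₂^ n → F₂) → F₂^ n → F₂
  interpolant []             F x = false
  interpolant ((g , u) ∷ ps) F x = interpolant ps F x xor (F (π g u x) xor interpolant ps F (π g u x))

  interpolant-Lo : ∀ {ps F} → Triangular ps → All (λ p → LoOn k (proj₁ p) F) ps → Lo k (interpolant ps F)
  interpolant-Lo {k} [] [] = Lo-false k
  interpolant-Lo {F = F} (add {g} {u} {ps} gu u⊥ t) (LF ∷ LFs) =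
    Lo-xor LP (Lo-xor {f = F ∘ π g u} {g = interpolant ps F ∘ π g u} LFπ (Lo-affine {φ₀ = π₀ g u} (π-⊕ g u) LP))
    where
    LP = interpolant-Lo t LFs
    LFπ : Lo _ (F ∘ π g u)
    LFπ vs a = trans (D-affine {φ₀ = π₀ g u} (π-⊕ g u) vs F a) (LF (Vec.map (π₀ g u) vs) (π g u a)
      (trans (sym (Vecₚ.map-∘ (dir g ∙_) (π₀ g u) vs)) (map-𝟎 (λ v → dir g ∙ π₀ g u v) (∙-π₀ g gu) vs)) (∙-π g gu a))

  -- On the new hyperplane `π g u` is the identity, so the correction replaces the old value by that
  -- of `F`. On an old one the correction is the old error at a point of the same hyperplane, which
  -- is zero.
  interpolant-agrees : ∀ {ps} F → Triangular ps →
    All (λ p → ∀ x → dir (proj₁ p) ∙ x ≡ off (proj₁ p) → interpolant ps F x ≡ F x) ps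
  interpolant-agrees F []                         = []
  interpolant-agrees F (add {g} {u} {ps} gu u⊥ t) =
    (λ x x∈ → trans (cong (λ y → P x xor (F y xor P y)) (π-fixed g u x x∈)) (xor-sandwich (P x) (F x)))
    ∷ All.zipWith (λ {p} (hu , agree) x x∈ → trans
        (cong₂ _xor_ (agree x x∈) (trans (cong (F (π g u x) xor_)
          (agree (π g u x) (trans (∙-π-other g (proj₁ p) hu x) x∈))) (Bool.xor-same (F (π g u x)))))
        (Bool.xor-identityʳ (F x))) (u⊥ , interpolant-agrees F t)
    where
    P = interpolant ps F

  duals : (ps : List (G × F₂^ n)) → Vec (F₂^ n) (length ps)
  duals []             = []
  duals ((_ , u) ∷ ps) = u ∷ duals ps

  -- All vertices of the parallelepiped other than x lie on some hyperplane of ps.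
  D-duals : ∀ l {ps} {Q : F₂^ n → F₂} b → Triangular ps → l ⊥ᵘ ps →
    All (λ p → ∀ x → l ∙ x ≡ b → dir (proj₁ p) ∙ x ≡ off (proj₁ p) → Q x ≡ false) ps →
    ∀ x → l ∙ x ≡ b → All (λ p → dir (proj₁ p) ∙ x ≢ off (proj₁ p)) ps → D (duals ps) Q x ≡ Q x
  D-duals l b [] [] [] x lx [] = refl
  D-duals l {Q = Q} b (add {g} {u} {ps} gu u⊥ t) (lu ∷ l⊥) (z ∷ zs) x lx (gx ∷ out) = trans
    (cong₂ _xor_ (D-duals l b t l⊥ zs x lx out) (trans
      (D-duals l b t l⊥ zs (x ⊕ u) lxu (All.zipWith (λ {p} (hu , hx) eq → hx (trans
        (sym (trans (∙-⊕ʳ (dir (proj₁ p)) x u) (trans (cong (dir (proj₁ p) ∙ x xor_) hu) (Bool.xor-identityʳ _)))) eq)) (u⊥ , out)))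
      (z (x ⊕ u) lxu (trans (∙-⊕ʳ (dir g) x u) (trans (cong (dir g ∙ x xor_) gu) (flip (dir g ∙ x) (off g) gx))))))
    (Bool.xor-identityʳ (Q x))
    where
    lxu : l ∙ (x ⊕ u) ≡ b
    lxu = trans (∙-⊕ʳ l x u) (trans (cong₂ _xor_ lx lu) (Bool.xor-identityʳ b))
    flip : ∀ a c → a ≢ c → a xor true ≡ c
    flip false false a≢c = contradiction refl a≢c
    flip false true  a≢c = refl
    flip true  false a≢c = refl
    flip true  true  a≢c = contradiction refl a≢c

  map-duals : ∀ l ps → l ⊥ᵘ ps → Vec.map (l ∙_) (duals ps) ≡ 𝟎
  map-duals l []       []        = refl
  map-duals l (_ ∷ ps) (lu ∷ l⊥) = cong₂ _∷_ lu (map-duals l ps l⊥)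

  -- A point of the hyperplane of `g` that avoids all hyperplanes of `ps` is the only vertex of its
  -- dual parallelepiped at which `Q` can be nonzero, so `Q x` equals a derivative that the degree
  -- bound kills. Since the dual vectors are orthogonal to `dir g`, the parallelepiped stays inside
  -- the hyperplane.
  vanishing : ∀ {ps} {Q : F₂^ n → F₂} g → Triangular ps → dir g ⊥ᵘ ps → LoOn (length ps) g Q →
    All (λ p → ∀ x → dir g ∙ x ≡ off g → dir (proj₁ p) ∙ x ≡ off (proj₁ p) → Q x ≡ false) ps →
    ∀ x → dir g ∙ x ≡ off g → Q x ≡ false
  vanishing {ps} {Q} g t g⊥ LQ zs x gx = scan ps zs (λ out → trans (sym (D-duals (dir g) (off g) t g⊥ zs x gx out))
                                                        (LQ (duals ps) x (map-duals (dir g) ps g⊥) gx))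
    where
    scan : ∀ qs → All (λ p → ∀ x → dir g ∙ x ≡ off g → dir (proj₁ p) ∙ x ≡ off (proj₁ p) → Q x ≡ false) qs →
           (All (λ p → dir (proj₁ p) ∙ x ≢ off (proj₁ p)) qs → Q x ≡ false) → Q x ≡ false
    scan []       []       otherwise = otherwise []
    scan (q ∷ qs) (z ∷ zs) otherwise with dir (proj₁ q) ∙ x Bool.≟ off (proj₁ q)
    ... | yes qx = z x gx qx
    ... | no ¬qx = scan qs zs (λ out → otherwise (¬qx ∷ out))

  -- When `l ∙ u` is `true`, adding `u` where necessary makes all dual vectors orthogonal to `l`. If
  -- `u` is orthogonal to the directions of the list, their pairings with the dual vectors do not
  -- change.
  shear : F₂^ n → F₂^ n → List (G × F₂^ n) → List (G × F₂^ n)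
  shear l u = map (λ (g , v) → g , v ⊕ ((l ∙ v) · u))

  shear-Triangular : ∀ l {u ps} → u ⊥ᵈ ps → Triangular ps → Triangular (shear l u ps)
  shear-Triangular l         []        []             = []
  shear-Triangular l {u} {(g , v) ∷ ps} (gu ∷ u⊥) (add gv v⊥ t) = add
    (trans (absorb (dir g) gu) gv)
    (Allₚ.map⁺ (All.zipWith (λ {p} (hu , hv) → trans (absorb (dir (proj₁ p)) hu) hv) (u⊥ , v⊥)))
    (shear-Triangular l u⊥ t)
    where
    absorb : ∀ d → d ∙ u ≡ false → d ∙ (v ⊕ ((l ∙ v) · u)) ≡ d ∙ v
    absorb d du = trans (∙-⊕ʳ d v _) (trans (cong (d ∙ v xor_)
      (trans (∙-· d (l ∙ v) u) (trans (cong (l ∙ v ∧_) du) (Bool.∧-zeroʳ (l ∙ v))))) (Bool.xor-identityʳ _))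

  shear-⊥ : ∀ l {u} → l ∙ u ≡ true → ∀ ps → l ⊥ᵘ shear l u ps
  shear-⊥ l     lu []             = []
  shear-⊥ l {u} lu ((g , v) ∷ ps) = trans (∙-⊕ʳ l v _) (trans (cong (l ∙ v xor_)
    (trans (∙-· l (l ∙ v) u) (trans (cong (l ∙ v ∧_) lu) (Bool.∧-identityʳ (l ∙ v))))) (Bool.xor-same (l ∙ v)))
    ∷ shear-⊥ l lu ps

  -- The directions other than one remain independent modulo l.
  orthogonalize : ∀ l {p ps} → Triangular (p ∷ ps) → ∃ λ qs → Triangular qs × length qs ≡ length ps × l ⊥ᵘ qs ×
                  (∀ {P : G → Set} → All (P ∘ proj₁) (p ∷ ps) → All (P ∘ proj₁) qs)
  -- The last element is dropped whether or not its dual vector is orthogonal to `l`, so that the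
  -- length falls by one in every case.
  orthogonalize l {ps = []} _ = [] , [] , refl , [] , λ _ → []
  orthogonalize l {g , u} {ps@(_ ∷ _)} (add gu u⊥ t) with l ∙ u in lu
  ... | true  = shear l u ps , shear-Triangular l u⊥ t , Listₚ.length-map _ ps , shear-⊥ l lu ps ,
                λ { (_ ∷ Pps) → Allₚ.map⁺ Pps }
  ... | false with qs , t′ , len , l⊥ , transfer ← orthogonalize l t =
    (g , u) ∷ qs , add gu (transfer {λ h → dir h ∙ u ≡ false} u⊥) t′ , cong suc len , lu ∷ l⊥ ,
    λ { {P} (Pg ∷ Pps) → Pg ∷ transfer {P} Pps }

  -- `triangulate` yields `suc k` independent directions. Checking agreement on the hyperplane of an
  -- arbitrary `g` gives up one of them to `orthogonalize`, and the remaining `k` match the degree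
  -- bound in `vanishing`.
  interpolate : ∀ {gs} → All (λ g → dir g ≢ 𝟎) gs → Unique (map dir gs) → 2 ^ k ≤ length gs →
    (F : F₂^ n → F₂) → All (λ g → LoOn k g F) gs →
    ∃ λ P → Lo k P × All (λ g → ∀ x → dir g ∙ x ≡ off g → P x ≡ F x) gs
  interpolate {k} {gs} gs≢ uniq big F LF
    with p ∷ ps , t , len , ps∈ ← triangulate gs≢ uniq k big (suc k) ℕ.≤-refl =
    P , LP , All.map agree LF
    where
    P  = interpolant (p ∷ ps) F
    LP : Lo k P
    LP = interpolant-Lo t (All.map (All.lookup LF) ps∈)
    agree : ∀ {g} → LoOn k g F → ∀ x → dir g ∙ x ≡ off g → P x ≡ F x
    agree {g} LFg x gx with qs , t′ , len′ , g⊥ , transfer ← orthogonalize (dir g) t = xor-injective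
      (vanishing {Q = λ x → P x xor F x} g t′ g⊥
        (subst (λ j → LoOn j g (λ x → P x xor F x)) (sym (trans len′ (ℕ.suc-injective len)))
          (λ vs a v⊥ ga → trans (D-xor vs P F a) (cong₂ _xor_ (LP vs a) (LFg vs a v⊥ ga))))
        (All.map (λ same y _ hy → trans (cong (_xor F y) (same y hy)) (Bool.xor-same (F y)))
          (transfer {λ h → ∀ x → dir h ∙ x ≡ off h → P x ≡ F x} (interpolant-agrees F t)))
        x gx)

-- Gluing approximations on hyperplanes

errorsOn : F₂^ n → F₂ → (f g : F₂^ n → F₂) → ℕ
errorsOn {n} l b f g = ∑ (cube n) (λ x → 𝟙 (on l b x) * 𝟙 (f x xor g x))

-- `approx` is a function on the whole space with a global degree bound, so that approximations
-- belonging to different hyperplanes can be subtracted without choosing coordinates on their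
-- intersection.
record Good (k T : ℕ) (f : F₂^ n → F₂) : Set where
  field
    dir     : F₂^ n
    dir≢𝟎   : dir ≢ 𝟎
    off     : F₂
    approx    : F₂^ n → F₂
    approx-Lo : Lo k approx
    errors  : errorsOn dir off f approx ≤ T

module Gluing (k T : ℕ) (f : F₂^ n → F₂) where
  open Good
  open Hyperplanes {n} {Good k T f} dir off
  open Interpolation {n} {Good k T f} dir off

  -- The difference times the indicators of both hyperplanes has degree less than `2 + k` on the
  -- whole cube. Wherever it is nonzero, `f` differs from one of the two approximations on its
  -- hyperplane, so its weight is at most `T + T`, which is below the minimum distance.
  compatible : T * 2 ^ (2 + k) < 2 ^ n → ∀ (g h : Good k T f) x →
               dir g ∙ x ≡ off g → dir h ∙ x ≡ off h → approx g x ≡ approx h x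
  compatible small g h x gx hx with approx g x xor approx h x in differ
  ... | false = xor-injective differ
  ... | true  = contradiction (begin-strict
    T * 2 ^ (2 + k)       <⟨ small ⟩
    2 ^ n                 ≤⟨ weight-bound (suc k) n LQ x Qx ⟩
    count Q * 2 ^ suc k   ≤⟨ ℕ.*-monoˡ-≤ (2 ^ suc k) countQ ⟩
    (T + T) * 2 ^ suc k   ≡⟨ solve 2 (λ T p → (T :+ T) :* p := T :* (con 2 :* p)) refl T (2 ^ suc k) ⟩
    T * 2 ^ (2 + k)       ∎) (ℕ.<-irrefl refl)
    where
    open ℕ.≤-Reasoning
    open +-*-Solver
    Q : F₂^ n → F₂
    Q y = (g ∋ y) ∧ ((h ∋ y) ∧ (approx g y xor approx h y))

    LQ : Lo (2 + k) Q
    LQ = Lo-on (suc k) (dir g) (off g) (Lo-on k (dir h) (off h) (Lo-xor (approx-Lo g) (approx-Lo h)))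

    Qx : Q x ≡ true
    Qx = cong₂ _∧_ (on⁺ (dir g) (off g) x gx) (cong₂ _∧_ (on⁺ (dir h) (off h) x hx) differ)

    bits : ∀ a b p q r → 𝟙 (a ∧ (b ∧ (p xor q))) ≤ 𝟙 a * 𝟙 (r xor p) + 𝟙 b * 𝟙 (r xor q)
    bits false b     p q r = z≤n
    bits true  false p q r = z≤n
    bits true  true  false false r = z≤n
    bits true  true  true  true  r = z≤n
    bits true  true  false true  false = ℕ.≤-refl
    bits true  true  false true  true  = ℕ.≤-refl
    bits true  true  true  false false = ℕ.≤-refl
    bits true  true  true  false true  = ℕ.≤-refl

    countQ : count Q ≤ T + T
    countQ = ℕ.≤-trans (∑-mono (cube n) (λ y → bits (g ∋ y) (h ∋ y) (approx g y) (approx h y) (f y)))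
      (ℕ.≤-trans (ℕ.≤-reflexive (∑-+ (cube n) _ _)) (ℕ.+-mono-≤ (errors g) (errors h)))

  patch : List (Good k T f) → F₂^ n → F₂
  patch []       x = false
  patch (g ∷ gs) x = if g ∋ x then approx g x else patch gs x

  patch-agrees : T * 2 ^ (2 + k) < 2 ^ n → ∀ gs {g} → g ∈ gs → ∀ x → dir g ∙ x ≡ off g → patch gs x ≡ approx g x
  patch-agrees small (h ∷ gs) g∈ x gx with h ∋ x in hx
  patch-agrees small (h ∷ gs) {g} g∈ x gx | true = compatible small h g x (on⁻ (dir h) (off h) x hx) gx
  patch-agrees small (h ∷ gs) (here refl) x gx | false = contradiction (trans (sym hx) (on⁺ (dir h) (off h) x gx)) λ ()
  patch-agrees small (h ∷ gs) (there g∈)  x gx | false = patch-agrees small gs g∈ x gx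

  D-local : ∀ {j} (g : Good k T f) {F H : F₂^ n → F₂} → (∀ x → dir g ∙ x ≡ off g → F x ≡ H x) →
            ∀ (vs : Vec (F₂^ n) j) a → Vec.map (dir g ∙_) vs ≡ 𝟎 → dir g ∙ a ≡ off g → D vs F a ≡ D vs H a
  D-local g same []       a _  ga = same a ga
  D-local g same (v ∷ vs) a v⊥ ga with p , q ← Vecₚ.∷-injective v⊥ = cong₂ _xor_
    (D-local g same vs a q ga)
    (D-local g same vs (a ⊕ v) q (trans (∙-⊕ʳ (dir g) a v) (trans (cong₂ _xor_ ga p) (Bool.xor-identityʳ (off g)))))

  -- `count-bound` charges the errors of `P` to the hyperplanes through them. On each hyperplane `P`
  -- coincides with the local approximation, so each is charged at most `T`; the term `2 ^ n` comes
  -- from the variance.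
  glueᴳ : ∀ gs → Unique (map dir gs) → 2 ^ k ≤ length gs → T * 2 ^ (2 + k) < 2 ^ n →
    ∃ λ P → Lo k P × length gs * count (λ x → f x xor P x) ≤ 4 * (length gs * T) + 2 ^ n
  glueᴳ gs uniq big small
    with P , LP , agree ← interpolate (All.universal dir≢𝟎 gs) uniq big (patch gs)
      (All.tabulate (λ {g} g∈ vs a v⊥ ga → trans
        (D-local g (patch-agrees small gs g∈) vs a v⊥ ga) (approx-Lo g vs a))) = P , LP , (begin
    length gs * count e
      ≤⟨ count-bound gs (All.universal dir≢𝟎 gs) uniq e ⟩
    4 * ∑ (cube n) (λ x → covering gs x * 𝟙 (e x)) + 2 ^ n
      ≡⟨ cong (λ s → 4 * s + 2 ^ n) (trans (∑-cong (cube n) (λ x → sym (∑-*ʳ gs (𝟙 (e x)) _))) (∑-swap (cube n) gs _)) ⟩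
    4 * ∑ gs (λ g → ∑ (cube n) (λ x → 𝟙 (g ∋ x) * 𝟙 (e x))) + 2 ^ n
      ≤⟨ ℕ.+-monoˡ-≤ (2 ^ n) (ℕ.*-monoʳ-≤ 4 (∑-mono-∈ gs {h′ = const T} (λ {g} g∈ → ℕ.≤-trans
           (ℕ.≤-reflexive (∑-cong (cube n) (λ x → errors-agree g (λ y gy → trans (All.lookup agree g∈ y gy) (patch-agrees small gs g∈ y gy)) x)))
           (errors g)))) ⟩
    4 * ∑ gs (const T) + 2 ^ n
      ≡⟨ cong (λ s → 4 * s + 2 ^ n) (∑-const gs T) ⟩
    4 * (length gs * T) + 2 ^ n ∎)
    where
    open ℕ.≤-Reasoning
    e : F₂^ n → F₂
    e x = f x xor P x

    errors-agree : ∀ g → (∀ x → dir g ∙ x ≡ off g → P x ≡ approx g x) → ∀ x →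
                   𝟙 (g ∋ x) * 𝟙 (e x) ≡ 𝟙 (g ∋ x) * 𝟙 (f x xor approx g x)
    errors-agree g same x with g ∋ x in gx
    ... | false = refl
    ... | true  = cong (λ b → 𝟙 (f x xor b) + 0) (same x (on⁻ (dir g) (off g) x gx))

-- Induction on the dimension: from hyperplanes to the whole space

Close : ∀ k → ℕ → (F₂^ n → F₂) → Set
Close {n} k T f = ∃ λ P → Lo k P × count (λ x → f x xor P x) ≤ T

good-hyperplane : ∀ k T (f : F₂^ (suc n) → F₂) {l} → l ≢ 𝟎 → (c : Chart l) → ∀ b →
                  Close k T (f ∘ Chart.ψ c b) → ∃ λ (g : Good k T f) → Good.dir g ≡ l
good-hyperplane {n} k T f {l} l≢𝟎 c b (P , LP , few) = record
  -- `χ b` is an affine left inverse of the chart `ψ b`, so `P ∘ χ b` extends `P` off the hyperplane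
  -- without raising the degree.
  { dir = l ; dir≢𝟎 = l≢𝟎 ; off = b ; approx = P ∘ χ b
  ; approx-Lo = Lo-affine {φ₀ = ρ} (χ-⊕ b) LP
  ; errors = ℕ.≤-trans (ℕ.≤-reflexive (sym (trans
      (∑-cong (cube n) (λ y → cong (λ z → 𝟙 (f (ψ b y) xor P z)) (sym (χ-ψ b y))))
      (∑-reindex (cubeᴱ n) (cubeᴱ (suc n)) (ψ b)
        (ψ-injective b)
        (on l b) (λ y → on⁺ l b (ψ b y) (l∙ψ b y)) (λ x onx → χ b x , ψ-χ b x (on⁻ l b x onx))
        (λ x → 𝟙 (f x xor P (χ b x))))))) few
  } , refl
  where open Chart c

-- A direction without a member of the family has its `X` paid by `Y`. Each remaining direction adds
-- one member to `gs`, which is charged `X`, so the length of `gs` counts the exceptional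
-- directions.
collect : ∀ {G : Set} (dir : G → A) X (Y : A → ℕ) → (∀ l → (∃ λ g → dir g ≡ l) ⊎ X ≤ Y l) →
  ∀ ls → Unique ls → ∃ λ gs → Unique (map dir gs) × (∀ {l} → l ∈ map dir gs → l ∈ ls) ×
                              length ls * X ≤ ∑ ls Y + length gs * X
collect dir X Y split []       []          = [] , [] , (λ ()) , z≤n
collect dir X Y split (l ∷ ls) (l∉ ∷ uniq)
  with gs , uniq′ , ⊆ls , bound ← collect dir X Y split ls uniq
  with split l
... | inj₁ (g , refl) = g ∷ gs , All.tabulate (λ m∈ → All.lookup l∉ (⊆ls m∈)) ∷ uniq′ ,
      (λ { (here eq) → here eq ; (there m∈) → there (⊆ls m∈) }) , (begin
  X + length ls * X                    ≤⟨ ℕ.+-monoʳ-≤ X bound ⟩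
  X + (∑ ls Y + length gs * X)         ≤⟨ ℕ.m≤n+m _ (Y (dir g)) ⟩
  Y (dir g) + (X + (∑ ls Y + length gs * X))
    ≡⟨ solve 4 (λ y X s g → y :+ (X :+ (s :+ g)) := (y :+ s) :+ (X :+ g)) refl (Y (dir g)) X (∑ ls Y) (length gs * X) ⟩
  Y (dir g) + ∑ ls Y + (X + length gs * X) ∎)
  where
  open ℕ.≤-Reasoning
  open +-*-Solver
... | inj₂ X≤Y = gs , uniq′ , there ∘ ⊆ls , ℕ.≤-trans (ℕ.+-mono-≤ X≤Y bound) (ℕ.≤-reflexive (sym (ℕ.+-assoc (Y l) _ _)))

-- The number of all pairs (a , vs) with k directions vs, dependent ones included.
volume : ℕ → ℕ → ℕ
volume k n = (2 ^ n) ^ suc k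

^-distribʳ-* : ∀ o p q → (p * q) ^ o ≡ p ^ o * q ^ o
^-distribʳ-* zero    p q = refl
^-distribʳ-* (suc o) p q = trans (cong (p * q *_) (^-distribʳ-* o p q))
  (CommutativeSemigroupProperties.interchange ℕ.*-commutativeSemigroup p q (p ^ o) (q ^ o))

volume-suc : ∀ k n → volume k (suc n) ≡ 2 ^ suc k * volume k n
volume-suc k n = ^-distribʳ-* (suc k) 2 (2 ^ n)

hyperplane-dichotomy : ∀ k n T p q →
  (∀ (f : F₂^ n → F₂) → Close k T f ⊎ p * volume k n ≤ q * R k f) →
  (f : F₂^ (suc n) → F₂) (l : F₂^ (suc n)) →
  (∃ λ (g : Good k T f) → Good.dir g ≡ l)
  ⊎ p * (2 * volume k n) ≤ q * R⊥ l k f + 𝟙 (does (l ≟ 𝟎)) * (p * (2 * volume k n))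
hyperplane-dichotomy k n T p q hyp f l with l ≟ 𝟎
-- The zero direction has no hyperplanes; the indicator term concedes it as one further exceptional
-- direction.
... | yes _ = inj₂ (ℕ.≤-trans (ℕ.≤-reflexive (sym (ℕ.+-identityʳ _))) (ℕ.m≤n+m _ (q * R⊥ l k f)))
... | no l≢𝟎 with hyp (f ∘ Chart.ψ (chart l l≢𝟎) false)
...   | inj₁ close = inj₁ (good-hyperplane k T f l≢𝟎 (chart l l≢𝟎) false close)
...   | inj₂ far₀ with hyp (f ∘ Chart.ψ (chart l l≢𝟎) true)
...     | inj₁ close = inj₁ (good-hyperplane k T f l≢𝟎 (chart l l≢𝟎) true close)
...     | inj₂ far₁ = inj₂ (begin
  p * (2 * volume k n)                ≡⟨ solve 2 (λ p v → p :* (con 2 :* v) := p :* v :+ p :* v) refl p (volume k n) ⟩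
  p * volume k n + p * volume k n     ≤⟨ ℕ.+-mono-≤ far₀ far₁ ⟩
  q * R k (f ∘ ψ false) + q * R k (f ∘ ψ true)   ≡⟨ sym (ℕ.*-distribˡ-+ q (R k (f ∘ ψ false)) _) ⟩
  q * (R k (f ∘ ψ false) + R k (f ∘ ψ true))     ≡⟨ cong (q *_) (R-restrict k (chart l l≢𝟎) f) ⟩
  q * R⊥ l k f                        ≡⟨ sym (ℕ.+-identityʳ _) ⟩
  q * R⊥ l k f + 0                    ∎)
  where
  open ℕ.≤-Reasoning
  open +-*-Solver
  open Chart (chart l l≢𝟎)

-- Divided out, the second alternative says that a proportion `p / q` for far functions on
-- hyperplanes shrinks only by the factor `1 - (K₀ + 1) / 2 ^ (n + 1)`: at most `K₀` directions have
-- a close hyperplane, and one more is `𝟎`.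
induction-step : ∀ k n T p q K₀ → 2 ^ k ≤ suc K₀ → T * 2 ^ (2 + k) < 2 ^ suc n →
  (∀ (f : F₂^ n → F₂) → Close k T f ⊎ p * volume k n ≤ q * R k f) →
  (f : F₂^ (suc n) → F₂) →
  (∃ λ P → Lo k P × ∃ λ K → K₀ < K × K * count (λ x → f x xor P x) ≤ 4 * (K * T) + 2 ^ suc n)
  ⊎ 2 ^ suc n * (p * volume k (suc n)) ≤ q * (2 ^ suc n * R k f) + suc K₀ * (p * volume k (suc n))
induction-step k n T p q K₀ big small hyp f
  with gs , uniq , _ , bound ← collect (Good.dir {k = k} {T} {f}) (p * (2 * volume k n))
         (λ l → q * R⊥ l k f + 𝟙 (does (l ≟ 𝟎)) * (p * (2 * volume k n))) (hyperplane-dichotomy k n T p q hyp f) (cube (suc n)) (cube-unique (suc n))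
  with suc K₀ ℕ.≤? length gs
... | yes K₀<K with P , LP , few ← Gluing.glueᴳ k T f gs uniq (ℕ.≤-trans big K₀<K) small =
  inj₁ (P , LP , length gs , K₀<K , few)
... | no K₀≮K = inj₂ (begin
  N * (p * volume k (suc n))
    ≡⟨ cong (N *_) X-volume ⟩
  N * (2 ^ k * X)
    ≡⟨ solve 3 (λ N K X → N :* (K :* X) := K :* (N :* X)) refl N (2 ^ k) X ⟩
  2 ^ k * (N * X)
    ≡⟨ cong (λ m → 2 ^ k * (m * X)) (sym (length-cube (suc n))) ⟩
  2 ^ k * (length (cube (suc n)) * X)
    ≤⟨ ℕ.*-monoʳ-≤ (2 ^ k) (ℕ.≤-trans bound (ℕ.+-mono-≤ (ℕ.≤-reflexive (trans (∑-+ (cube (suc n)) _ _)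
         (cong₂ _+_ (∑-* (cube (suc n)) q _) (∑-delta (cubeᴱ (suc n)) 𝟎 (const X)))))
         (ℕ.*-monoˡ-≤ X (s≤s⁻¹ (ℕ.≰⇒> K₀≮K))))) ⟩
  2 ^ k * (q * S + X + K₀ * X)
    ≡⟨ solve 5 (λ K q S X K₀ → K :* (q :* S :+ X :+ K₀ :* X) := q :* (K :* S) :+ (con 1 :+ K₀) :* (K :* X)) refl (2 ^ k) q S X K₀ ⟩
  q * (2 ^ k * S) + suc K₀ * (2 ^ k * X)
    ≡⟨ cong₂ _+_ (cong (q *_) (∑-R⊥ k f)) (cong (suc K₀ *_) (sym X-volume)) ⟩
  q * (N * R k f) + suc K₀ * (p * volume k (suc n)) ∎)
  where
  open ℕ.≤-Reasoning
  open +-*-Solver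
  N = 2 ^ suc n
  X = p * (2 * volume k n)
  S = ∑ (cube (suc n)) (λ l → R⊥ l k f)
  X-volume : p * volume k (suc n) ≡ 2 ^ k * X
  X-volume = trans (cong (p *_) (volume-suc k n))
    (solve 3 (λ p K v → p :* ((con 2 :* K) :* v) := K :* (p :* (con 2 :* v))) refl p (2 ^ k) (volume k n))

-- Counting independent tuples, and the case of full dimension

member : F₂^ n → Vec (F₂^ n) k → Bool
member v vs = does (anySubset? (λ t → v ≟ combo vs t))

∑-member : ∀ (vs : Vec (F₂^ n) k) → ∑ (cube n) (λ v → 𝟙 (member v vs)) ≤ 2 ^ k
∑-member {n} {k} vs = begin
  ∑ (cube n) (λ v → 𝟙 (member v vs))                                  ≤⟨ ∑-mono (cube n) le ⟩
  ∑ (cube n) (λ v → ∑ (cube k) (λ t → 𝟙 (does (v ≟ combo vs t))))     ≡⟨ ∑-swap (cube n) (cube k) _ ⟩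
  ∑ (cube k) (λ t → ∑ (cube n) (λ v → 𝟙 (does (v ≟ combo vs t))))     ≡⟨ ∑-cong (cube k) (λ t → trans
    (∑-cong (cube n) (λ v → sym (ℕ.*-identityʳ _))) (∑-delta (cubeᴱ n) (combo vs t) (const 1))) ⟩
  ∑ (cube k) (const 1)                                                ≡⟨ ∑-cube-1 k ⟩
  2 ^ k                                                               ∎
  where
  open ℕ.≤-Reasoning
  le : ∀ v → 𝟙 (member v vs) ≤ ∑ (cube k) (λ t → 𝟙 (does (v ≟ combo vs t)))
  le v with anySubset? (λ t → v ≟ combo vs t)
  ... | no  _        = z≤n
  ... | yes (t , eq) = ℕ.≤-trans (ℕ.≤-reflexive (sym (cong 𝟙 (dec-true (v ≟ combo vs t) eq))))
                                 (term≤∑ (λ t → 𝟙 (does (v ≟ combo vs t))) (cube-complete t))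

independent : Vec (F₂^ n) k → Bool
independent []       = true
independent (v ∷ vs) = independent vs ∧ not (member v vs)

independent-sound : ∀ (vs : Vec (F₂^ n) k) → independent vs ≡ true → Independent vs
independent-sound []       _   []      _  = refl
independent-sound (v ∷ vs) ind t       eq with independent vs in ind′ | member v vs in v∉
independent-sound (v ∷ vs) ind (true  ∷ t) eq | true | false = contradiction
  (t , trans (sym (·-identity v)) (⊕≡𝟎⇒≡ (true · v) (combo vs t) eq)) (does-false (anySubset? _) v∉)
independent-sound (v ∷ vs) ind (false ∷ t) eq | true | false = cong (false ∷_) (independent-sound vs ind′ t
  (trans (sym (trans (cong (_⊕ combo vs t) (·-zero v)) (⊕-identityˡ _))) eq))

D-independent : ∀ (vs : Vec (F₂^ n) k) f → independent vs ≡ false → ∀ a → D vs f a ≡ false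
D-independent (v ∷ vs) f dep a with independent vs in ind′ | member v vs in v∈
... | false | _    = cong₂ _xor_ (D-independent vs f ind′ a) (D-independent vs f ind′ (a ⊕ v))
... | true  | true with t , eq ← does-true (anySubset? (λ t → v ≟ combo vs t)) v∈ = D-dependent vs v f t eq a

#independent : ℕ → ℕ → ℕ
#independent k n = ∑ (tuples k n) (𝟙 ∘ independent)

#independent-suc : ∀ k n → 2 ^ n * #independent k n ≤ #independent (suc k) n + 2 ^ k * #independent k n
#independent-suc k n = begin
  2 ^ n * #independent k n
    ≡⟨ trans (sym (∑-* (tuples k n) (2 ^ n) _)) (∑-cong (tuples k n) (λ vs → sym (∑-cube-const n _))) ⟩
  ∑ (tuples k n) (λ vs → ∑ (cube n) (λ v → 𝟙 (independent vs)))
    ≡⟨ ∑-cong (tuples k n) (λ vs → trans (∑-cong (cube n) (λ v → cases (independent vs) (member v vs)))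
         (trans (∑-+ (cube n) _ _) (cong (s vs +_) (∑-* (cube n) (𝟙 (independent vs)) _)))) ⟩
  ∑ (tuples k n) (λ vs → s vs + 𝟙 (independent vs) * ∑ (cube n) (λ v → 𝟙 (member v vs)))
    ≤⟨ ∑-mono (tuples k n) (λ vs → ℕ.+-monoʳ-≤ (s vs) (ℕ.*-monoʳ-≤ (𝟙 (independent vs)) (∑-member vs))) ⟩
  ∑ (tuples k n) (λ vs → s vs + 𝟙 (independent vs) * 2 ^ k)
    ≡⟨ trans (∑-+ (tuples k n) _ _) (cong₂ _+_
         (trans (∑-swap (tuples k n) (cube n) _) (sym (∑-tuples-suc k n _)))
         (trans (∑-*ʳ (tuples k n) (2 ^ k) _) (ℕ.*-comm (#independent k n) (2 ^ k)))) ⟩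
  #independent (suc k) n + 2 ^ k * #independent k n ∎
  where
  open ℕ.≤-Reasoning
  s : Vec (F₂^ n) k → ℕ
  s vs = ∑ (cube n) (λ v → 𝟙 (independent (v ∷ vs)))

  cases : ∀ b c → 𝟙 b ≡ 𝟙 (b ∧ not c) + 𝟙 b * 𝟙 c
  cases false c     = refl
  cases true  false = refl
  cases true  true  = refl

#independent≤ : ∀ k n → #independent k n ≤ (2 ^ n) ^ k
#independent≤ k n = ℕ.≤-trans (∑-mono (tuples k n) (λ vs → 𝟙≤1 (independent vs)))
  (ℕ.≤-reflexive (trans (∑-tuples-const k n 1) (ℕ.*-identityʳ _)))
  where
  𝟙≤1 : ∀ b → 𝟙 b ≤ 1
  𝟙≤1 false = z≤n
  𝟙≤1 true  = ℕ.≤-refl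

-- Given `j` earlier vectors, the next one falls into their span with probability at most
-- `2 ^ j / 2 ^ n`; these probabilities sum to less than `2 ^ k / 2 ^ n`.
#independent-union-bound : ∀ k n → 2 ^ n * (2 ^ n) ^ k ≤ 2 ^ n * #independent k n + 2 ^ k * (2 ^ n) ^ k
#independent-union-bound zero    n = ℕ.m≤m+n _ _
#independent-union-bound (suc k) n = begin
  N * (N * N ^ k)                          ≤⟨ ℕ.*-monoʳ-≤ N (#independent-union-bound k n) ⟩
  N * (N * J + K * N ^ k)                  ≤⟨ ℕ.*-monoʳ-≤ N (ℕ.+-monoˡ-≤ (K * N ^ k) (#independent-suc k n)) ⟩
  N * (J′ + K * J + K * N ^ k)             ≤⟨ ℕ.*-monoʳ-≤ N (ℕ.+-monoˡ-≤ (K * N ^ k) (ℕ.+-monoʳ-≤ J′ (ℕ.*-monoʳ-≤ K (#independent≤ k n)))) ⟩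
  N * (J′ + K * N ^ k + K * N ^ k)
    ≡⟨ solve 4 (λ N J′ K P → N :* (J′ :+ K :* P :+ K :* P) := N :* J′ :+ (con 2 :* K) :* (N :* P)) refl N J′ K (N ^ k) ⟩
  N * J′ + 2 * K * (N * N ^ k)             ∎
  where
  open ℕ.≤-Reasoning
  open +-*-Solver
  N = 2 ^ n
  K = 2 ^ k
  J = #independent k n
  J′ = #independent (suc k) n

-- For `suc j` vectors the union bound would be vacuous. It is applied to the first `j` only, which
-- are independent in at least half of the cases; the last vector then avoids a hyperplane, which is
-- another half.
#bases : ∀ j → (2 ^ suc j) ^ suc j ≤ 4 * #independent (suc j) (suc j)
#bases j = begin
  2 * H * N ^ j       ≡⟨ ℕ.*-assoc 2 H (N ^ j) ⟩
  2 * (H * N ^ j)     ≤⟨ ℕ.*-monoʳ-≤ 2 half ⟩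
  2 * (2 * H * J)     ≡⟨ solve 2 (λ H J → con 2 :* (con 2 :* H :* J) := con 4 :* (H :* J)) refl H J ⟩
  4 * (H * J)         ≤⟨ ℕ.*-monoʳ-≤ 4 last ⟩
  4 * #independent (suc j) (suc j) ∎
  where
  open ℕ.≤-Reasoning
  open +-*-Solver
  H = 2 ^ j
  N = 2 ^ suc j
  J = #independent j (suc j)
  half : H * N ^ j ≤ 2 * H * J
  half = ℕ.+-cancelʳ-≤ (H * N ^ j) _ _ (ℕ.≤-trans
    (ℕ.≤-reflexive (solve 2 (λ H P → H :* P :+ H :* P := con 2 :* H :* P) refl H (N ^ j)))
    (#independent-union-bound j (suc j)))
  last : H * J ≤ #independent (suc j) (suc j)
  last = ℕ.+-cancelʳ-≤ (H * J) _ _ (ℕ.≤-trans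
    (ℕ.≤-reflexive (solve 2 (λ H J → H :* J :+ H :* J := con 2 :* H :* J) refl H J)) (#independent-suc j (suc j)))

weightOn-∑ : ∀ (vs : Vec (F₂^ n) k) e a → weightOn vs e a ≡ ∑ (cube k) (λ t → 𝟙 (e (⟦ a , vs ⟧ t)))
weightOn-∑ []       e a = sym (trans (ℕ.+-identityʳ _) (cong (𝟙 ∘ e) (⊕-identityʳ a)))
weightOn-∑ {k = suc k} (v ∷ vs) e a = sym (trans (∑-cube-suc k _) (cong₂ _+_
  (trans (∑-cong (cube k) (λ t → cong (λ x → 𝟙 (e (a ⊕ x))) (trans (cong (_⊕ combo vs t) (·-zero v)) (⊕-identityˡ _))))
         (sym (weightOn-∑ vs e a)))
  (trans (∑-cong (cube k) (λ t → cong (𝟙 ∘ e) (trans (cong (λ x → a ⊕ (x ⊕ combo vs t)) (·-identity v)) (sym (⊕-assoc a v _)))))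
         (sym (weightOn-∑ vs e (a ⊕ v))))))

⟦⟧-injective : ∀ (vs : Vec (F₂^ n) k) a → Independent vs → Injective _≡_ _≡_ ⟦ a , vs ⟧
⟦⟧-injective vs a ind {s} {t} eq = ⊕≡𝟎⇒≡ s t (ind (s ⊕ t) (trans (combo-⊕ vs s t) (trans
  (cong (_⊕ combo vs t) (trans (sym (⊕-cancelˡ a (combo vs s))) (trans (cong (a ⊕_) eq) (⊕-cancelˡ a (combo vs t)))))
  (⊕-self (combo vs t)))))

-- The image of an injective self-map already has `2 ^ n` points, so counting leaves nothing outside
-- it and `φ` permutes the cube.
∑-injective : (φ : F₂^ n → F₂^ n) → Injective _≡_ _≡_ φ → ∀ (h : F₂^ n → ℕ) → ∑ (cube n) (h ∘ φ) ≡ ∑ (cube n) h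
∑-injective {n} φ inj h = trans (image-sum h) (∑-cong (cube n) (λ y → trans (cong (λ b → 𝟙 b * h y) (everything y)) (ℕ.+-identityʳ (h y))))
  where
  inImage : F₂^ n → Bool
  inImage y = does (anySubset? (λ t → φ t ≟ y))

  image-sum : ∀ h → ∑ (cube n) (h ∘ φ) ≡ ∑ (cube n) (λ y → 𝟙 (inImage y) * h y)
  image-sum = ∑-reindex (cubeᴱ n) (cubeᴱ n) φ inj inImage
    (λ t → dec-true (anySubset? _) (t , refl)) (λ y → does-true (anySubset? _))

  outside≡0 : ∑ (cube n) (𝟙 ∘ not ∘ inImage) ≡ 0
  outside≡0 = ℕ.+-cancelʳ-≡ (2 ^ n) _ _ (begin
    ∑ (cube n) (𝟙 ∘ not ∘ inImage) + 2 ^ n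
      ≡⟨ cong (∑ (cube n) (𝟙 ∘ not ∘ inImage) +_) (trans (sym (∑-cube-1 n)) (trans (image-sum (const 1)) (∑-cong (cube n) (λ y → ℕ.*-identityʳ _)))) ⟩
    ∑ (cube n) (𝟙 ∘ not ∘ inImage) + ∑ (cube n) (𝟙 ∘ inImage)
      ≡⟨ trans (sym (∑-+ (cube n) _ _)) (trans (∑-cong (cube n) (λ y → 𝟙-not (inImage y))) (∑-cube-1 n)) ⟩
    2 ^ n ∎)
    where open ≡-Reasoning

  everything : ∀ y → inImage y ≡ true
  everything y with inImage y in out
  ... | true  = refl
  ... | false = contradiction (ℕ.≤-trans (ℕ.≤-reflexive (sym (cong (𝟙 ∘ not) out)))
    (ℕ.≤-trans (term≤∑ (𝟙 ∘ not ∘ inImage) (cube-complete y)) (ℕ.≤-reflexive outside≡0))) λ ()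

D-full : ∀ (vs : Vec (F₂^ n) n) f a → independent vs ≡ true → D vs f a ≡ odd (count f)
D-full vs f a ind = trans (sym (odd-weightOn vs f a)) (cong odd (trans (weightOn-∑ vs f a)
  (∑-injective ⟦ a , vs ⟧ (⟦⟧-injective vs a (independent-sound vs ind)) (𝟙 ∘ f))))

-- The only flat is the whole space: along any basis the derivative is the parity of `count f`,
-- whatever the base point. So either every derivative vanishes or every basis gives a rejecting
-- pair, and bases make up at least a quarter of all tuples.
full-dimension : ∀ j (f : F₂^ (suc j) → F₂) → Lo (suc j) f ⊎ volume (suc j) (suc j) ≤ 4 * R (suc j) f
full-dimension j f with odd (count f) in parity
... | false = inj₁ (λ vs a → vanish vs a (independent vs) refl)
  where
  vanish : ∀ vs a b → independent vs ≡ b → D vs f a ≡ false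
  vanish vs a false dep = D-independent vs f dep a
  vanish vs a true  ind = trans (D-full vs f a ind) parity
... | true = inj₂ (begin
  N * N ^ suc j                        ≤⟨ ℕ.*-monoʳ-≤ N (#bases j) ⟩
  N * (4 * J)                          ≡⟨ solve 2 (λ N J → N :* (con 4 :* J) := con 4 :* (N :* J)) refl N J ⟩
  4 * (N * J)                          ≡⟨ cong (4 *_) (sym (∑-* (tuples (suc j) (suc j)) N _)) ⟩
  4 * ∑ (tuples (suc j) (suc j)) (λ vs → N * 𝟙 (independent vs))
                                       ≤⟨ ℕ.*-monoʳ-≤ 4 (∑-mono (tuples (suc j) (suc j)) (λ vs → reject vs (independent vs) refl)) ⟩
  4 * R (suc j) f                      ∎)
  where
  open ℕ.≤-Reasoning
  open +-*-Solver
  N = 2 ^ suc j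
  J = #independent (suc j) (suc j)
  reject : ∀ vs b → independent vs ≡ b → N * 𝟙 b ≤ ∑ (cube (suc j)) (λ a → 𝟙 (D vs f a))
  reject vs false _   = ℕ.≤-trans (ℕ.≤-reflexive (ℕ.*-zeroʳ N)) z≤n
  reject vs true  ind = ℕ.≤-reflexive (trans (sym (∑-cube-const (suc j) 1)) (∑-cong (cube (suc j)) (λ a → sym (cong 𝟙
    (trans (D-full vs f a ind) parity)))))

-- Numerical form of the induction

R-near-volume : ∀ k (f P : F₂^ n → F₂) → Lo k P → let E = count (λ x → f x xor P x) in
                2 ^ suc k * E ≤ 2 ^ n → volume k n * (2 ^ k * E) ≤ 2 ^ n * (2 * R k f)
R-near-volume {n} k f P LP small = ℕ.≤-trans (ℕ.≤-reflexive (ℕ.*-assoc (2 ^ n) ((2 ^ n) ^ k) _))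
  (ℕ.*-monoʳ-≤ (2 ^ n) (R-near k f P LP small))

0<2^ : ∀ m → 0 < 2 ^ m
0<2^ m = ℕ.m^n>0 2 m

2≤2^ : ∀ m → 0 < m → 2 ≤ 2 ^ m
2≤2^ (suc m) _ = ℕ.≤-trans (ℕ.*-monoʳ-≤ 2 (0<2^ m)) ℕ.≤-refl

-- Half of the directions, `H` of them, may be exceptional; since `H` is at least 2, the rest and
-- `𝟎` still leave a quarter of the proportion. With more than `H` close hyperplanes and `T = 0`,
-- the glued polynomial has fewer than two errors: none means close, and for exactly one the second
-- moment estimate applies directly.
codimension-bound : ∀ j d (f : F₂^ (j + suc d) → F₂) →
                    Close (suc d) 0 f ⊎ volume (suc d) (j + suc d) ≤ 4 ^ suc j * R (suc d) f
codimension-bound zero d f with full-dimension d f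
... | inj₁ Lf  = inj₁ (f , Lf , ℕ.≤-reflexive (count-const-false (λ x → Bool.xor-same (f x))))
... | inj₂ far = inj₂ far
codimension-bound (suc j) d f = conclude
  (induction-step κ ν 0 1 q H (ℕ.m≤n⇒m≤1+n (ℕ.^-monoʳ-≤ 2 (ℕ.m≤n+m κ j))) (0<2^ (suc ν)) hyp f)
  where
  open ℕ.≤-Reasoning
  open +-*-Solver
  κ = suc d
  ν = j + κ
  q = 4 ^ suc j
  H = 2 ^ ν
  V = volume κ (suc ν)
  2≤H : 2 ≤ H
  2≤H = 2≤2^ ν (ℕ.≤-trans (s≤s z≤n) (ℕ.m≤n+m κ j))

  hyp : ∀ f → Close κ 0 f ⊎ 1 * volume κ ν ≤ q * R κ f
  hyp f with codimension-bound j d f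
  ... | inj₁ close = inj₁ close
  ... | inj₂ far   = inj₂ (ℕ.≤-trans (ℕ.≤-reflexive (ℕ.+-identityʳ _)) far)

  close-case : ∀ P → Lo κ P → ∀ K → H < K → ∀ E → count (λ x → f x xor P x) ≡ E → K * E ≤ 4 * (K * 0) + 2 ^ suc ν →
               Close κ 0 f ⊎ V ≤ 4 ^ suc (suc j) * R κ f
  close-case P LP K H<K 0 E≡ _ = inj₁ (P , LP , ℕ.≤-reflexive E≡)
  close-case P LP K H<K 1 E≡ _ = inj₂ (ℕ.*-cancelˡ-≤ (2 ^ κ) {{ℕ.m^n≢0 2 κ}} (begin
    2 ^ κ * V                              ≡⟨ solve 2 (λ K V → K :* V := V :* (K :* con 1)) refl (2 ^ κ) V ⟩
    V * (2 ^ κ * 1)                        ≡⟨ cong (λ E → V * (2 ^ κ * E)) (sym E≡) ⟩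
    V * (2 ^ κ * count (λ x → f x xor P x))
      ≤⟨ R-near-volume κ f P LP (ℕ.≤-trans (ℕ.≤-reflexive (trans (cong (2 ^ suc κ *_) E≡) (ℕ.*-identityʳ _)))
           (ℕ.^-monoʳ-≤ 2 (s≤s (ℕ.m≤n+m κ j)))) ⟩
    2 ^ suc ν * (2 * R κ f)                ≡⟨ cong (λ μ → 2 * μ * (2 * R κ f)) (ℕ.^-distribˡ-+-* 2 j κ) ⟩
    2 * (2 ^ j * 2 ^ κ) * (2 * R κ f)      ≡⟨ solve 3 (λ J K R → con 2 :* (J :* K) :* (con 2 :* R) := K :* (con 4 :* (J :* R))) refl (2 ^ j) (2 ^ κ) (R κ f) ⟩
    2 ^ κ * (4 * (2 ^ j * R κ f))          ≤⟨ ℕ.*-monoʳ-≤ (2 ^ κ) (ℕ.*-monoʳ-≤ 4 (ℕ.*-monoˡ-≤ (R κ f)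
                                                (ℕ.≤-trans (ℕ.^-monoˡ-≤ j (s≤s (s≤s (z≤n {2})))) (ℕ.m≤n*m (4 ^ j) 4)))) ⟩
    2 ^ κ * (4 * (4 ^ suc j * R κ f))      ≡⟨ cong (2 ^ κ *_) (sym (ℕ.*-assoc 4 (4 ^ suc j) _)) ⟩
    2 ^ κ * (4 ^ suc (suc j) * R κ f)      ∎))
  close-case P LP K H<K (suc (suc E)) E≡ few = contradiction (begin-strict
    2 * H             <⟨ ℕ.*-monoʳ-< 2 H<K ⟩
    2 * K             ≡⟨ ℕ.*-comm 2 K ⟩
    K * 2             ≤⟨ ℕ.*-monoʳ-≤ K (s≤s (s≤s (z≤n {E}))) ⟩
    K * suc (suc E)   ≤⟨ few ⟩
    4 * (K * 0) + 2 ^ suc ν ≡⟨ cong (λ z → 4 * z + 2 ^ suc ν) (ℕ.*-zeroʳ K) ⟩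
    2 * H             ∎) (ℕ.<-irrefl refl)

  conclude : (∃ λ P → Lo κ P × ∃ λ K → H < K × K * count (λ x → f x xor P x) ≤ 4 * (K * 0) + 2 ^ suc ν)
             ⊎ 2 ^ suc ν * (1 * V) ≤ q * (2 ^ suc ν * R κ f) + suc H * (1 * V) →
             Close κ 0 f ⊎ V ≤ 4 ^ suc (suc j) * R κ f
  conclude (inj₁ (P , LP , K , H<K , few)) = close-case P LP K H<K _ refl few
  conclude (inj₂ far) = inj₂ (ℕ.*-cancelˡ-≤ H {{ℕ.m^n≢0 2 ν}} (ℕ.+-cancelʳ-≤ (3 * H * V) _ _ (begin
    H * V + 3 * H * V                                 ≡⟨ solve 2 (λ H V → H :* V :+ con 3 :* H :* V := con 2 :* (con 2 :* H :* (con 1 :* V))) refl H V ⟩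
    2 * (2 * H * (1 * V))                             ≤⟨ ℕ.*-monoʳ-≤ 2 far ⟩
    2 * (q * (2 * H * R κ f) + suc H * (1 * V))       ≡⟨ solve 4 (λ q H R V → con 2 :* (q :* (con 2 :* H :* R) :+ (con 1 :+ H) :* (con 1 :* V))
                                                           := H :* ((con 4 :* q) :* R) :+ (con 2 :+ con 2 :* H) :* V) refl q H (R κ f) V ⟩
    H * (4 * q * R κ f) + (2 + 2 * H) * V             ≤⟨ ℕ.+-monoʳ-≤ _ (ℕ.*-monoˡ-≤ V (ℕ.≤-trans (ℕ.+-monoˡ-≤ (2 * H) 2≤H)
                                                           (ℕ.≤-reflexive (solve 1 (λ H → H :+ con 2 :* H := con 3 :* H) refl H)))) ⟩
    H * (4 * q * R κ f) + 3 * H * V                   ∎)))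

-- Each step loses the factor 1 − (8 · 2 ^ d + 1) / 2 ^ ν of the exceptional directions; the decrease
-- of (2 ^ ν + 32 · 2 ^ d) / 2 ^ ν makes up for the product of these factors.
far-bound : ∀ q → 4 ^ 5 ≤ q → ∀ i d (f : F₂^ (i + (4 + suc d)) → F₂) → let ν = i + (4 + suc d) in
  Close (suc d) (2 ^ suc i) f
  ⊎ (2 ^ ν + 32 * 2 ^ d) * volume (suc d) ν ≤ (2 * q * 2 ^ ν) * R (suc d) f
far-bound q 4^5≤q zero d f = conclude (codimension-bound 4 d f)
  where
  open ℕ.≤-Reasoning
  open +-*-Solver
  κ = suc d
  ν = 4 + κ
  Δ = 2 ^ d
  V = volume κ ν
  -- At codimension 4 both summands of `2 ^ ν + 32 * Δ` are equal, so the relative excess starts at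
  -- the factor 2 that accompanies `q`.
  2^n : 2 ^ ν ≡ 32 * Δ
  2^n = solve 1 (λ Δ → con 2 :* (con 2 :* (con 2 :* (con 2 :* (con 2 :* Δ)))) := con 32 :* Δ) refl Δ

  conclude : Close κ 0 f ⊎ V ≤ 4 ^ 5 * R κ f → Close κ 2 f ⊎ (2 ^ ν + 32 * Δ) * V ≤ 2 * q * 2 ^ ν * R κ f
  conclude (inj₁ (P , LP , few)) = inj₁ (P , LP , ℕ.≤-trans few z≤n)
  conclude (inj₂ far) = inj₂ (begin
    (2 ^ ν + 32 * Δ) * V        ≡⟨ cong (λ μ → (μ + 32 * Δ) * V) 2^n ⟩
    (32 * Δ + 32 * Δ) * V       ≡⟨ solve 2 (λ Δ V → (con 32 :* Δ :+ con 32 :* Δ) :* V := con 64 :* Δ :* V) refl Δ V ⟩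
    64 * Δ * V                  ≤⟨ ℕ.*-monoʳ-≤ (64 * Δ) (ℕ.≤-trans far (ℕ.*-monoˡ-≤ (R κ f) 4^5≤q)) ⟩
    64 * Δ * (q * R κ f)        ≡⟨ solve 3 (λ Δ q R → con 64 :* Δ :* (q :* R) := (con 2 :* q :* (con 32 :* Δ)) :* R) refl Δ q (R κ f) ⟩
    2 * q * (32 * Δ) * R κ f    ≡⟨ cong (λ μ → 2 * q * μ * R κ f) (sym 2^n) ⟩
    2 * q * 2 ^ ν * R κ f       ∎)
far-bound q 4^5≤q (suc i) d f = conclude
  -- As `M` is `32 * (T * Δ)`, more than `8 * Δ` close hyperplanes push the variance term below
  -- `4 * T` errors, hence the total to at most `8 * T`.
  (induction-step κ ν T (μ + 32 * Δ) (2 * q * μ) (8 * Δ)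
    (ℕ.≤-trans (ℕ.*-monoˡ-≤ Δ {2} {8} (s≤s (s≤s z≤n))) (ℕ.n≤1+n _)) small (far-bound q 4^5≤q i d) f)
  where
  open ℕ.≤-Reasoning
  open +-*-Solver
  κ = suc d
  ν = i + (4 + κ)
  Δ = 2 ^ d
  T = 2 ^ suc i
  μ = 2 ^ ν
  M = 2 ^ suc ν
  V = volume κ (suc ν)

  M≡ : M ≡ 32 * (T * Δ)
  M≡ = trans (cong (2 *_) (ℕ.^-distribˡ-+-* 2 i (4 + κ)))
    (solve 2 (λ I Δ → con 2 :* (I :* (con 2 :* (con 2 :* (con 2 :* (con 2 :* (con 2 :* Δ))))))
      := con 32 :* ((con 2 :* I) :* Δ)) refl (2 ^ i) Δ)

  32Δ≤m : 32 * Δ ≤ μ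
  32Δ≤m = ℕ.≤-trans (ℕ.≤-reflexive (solve 1 (λ Δ → con 32 :* Δ := con 2 :* (con 2 :* (con 2 :* (con 2 :* (con 2 :* Δ))))) refl Δ))
    (ℕ.^-monoʳ-≤ 2 (ℕ.m≤n+m (4 + κ) i))

  16≤q : 16 ≤ q
  16≤q = ℕ.≤-trans (ℕ.^-monoʳ-≤ 4 {2} {5} (s≤s (s≤s z≤n))) 4^5≤q

  small : T * 2 ^ (2 + κ) < M
  small = begin-strict
    T * 2 ^ (2 + κ)   ≡⟨ solve 2 (λ T Δ → T :* (con 2 :* (con 2 :* (con 2 :* Δ))) := con 8 :* (T :* Δ)) refl T Δ ⟩
    8 * (T * Δ)       <⟨ ℕ.*-monoˡ-< (T * Δ) {{ℕ.m*n≢0 T Δ {{ℕ.m^n≢0 2 (suc i)}} {{ℕ.m^n≢0 2 d}}}} {8} {32} (ℕ.m≤m+n 9 23) ⟩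
    32 * (T * Δ)      ≡⟨ sym M≡ ⟩
    M                 ∎

  -- Gluing gives `8 * T` errors where `2 * T` are allowed. In the gap the second moment estimate
  -- takes over; its range ends exactly at `8 * T`, since `2 ^ suc κ * (8 * T)` equals `M`.
  close-case : ∀ P → Lo κ P → ∀ E → count (λ x → f x xor P x) ≡ E → E ≤ 8 * T →
               Close κ (2 * T) f ⊎ (M + 32 * Δ) * V ≤ 2 * q * M * R κ f
  close-case P LP E refl E≤8T = decide (E ℕ.≤? 2 * T)
    where
    V≤ : 2 * T < E → V ≤ 16 * R κ f
    V≤ 2T<E = ℕ.*-cancelˡ-≤ (4 * (T * Δ)) {{ℕ.m*n≢0 4 (T * Δ) {{_}} {{ℕ.m*n≢0 T Δ {{ℕ.m^n≢0 2 (suc i)}} {{ℕ.m^n≢0 2 d}}}}}} (begin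
      4 * (T * Δ) * V               ≡⟨ solve 3 (λ T Δ V → con 4 :* (T :* Δ) :* V := V :* ((con 2 :* Δ) :* (con 2 :* T))) refl T Δ V ⟩
      V * (2 * Δ * (2 * T))         ≤⟨ ℕ.*-monoʳ-≤ V (ℕ.*-monoʳ-≤ (2 * Δ) (ℕ.<⇒≤ 2T<E)) ⟩
      V * (2 * Δ * E)               ≤⟨ R-near-volume κ f P LP (ℕ.≤-trans (ℕ.*-monoʳ-≤ (2 ^ suc κ) E≤8T) (ℕ.≤-reflexive
        (trans (solve 2 (λ T Δ → (con 2 :* (con 2 :* Δ)) :* (con 8 :* T) := con 32 :* (T :* Δ)) refl T Δ) (sym M≡)))) ⟩
      M * (2 * R κ f)               ≡⟨ cong (_* (2 * R κ f)) M≡ ⟩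
      32 * (T * Δ) * (2 * R κ f)    ≡⟨ solve 2 (λ X R → con 32 :* X :* (con 2 :* R) := con 4 :* X :* (con 16 :* R)) refl (T * Δ) (R κ f) ⟩
      4 * (T * Δ) * (16 * R κ f)    ∎)

    decide : Dec (E ≤ 2 * T) → Close κ (2 * T) f ⊎ (M + 32 * Δ) * V ≤ 2 * q * M * R κ f
    decide (yes E≤2T) = inj₁ (P , LP , E≤2T)
    decide (no  E≰2T) = inj₂ (begin
      (M + 32 * Δ) * V      ≤⟨ ℕ.*-monoˡ-≤ V (ℕ.+-monoʳ-≤ M (ℕ.≤-trans 32Δ≤m (ℕ.m≤n*m μ 2))) ⟩
      (M + M) * V           ≡⟨ solve 2 (λ M V → (M :+ M) :* V := con 2 :* M :* V) refl M V ⟩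
      2 * M * V             ≤⟨ ℕ.*-monoʳ-≤ (2 * M) (V≤ (ℕ.≰⇒> E≰2T)) ⟩
      2 * M * (16 * R κ f)  ≡⟨ solve 2 (λ M R → con 2 :* M :* (con 16 :* R) := con 32 :* M :* R) refl M (R κ f) ⟩
      32 * M * R κ f        ≤⟨ ℕ.*-monoˡ-≤ (R κ f) (ℕ.*-monoˡ-≤ M (ℕ.*-monoʳ-≤ 2 {16} 16≤q)) ⟩
      2 * q * M * R κ f     ∎)

  E-bound : ∀ K E → 8 * Δ < K → K * E ≤ 4 * (K * T) + M → E ≤ 8 * T
  E-bound K@(suc _) E 8Δ<K few = ℕ.*-cancelˡ-≤ K (begin
    K * E                          ≤⟨ few ⟩
    4 * (K * T) + M                ≡⟨ cong (4 * (K * T) +_) M≡ ⟩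
    4 * (K * T) + 32 * (T * Δ)     ≡⟨ cong (4 * (K * T) +_) (solve 2 (λ T Δ → con 32 :* (T :* Δ) := con 4 :* ((con 8 :* Δ) :* T)) refl T Δ) ⟩
    4 * (K * T) + 4 * (8 * Δ * T)  ≤⟨ ℕ.+-monoʳ-≤ (4 * (K * T)) (ℕ.*-monoʳ-≤ 4 (ℕ.*-monoˡ-≤ T (ℕ.<⇒≤ 8Δ<K))) ⟩
    4 * (K * T) + 4 * (K * T)      ≡⟨ solve 2 (λ K T → con 4 :* (K :* T) :+ con 4 :* (K :* T) := K :* (con 8 :* T)) refl K T ⟩
    K * (8 * T)                    ∎)

  conclude : (∃ λ P → Lo κ P × ∃ λ K → 8 * Δ < K × K * count (λ x → f x xor P x) ≤ 4 * (K * T) + M)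
             ⊎ M * ((μ + 32 * Δ) * V) ≤ 2 * q * μ * (M * R κ f) + suc (8 * Δ) * ((μ + 32 * Δ) * V) →
             Close κ (2 * T) f ⊎ (M + 32 * Δ) * V ≤ 2 * q * M * R κ f
  conclude (inj₁ (P , LP , K , 8Δ<K , few)) = close-case P LP _ refl (E-bound K _ 8Δ<K few)
  conclude (inj₂ far) = inj₂ (ℕ.*-cancelˡ-≤ μ {{ℕ.m^n≢0 2 ν}} (ℕ.+-cancelʳ-≤ (suc (8 * Δ) * ((μ + 32 * Δ) * V)) _ _ (begin
    μ * ((2 * μ + 32 * Δ) * V) + suc (8 * Δ) * ((μ + 32 * Δ) * V)
      ≡⟨ solve 3 (λ μ Δ V → μ :* ((con 2 :* μ :+ con 32 :* Δ) :* V) :+ (con 1 :+ con 8 :* Δ) :* ((μ :+ con 32 :* Δ) :* V)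
           := (μ :* (con 2 :* μ :+ con 32 :* Δ) :+ (con 1 :+ con 8 :* Δ) :* (μ :+ con 32 :* Δ)) :* V) refl μ Δ V ⟩
    (μ * (2 * μ + 32 * Δ) + (1 + 8 * Δ) * (μ + 32 * Δ)) * V
      -- By `1 ≤ Δ` and `32 * Δ ≤ μ` the exceptional directions cost at most `18 * (μ * Δ)`, while
      -- the falling excess releases `32 * (μ * Δ)`; the difference is the slack added in the next
      -- step.
      ≤⟨ ℕ.*-monoˡ-≤ V (ℕ.+-monoʳ-≤ (μ * (2 * μ + 32 * Δ)) (ℕ.*-mono-≤ (ℕ.+-monoˡ-≤ (8 * Δ) (0<2^ d)) (ℕ.+-monoʳ-≤ μ 32Δ≤m))) ⟩
    (μ * (2 * μ + 32 * Δ) + (Δ + 8 * Δ) * (μ + μ)) * V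
      ≤⟨ ℕ.m≤m+n _ (14 * (μ * Δ) * V) ⟩
    (μ * (2 * μ + 32 * Δ) + (Δ + 8 * Δ) * (μ + μ)) * V + 14 * (μ * Δ) * V
      ≡⟨ solve 3 (λ μ Δ V → (μ :* (con 2 :* μ :+ con 32 :* Δ) :+ (Δ :+ con 8 :* Δ) :* (μ :+ μ)) :* V :+ con 14 :* (μ :* Δ) :* V
           := con 2 :* μ :* ((μ :+ con 32 :* Δ) :* V)) refl μ Δ V ⟩
    M * ((μ + 32 * Δ) * V)
      ≤⟨ far ⟩
    2 * q * μ * (M * R κ f) + suc (8 * Δ) * ((μ + 32 * Δ) * V)
      ≡⟨ cong (_+ suc (8 * Δ) * ((μ + 32 * Δ) * V)) (solve 4 (λ q μ M R → con 2 :* q :* μ :* (M :* R) := μ :* (con 2 :* q :* M :* R)) refl q μ M (R κ f)) ⟩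
    μ * (2 * q * M * R κ f) + suc (8 * Δ) * ((μ + 32 * Δ) * V) ∎)))

-- Divided out, with the proportion `R / volume`: it is either at least `2 ^ d` times the distance
-- from `f` to `P`, or at least `1 / (2 * q)`.
Dichotomy : ℕ → ℕ → (F₂^ n → F₂) → Set
Dichotomy {n} q d f =
  (∃ λ P → Lo (suc d) P × volume (suc d) n * (2 ^ d * count (λ x → f x xor P x)) ≤ 2 ^ n * R (suc d) f)
  ⊎ volume (suc d) n ≤ 2 * q * R (suc d) f

small-codimension : ∀ q → 4 ^ 5 ≤ q → ∀ d j → suc j ≤ 4 → (f : F₂^ (j + suc d) → F₂) → Dichotomy q d f
small-codimension q 4^5≤q d j j<4 f = conclude (codimension-bound j d f)
  where
  κ = suc d
  V = volume κ (j + κ)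
  conclude : Close κ 0 f ⊎ V ≤ 4 ^ suc j * R κ f → Dichotomy q d f
  conclude (inj₁ (P , LP , none)) = inj₁ (P , LP , ℕ.≤-trans (ℕ.≤-reflexive (trans
    (cong (λ E → V * (2 ^ d * E)) (ℕ.n≤0⇒n≡0 none))
    (trans (cong (V *_) (ℕ.*-zeroʳ (2 ^ d))) (ℕ.*-zeroʳ V)))) z≤n)
  conclude (inj₂ far) = inj₂ (ℕ.≤-trans far (ℕ.*-monoˡ-≤ (R κ f)
    (ℕ.≤-trans (ℕ.^-monoʳ-≤ 4 (ℕ.m≤n⇒m≤1+n j<4)) (ℕ.≤-trans 4^5≤q (ℕ.m≤n*m q 2)))))

large-codimension : ∀ q → 4 ^ 5 ≤ q → ∀ d i (f : F₂^ (i + (4 + suc d)) → F₂) → Dichotomy q d f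
large-codimension q 4^5≤q d i f = conclude (far-bound q 4^5≤q i d f)
  where
  open ℕ.≤-Reasoning
  open +-*-Solver
  κ = suc d
  ν = i + (4 + κ)
  Δ = 2 ^ d
  V = volume κ ν
  conclude : Close κ (2 ^ suc i) f ⊎ (2 ^ ν + 32 * Δ) * V ≤ 2 * q * 2 ^ ν * R κ f → Dichotomy q d f
  -- The factor 2 lost in `R-near` cancels against the one in `2 ^ suc d`, the number of points of a
  -- flat, and exactly `2 ^ d` remains.
  conclude (inj₁ (P , LP , few)) = inj₁ (P , LP , ℕ.*-cancelˡ-≤ 2 (begin
    2 * (V * (Δ * E))      ≡⟨ solve 3 (λ V Δ E → con 2 :* (V :* (Δ :* E)) := V :* ((con 2 :* Δ) :* E)) refl V Δ E ⟩
    V * (2 * Δ * E)        ≤⟨ R-near-volume κ f P LP (begin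
      2 * (2 * Δ) * E            ≤⟨ ℕ.*-monoʳ-≤ (2 * (2 * Δ)) few ⟩
      2 * (2 * Δ) * (2 * 2 ^ i)  ≡⟨ solve 2 (λ Δ I → con 2 :* (con 2 :* Δ) :* (con 2 :* I) := con 8 :* (I :* Δ)) refl Δ (2 ^ i) ⟩
      8 * (2 ^ i * Δ)            ≤⟨ ℕ.*-monoˡ-≤ (2 ^ i * Δ) {8} {32} (ℕ.m≤m+n 8 24) ⟩
      32 * (2 ^ i * Δ)           ≡⟨ solve 2 (λ Δ I → con 32 :* (I :* Δ) := I :* (con 2 :* (con 2 :* (con 2 :* (con 2 :* (con 2 :* Δ)))))) refl Δ (2 ^ i) ⟩
      2 ^ i * 2 ^ (4 + κ)        ≡⟨ sym (ℕ.^-distribˡ-+-* 2 i (4 + κ)) ⟩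
      2 ^ ν                      ∎) ⟩
    2 ^ ν * (2 * R κ f)    ≡⟨ solve 2 (λ N R → N :* (con 2 :* R) := con 2 :* (N :* R)) refl (2 ^ ν) (R κ f) ⟩
    2 * (2 ^ ν * R κ f)    ∎))
    where E = count (λ x → f x xor P x)
  conclude (inj₂ far) = inj₂ (ℕ.*-cancelˡ-≤ (2 ^ ν) {{ℕ.m^n≢0 2 ν}} (begin
    2 ^ ν * V                     ≤⟨ ℕ.*-monoˡ-≤ V (ℕ.m≤m+n (2 ^ ν) (32 * Δ)) ⟩
    (2 ^ ν + 32 * Δ) * V          ≤⟨ far ⟩
    2 * q * 2 ^ ν * R κ f         ≡⟨ solve 3 (λ q N R → con 2 :* q :* N :* R := N :* (con 2 :* q :* R)) refl q (2 ^ ν) (R κ f) ⟩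
    2 ^ ν * (2 * q * R κ f)       ∎))

dichotomy : ∀ q → 4 ^ 5 ≤ q → ∀ d n → suc d ≤ n → (f : F₂^ n → F₂) → Dichotomy q d f
dichotomy q 4^5≤q d n d<n = by-codimension (n ∸ suc d) (4 ℕ.≤? n ∸ suc d) (ℕ.m∸n+n≡m d<n)
  where
  large : ∀ i {j} → i + 4 ≡ j → ∀ {n} → j + suc d ≡ n → (f : F₂^ n → F₂) → Dichotomy q d f
  large i refl refl = subst (λ n → (f : F₂^ n → F₂) → Dichotomy q d f)
    (sym (ℕ.+-assoc i 4 (suc d))) (large-codimension q 4^5≤q d i)

  by-codimension : ∀ j → Dec (4 ≤ j) → ∀ {n} → j + suc d ≡ n → (f : F₂^ n → F₂) → Dichotomy q d f
  by-codimension j (no 4≰j)  refl = small-codimension q 4^5≤q d j (ℕ.≰⇒> 4≰j)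
  by-codimension j (yes 4≤j) eq   = large (j ∸ 4) (ℕ.m∸n+n≡m 4≤j) eq

-- Derivatives and the degree of the multilinear polynomial

anf-Lo : ∀ (S : Subset n) {f : F₂^ n → F₂} → Lo k f → k ≤ ∣ S ∣ → anf f S ≡ false
anf-Lo []            {f} Lf z≤n = Lf [] []
anf-Lo (outside ∷ S) Lf k≤ = anf-Lo S (Lo-half false Lf) k≤
anf-Lo {k = zero}  (inside ∷ S) {f} Lf _ = anf-Lo {k = zero} S
  (λ { [] x → cong₂ _xor_ (Lf [] (false ∷ x)) (Lf [] (true ∷ x)) }) z≤n
-- A coordinate in `S` replaces `f` by its derivative in that unit direction and so uses up one
-- degree; the coefficient at `S` is an iterated derivative of order `∣ S ∣`.
anf-Lo {k = suc k} (inside ∷ S) {f} Lf (s≤s k≤) = anf-Lo S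
  (Lo-cong (λ x → cong (λ y → f (false ∷ x) xor f (true ∷ y)) (⊕-identityʳ x))
    (Lo-half false (Lo-∂ Lf (true ∷ 𝟎)))) k≤

Lo⇒deg≤ : ∀ d {f : F₂^ n → F₂} → Lo (suc d) f → deg f ≤ d
Lo⇒deg≤ {n} d {f} Lf = max≤v⁺ z≤n (Allₚ.map⁺ (All.map (λ {S} fS → bound S fS)
  (Allₚ.all-filter (λ S → anf f S Bool.≟ true) (cube n))))
  where
  bound : ∀ S → anf f S ≡ true → ∣ S ∣ ≤ d
  bound S fS = ℕ.≮⇒≥ (λ d<∣S∣ → contradiction (trans (sym fS) (anf-Lo S Lf d<∣S∣)) λ ())

odd-∑-xor : ∀ (xs : List A) (f g : A → F₂) →
            odd (∑ xs (λ x → 𝟙 (f x xor g x))) ≡ odd (∑ xs (𝟙 ∘ f)) xor odd (∑ xs (𝟙 ∘ g))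
odd-∑-xor []       f g = refl
odd-∑-xor (x ∷ xs) f g = begin
  odd (𝟙 (f x xor g x) + ∑ xs (λ x → 𝟙 (f x xor g x)))
    ≡⟨ trans (odd-+ (𝟙 (f x xor g x)) _) (cong₂ _xor_ (odd-𝟙 (f x xor g x)) (odd-∑-xor xs f g)) ⟩
  (f x xor g x) xor (odd (∑ xs (𝟙 ∘ f)) xor odd (∑ xs (𝟙 ∘ g)))
    ≡⟨ xor-interchange (f x) (g x) _ _ ⟩
  (f x xor odd (∑ xs (𝟙 ∘ f))) xor (g x xor odd (∑ xs (𝟙 ∘ g)))
    ≡⟨ sym (cong₂ _xor_ (odd-∷ f) (odd-∷ g)) ⟩
  odd (∑ (x ∷ xs) (𝟙 ∘ f)) xor odd (∑ (x ∷ xs) (𝟙 ∘ g)) ∎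
  where
  open ≡-Reasoning
  odd-∷ : ∀ f → odd (𝟙 (f x) + ∑ xs (𝟙 ∘ f)) ≡ f x xor odd (∑ xs (𝟙 ∘ f))
  odd-∷ f = trans (odd-+ (𝟙 (f x)) _) (cong (_xor odd (∑ xs (𝟙 ∘ f))) (odd-𝟙 (f x)))

anf-full : ∀ n (f : F₂^ n → F₂) → anf f (replicate n inside) ≡ odd (count f)
anf-full zero    f = sym (trans (odd-+ (𝟙 (f [])) 0) (trans (Bool.xor-identityʳ _) (odd-𝟙 (f []))))
anf-full (suc n) f = trans (anf-full n _) (trans (odd-∑-xor (cube n) (f ∘ (false ∷_)) (f ∘ (true ∷_)))
  (sym (trans (cong odd (count-suc f)) (odd-+ (count (f ∘ (false ∷_))) _))))

∣full∣ : ∀ n → ∣ replicate n inside ∣ ≡ n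
∣full∣ zero    = refl
∣full∣ (suc n) = cong suc (∣full∣ n)

-- The coefficient of the full monomial is the parity of `f` over the cube, so an odd sum would
-- force degree `suc d`.
deg≤⇒even : ∀ d (f : F₂^ (suc d) → F₂) → deg f ≤ d → odd (count f) ≡ false
deg≤⇒even d f deg≤d = Bool.¬-not (λ oddf → ℕ.1+n≰n (begin
  suc d                            ≡⟨ sym (∣full∣ (suc d)) ⟩
  ∣ replicate (suc d) inside ∣     ≤⟨ All.lookup (xs≤max 0 _) (∈.∈-map⁺ ∣_∣
    (∈.∈-filter⁺ (λ S → anf f S Bool.≟ true) (cube-complete (replicate (suc d) inside)) (trans (anf-full (suc d) f) oddf))) ⟩
  deg f                            ≤⟨ deg≤d ⟩
  d                                ∎))
  where open ℕ.≤-Reasoning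

-- From pairs of a base point and directions to flats

affineMaps : ∀ k n → List (AffineMap k n)
affineMaps k n = cartesianProductWith (λ vs a → a , vs) (tuples k n) (cube n)

affineᴱ : ∀ k n → Enumeration (AffineMap k n)
affineᴱ k n = record
  { elements = affineMaps k n
  ; unique   = Uniqueₚ.cartesianProductWith⁺ (λ vs a → a , vs) (λ { refl → refl , refl })
                 (unique (tuplesᴱ k n)) (cube-unique n)
  ; complete = λ (a , vs) → ∈.∈-cartesianProductWith⁺ (λ vs a → a , vs) (complete (tuplesᴱ k n) vs) (cube-complete a)
  ; _≈?_     = Productₚ.≡-dec _≟_ (Vecₚ.≡-dec _≟_)
  }

derivative : (F₂^ n → F₂) → AffineMap k n → F₂
derivative f (a , vs) = D vs f a

∑-affineMaps : ∀ k (f : F₂^ n → F₂) → ∑ (affineMaps k n) (𝟙 ∘ derivative f) ≡ R k f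
∑-affineMaps {n} k f = ∑-cartesianProductWith _ (tuples k n) (cube n) (𝟙 ∘ derivative f)

∑-affineMaps-1 : ∀ k n → ∑ (affineMaps k n) (const 1) ≡ volume k n
∑-affineMaps-1 k n = trans (∑-cartesianProductWith (λ vs a → a , vs) (tuples k n) (cube n) (const 1)) (trans
  (∑-cong (tuples k n) (λ _ → ∑-cube-1 n)) (trans (∑-tuples-const k n (2 ^ n)) (ℕ.*-comm ((2 ^ n) ^ k) (2 ^ n))))

-- The number of parametrizations of `A`. That all flats of one dimension share it makes counting
-- pairs equivalent to counting flats.
multiplicity : ∀ k → (F₂^ n → Bool) → ℕ
multiplicity {n} k A = ∑ (affineMaps k n) (λ φ → 𝟙 (does (parametrizes? φ A)))

Parametrizes-resp : ∀ {φ : AffineMap k n} {A B : F₂^ n → Bool} → A ≗ B → φ Parametrizes A → φ Parametrizes B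
Parametrizes-resp {φ = φ} A≗B (inj , im) = inj , λ x → subst (λ b → Equiv x b) (A≗B x) (im x)
  where
  Equiv : _ → Bool → Set
  Equiv x b = b ≡ true ⇔ ∃ λ t → ⟦ φ ⟧ t ≡ x

Parametrizes-unique : ∀ {φ : AffineMap k n} {A B : F₂^ n → Bool} → φ Parametrizes A → φ Parametrizes B → A ≗ B
Parametrizes-unique {A = A} {B} (_ , imA) (_ , imB) x = agree (A x) (B x)
  (λ Ax → Equivalence.from (imB x) (Equivalence.to (imA x) Ax)) (λ Bx → Equivalence.from (imA x) (Equivalence.to (imB x) Bx))
  where
  agree : ∀ b c → (b ≡ true → c ≡ true) → (c ≡ true → b ≡ true) → b ≡ c
  agree false false f g = refl
  agree false true  f g = g refl
  agree true  c     f g = sym (f refl)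

∑-parametrized : ∀ {φ : AffineMap k n} {A : F₂^ n → Bool} → φ Parametrizes A → ∀ (f : F₂^ n → F₂) →
                 count (f ∘ ⟦ φ ⟧) ≡ ∑ (cube n) (λ x → 𝟙 (A x) * 𝟙 (f x))
∑-parametrized {k} {n} {φ} {A} (inj , im) f = ∑-reindex (cubeᴱ k) (cubeᴱ n) ⟦ φ ⟧ inj A
  (λ t → Equivalence.from (im (⟦ φ ⟧ t)) (t , refl)) (λ x → Equivalence.to (im x)) (𝟙 ∘ f)

-- The sum of f over the flat A does not depend on the parametrization.
derivative⇒¬Accepts : ∀ d (f : F₂^ n → F₂) {φ : AffineMap (suc d) n} {A : F₂^ n → Bool} →
                      φ Parametrizes A → derivative f φ ≡ true → ¬ Accepts d f A
derivative⇒¬Accepts d f {φ = a , vs} φA Dφ (φ′ , φ′A , deg≤d) = contradiction (begin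
  true                                        ≡⟨ sym Dφ ⟩
  D vs f a                                    ≡⟨ sym (odd-weightOn vs f a) ⟩
  odd (weightOn vs f a)                       ≡⟨ cong odd (trans (weightOn-∑ vs f a)
    (trans (∑-parametrized φA f) (sym (∑-parametrized φ′A f)))) ⟩
  odd (count (f ∘ ⟦ φ′ ⟧))                    ≡⟨ deg≤⇒even d (f ∘ ⟦ φ′ ⟧) deg≤d ⟩
  false                                       ∎) λ ()
  where open ≡-Reasoning

image : AffineMap k n → F₂^ n → Bool
image φ x = does (anySubset? λ t → ⟦ φ ⟧ t ≟ x)

Parametrizes-image : (φ : AffineMap k n) → Injective _≡_ _≡_ ⟦ φ ⟧ → φ Parametrizes image φ
Parametrizes-image φ inj = inj , λ x → mk⇔ (does-true (anySubset? λ t → ⟦ φ ⟧ t ≟ x)) (dec-true (anySubset? _))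

module Transport {k n} (a : F₂^ n) (us : Vec (F₂^ n) k) where

  compose : AffineMap k k → AffineMap k n
  compose (t , ts) = ⟦ a , us ⟧ t , Vec.map (combo us) ts

  combo-map : ∀ {j} (ts : Vec (F₂^ k) j) s → combo (Vec.map (combo us) ts) s ≡ combo us (combo ts s)
  combo-map []       []      = sym (combo-𝟎 us)
  combo-map (t ∷ ts) (b ∷ s) = trans (cong₂ _⊕_ (·-combo b) (combo-map ts s)) (sym (combo-⊕ us (b · t) (combo ts s)))
    where
    ·-combo : ∀ b → b · combo us t ≡ combo us (b · t)
    ·-combo false = trans (·-zero (combo us t)) (sym (trans (cong (combo us) (·-zero t)) (combo-𝟎 us)))
    ·-combo true  = trans (·-identity (combo us t)) (cong (combo us) (sym (·-identity t)))

  ⟦compose⟧ : ∀ ψ s → ⟦ compose ψ ⟧ s ≡ ⟦ a , us ⟧ (⟦ ψ ⟧ s)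
  ⟦compose⟧ (t , ts) s = trans (cong ((a ⊕ combo us t) ⊕_) (combo-map ts s))
    (trans (⊕-assoc a (combo us t) _) (cong (a ⊕_) (sym (combo-⊕ us t (combo ts s)))))

  module _ {A : F₂^ n → Bool} (param : (a , us) Parametrizes A) where
    private
      inj = proj₁ param
      im  = proj₂ param

    combo-injective : ∀ {s t} → combo us s ≡ combo us t → s ≡ t
    combo-injective eq = inj (cong (a ⊕_) eq)

    compose-injective : Injective _≡_ _≡_ compose
    compose-injective {t , ts} {t′ , ts′} eq with p , q ← Productₚ.,-injective eq =
      cong₂ _,_ (inj p) (map-injective q)
      where
      map-injective : ∀ {j} {ts ts′ : Vec (F₂^ k) j} → Vec.map (combo us) ts ≡ Vec.map (combo us) ts′ → ts ≡ ts′
      map-injective {ts = []}     {[]}       _  = refl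
      map-injective {ts = t ∷ ts} {t′ ∷ ts′} eq with p , q ← Vecₚ.∷-injective eq =
        cong₂ _∷_ (combo-injective p) (map-injective q)

    compose⁺ : ∀ {ψ} → ψ Parametrizes const true → compose ψ Parametrizes A
    compose⁺ {ψ} (injψ , surj) =
      (λ {s} {t} eq → injψ (inj (trans (sym (⟦compose⟧ ψ s)) (trans eq (⟦compose⟧ ψ t))))) ,
      λ x → mk⇔
        (λ Ax → let s , eq = Equivalence.to (im x) Ax
                    t , eq′ = Equivalence.to (surj s) refl
                in t , trans (⟦compose⟧ ψ t) (trans (cong ⟦ a , us ⟧ eq′) eq))
        (λ (t , eq) → Equivalence.from (im x) (⟦ ψ ⟧ t , trans (sym (⟦compose⟧ ψ t)) eq))

    compose⁻ : ∀ {ψ} → compose ψ Parametrizes A → ψ Parametrizes const true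
    compose⁻ {ψ} (injφ , imφ) =
      (λ {s} {t} eq → injφ (trans (⟦compose⟧ ψ s) (trans (cong ⟦ a , us ⟧ eq) (sym (⟦compose⟧ ψ t))))) ,
      λ s → mk⇔
        (λ _ → let t , eq = Equivalence.to (imφ (⟦ a , us ⟧ s)) (Equivalence.from (im (⟦ a , us ⟧ s)) (s , refl))
               in t , inj (trans (sym (⟦compose⟧ ψ t)) eq))
        (λ _ → refl)

    -- Both parametrizations have the same image, so each point of the second has coordinates in the
    -- first. Differences of such coordinates express the span of `vs` through `us`, and evaluating
    -- at unit vectors, as `lift` does, gives the directions of `ψ`.
    compose-surjective : ∀ φ → φ Parametrizes A → ∃ λ ψ → compose ψ ≡ φ
    compose-surjective (b , vs) (injφ , imφ) = (t₀ , proj₁ linear) , cong₂ _,_ eq₀ (proj₂ linear)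
      where
      preimage : ∀ s → ∃ λ t → ⟦ a , us ⟧ t ≡ b ⊕ combo vs s
      preimage s = Equivalence.to (im _) (Equivalence.from (imφ _) (s , refl))

      t₀ = proj₁ (preimage 𝟎)
      eq₀ : ⟦ a , us ⟧ t₀ ≡ b
      eq₀ = trans (proj₂ (preimage 𝟎)) (trans (cong (b ⊕_) (combo-𝟎 vs)) (⊕-identityʳ b))

      difference : ∀ s → ∃ λ t → combo us t ≡ combo vs s
      difference s = t₀ ⊕ t , (begin
        combo us (t₀ ⊕ t)                           ≡⟨ combo-⊕ us t₀ t ⟩
        combo us t₀ ⊕ combo us t                    ≡⟨ sym (⊕-cancelˡ a _) ⟩
        a ⊕ (a ⊕ (combo us t₀ ⊕ combo us t))        ≡⟨ cong (a ⊕_) (sym (⊕-assoc a (combo us t₀) (combo us t))) ⟩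
        a ⊕ ((a ⊕ combo us t₀) ⊕ combo us t)        ≡⟨ cong (λ x → a ⊕ (x ⊕ combo us t)) eq₀ ⟩
        a ⊕ (b ⊕ combo us t)                        ≡⟨ cong (a ⊕_) (⊕-comm b (combo us t)) ⟩
        a ⊕ (combo us t ⊕ b)                        ≡⟨ sym (⊕-assoc a (combo us t) b) ⟩
        (a ⊕ combo us t) ⊕ b                        ≡⟨ cong (_⊕ b) (proj₂ (preimage s)) ⟩
        (b ⊕ combo vs s) ⊕ b                        ≡⟨ ⊕-swap b (combo vs s) b ⟩
        (b ⊕ b) ⊕ combo vs s                        ≡⟨ cong (_⊕ combo vs s) (⊕-self b) ⟩
        𝟎 ⊕ combo vs s                              ≡⟨ ⊕-identityˡ _ ⟩
        combo vs s                                  ∎)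
        where
        open ≡-Reasoning
        t = proj₁ (preimage s)

      lift : ∀ {j} (ws : Vec (F₂^ n) j) → (∀ s → ∃ λ t → combo us t ≡ combo ws s) → ∃ λ ts → Vec.map (combo us) ts ≡ ws
      lift []       _     = [] , refl
      lift (w ∷ ws) diffs
        with t , eq ← diffs (true ∷ 𝟎)
        with ts , eqs ← lift ws (λ s → let t , eq = diffs (false ∷ s) in
               t , trans eq (trans (cong (_⊕ combo ws s) (·-zero w)) (⊕-identityˡ _)))
        = t ∷ ts , cong₂ _∷_ (trans eq (trans (cong₂ _⊕_ (·-identity w) (combo-𝟎 ws)) (⊕-identityʳ w))) eqs

      linear : ∃ λ ts → Vec.map (combo us) ts ≡ vs
      linear = lift vs difference

    -- Composition with one fixed parametrization is a bijection from the affine automorphisms of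
    -- `F₂^ k`, which are the parametrizations of `const true`, to the parametrizations of `A`; so
    -- only `k` matters.
    multiplicity-constant : multiplicity k A ≡ multiplicity {k} k (const true)
    multiplicity-constant = sym (trans
      (∑-cong (affineMaps k k) (λ ψ → cong 𝟙 (does-cong (parametrizes? ψ (const true)) (parametrizes? (compose ψ) A)
        compose⁺ compose⁻)))
      (∑-transport (affineᴱ k k) (affineᴱ k n) compose compose-injective _ (λ φ → support φ (parametrizes? φ A) refl)))
      where
      support : ∀ φ (φA? : Dec (φ Parametrizes A)) → parametrizes? φ A ≡ φA? →
                𝟙 (does (parametrizes? φ A)) ≡ 0 ⊎ ∃ λ ψ → compose ψ ≡ φ
      support φ (yes φA) _  = inj₂ (compose-surjective φ φA)
      support φ (no _)   eq = inj₁ (cong (𝟙 ∘ does) eq)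

at-most-one : ∀ {φ : AffineMap k n} {As : List (F₂^ n → Bool)} → AllPairs (λ A B → ¬ (A ≗ B)) As →
              ∑ As (λ A → 𝟙 (does (parametrizes? φ A))) ≤ 1
at-most-one {As = []}     []             = z≤n
at-most-one {φ = φ} {As = A ∷ As} (A∉ ∷ uniq) = split (parametrizes? φ A)
  where
  none : φ Parametrizes A → ∀ {Bs} → All (λ B → ¬ (A ≗ B)) Bs → ∑ Bs (λ B → 𝟙 (does (parametrizes? φ B))) ≡ 0
  none φA []           = refl
  none φA {B ∷ _} (A≢B ∷ A∉) = cong₂ _+_
    (cong 𝟙 (dec-false (parametrizes? φ B) (λ φB → A≢B (Parametrizes-unique {φ = φ} φA φB)))) (none φA A∉)

  split : Dec (φ Parametrizes A) → ∑ (A ∷ As) (λ A → 𝟙 (does (parametrizes? φ A))) ≤ 1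
  split (yes φA) = ℕ.≤-reflexive (cong₂ _+_ (cong 𝟙 (dec-true (parametrizes? φ A) φA)) (none φA A∉))
  split (no ¬φA) = ℕ.≤-trans
    (ℕ.≤-reflexive (cong (λ b → 𝟙 b + ∑ As (λ A → 𝟙 (does (parametrizes? φ A)))) (dec-false (parametrizes? φ A) ¬φA)))
    (at-most-one {φ = φ} uniq)

∑-filter : ∀ {P : A → Set} (P? : Decidable P) (xs : List A) (h : A → ℕ) →
           ∑ (filter P? xs) h ≡ ∑ xs (λ x → 𝟙 (does (P? x)) * h x)
∑-filter P? []       h = refl
∑-filter P? (x ∷ xs) h with P? x
... | yes _ = cong₂ _+_ (sym (ℕ.+-identityʳ (h x))) (∑-filter P? xs h)
... | no _  = ∑-filter P? xs h

length-filter : ∀ {P : A → Set} (P? : Decidable P) (xs : List A) →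
                length (filter P? xs) ≡ ∑ xs (λ x → 𝟙 (does (P? x)))
length-filter P? xs = trans (sym (∑-1 (filter P? xs)))
  (trans (∑-filter P? xs (const 1)) (∑-cong xs (λ x → ℕ.*-identityʳ _)))

module Flats (k n : ℕ) where

  M : ℕ
  M = multiplicity {k} k (const true)

  isFlat : ∀ {A} → A ∈ flats k n → IsFlat k A
  isFlat A∈ = proj₂ (∈.∈-filter⁻ (isFlat? k) {xs = functions n} A∈)

  multiplicity-flat : ∀ {A} → A ∈ flats k n → multiplicity k A ≡ M
  multiplicity-flat {A} A∈ = constant (isFlat A∈)
    where
    constant : IsFlat k A → multiplicity k A ≡ M
    constant ((a , us) , param) = Transport.multiplicity-constant a us param

  ∑-multiplicity : ∀ (h : (F₂^ n → Bool) → ℕ) → ∑ (flats k n) h * M ≡ ∑ (flats k n) (λ A → h A * multiplicity k A)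
  -- The multiplicities are known for members of the list only, so the equality is assembled from
  -- two inequalities relative to membership.
  ∑-multiplicity h = trans (sym (∑-*ʳ (flats k n) M h)) (ℕ.≤-antisym
    (∑-mono-∈ (flats k n) (λ {A} A∈ → ℕ.≤-reflexive (cong (h A *_) (sym (multiplicity-flat A∈)))))
    (∑-mono-∈ (flats k n) (λ {A} A∈ → ℕ.≤-reflexive (cong (h A *_) (multiplicity-flat A∈)))))

  ∑-flats-affineMaps : ∀ (h : (F₂^ n → Bool) → ℕ) → ∑ (flats k n) (λ A → h A * multiplicity k A)
    ≡ ∑ (affineMaps k n) (λ φ → ∑ (flats k n) (λ A → h A * 𝟙 (does (parametrizes? φ A))))
  ∑-flats-affineMaps h = trans
    (∑-cong (flats k n) (λ A → sym (∑-* (affineMaps k n) (h A) _))) (∑-swap (flats k n) (affineMaps k n) _)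

  -- The left side counts the affine maps that parametrize some flat, and each has just one image.
  -- Enlarging this to all pairs can only lower the estimate for the proportion of rejecting flats,
  -- so an inequality suffices.
  #flats*M≤volume : length (flats k n) * M ≤ volume k n
  #flats*M≤volume = begin
    length (flats k n) * M
      ≡⟨ cong (_* M) (sym (∑-1 (flats k n))) ⟩
    ∑ (flats k n) (const 1) * M
      ≡⟨ trans (∑-multiplicity (const 1)) (∑-flats-affineMaps (const 1)) ⟩
    ∑ (affineMaps k n) (λ φ → ∑ (flats k n) (λ A → 1 * 𝟙 (does (parametrizes? φ A))))
      ≤⟨ ∑-mono (affineMaps k n) at-most-one-flat ⟩
    ∑ (affineMaps k n) (const 1)
      ≡⟨ ∑-affineMaps-1 k n ⟩
    volume k n ∎
    where
    open ℕ.≤-Reasoning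
    at-most-one-flat : ∀ φ → ∑ (flats k n) (λ A → 1 * 𝟙 (does (parametrizes? φ A))) ≤ 1
    at-most-one-flat φ = begin
      ∑ (flats k n) (λ A → 1 * 𝟙 (does (parametrizes? φ A)))  ≡⟨ ∑-cong (flats k n) (λ A → ℕ.*-identityˡ _) ⟩
      ∑ (flats k n) (λ A → 𝟙 (does (parametrizes? φ A)))      ≡⟨ ∑-filter (isFlat? k) (functions n) _ ⟩
      ∑ (functions n) (λ A → 𝟙 (does (isFlat? k A)) * 𝟙 (does (parametrizes? φ A)))
        ≤⟨ ∑-mono (functions n) (λ A → 𝟙*≤ (does (isFlat? k A)) _) ⟩
      ∑ (functions n) (λ A → 𝟙 (does (parametrizes? φ A)))    ≤⟨ at-most-one {φ = φ} (functions-unique n) ⟩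
      1                                                       ∎
      where
      𝟙*≤ : ∀ b x → 𝟙 b * x ≤ x
      𝟙*≤ false x = z≤n
      𝟙*≤ true  x = ℕ.≤-reflexive (ℕ.+-identityʳ x)

  flat-of : (φ : AffineMap k n) → Injective _≡_ _≡_ ⟦ φ ⟧ → ∃ λ A → A ∈ flats k n × φ Parametrizes A
  flat-of φ inj = find (functions-complete (image φ)) (λ A∈ → A∈)
    where
    find : ∀ {As} → Any (image φ ≗_) As → (∀ {A} → A ∈ As → A ∈ functions n) → ∃ λ A → A ∈ flats k n × φ Parametrizes A
    find (here {A} im≗A) As⊆ = A , ∈.∈-filter⁺ (isFlat? k) (As⊆ (here refl)) (φ , φA) , φA
      where φA = Parametrizes-resp {φ = φ} im≗A (Parametrizes-image φ inj)
    find (there any) As⊆ = find any (As⊆ ∘ there)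

  M>0 : k ≤ n → 0 < M
  M>0 k≤n = positive (proj₂ (flats-nonEmpty k≤n)) (isFlat (proj₂ (flats-nonEmpty k≤n)))
    where
    open ℕ.≤-Reasoning
    positive : ∀ {A} → A ∈ flats k n → IsFlat k A → 0 < M
    positive {A} A∈ (φ , param) = begin
      1                                     ≡⟨ sym (cong 𝟙 (dec-true (parametrizes? φ A) param)) ⟩
      𝟙 (does (parametrizes? φ A))          ≤⟨ term≤∑ (λ φ → 𝟙 (does (parametrizes? φ A))) (complete (affineᴱ k n) φ) ⟩
      multiplicity k A                      ≡⟨ multiplicity-flat A∈ ⟩
      M                                     ∎

-- A pair with nonzero derivative has independent directions, hence parametrizes a flat, and this
-- flat is rejecting. Each rejecting flat accounts for at most `M` such pairs.
R≤#rejecting : ∀ d (f : F₂^ n → F₂) →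
  R (suc d) f ≤ length (filter (λ A → ¬? (accepts? d f A)) (flats (suc d) n)) * Flats.M (suc d) n
R≤#rejecting {n} d f = begin
  R κ f                                                ≡⟨ sym (∑-affineMaps κ f) ⟩
  ∑ (affineMaps κ n) (𝟙 ∘ derivative f)                ≤⟨ ∑-mono (affineMaps κ n) (λ φ → pointwise φ (derivative f φ) refl) ⟩
  ∑ (affineMaps κ n) (λ φ → ∑ (flats κ n) (λ A → rejects A * 𝟙 (does (parametrizes? φ A))))
                                                       ≡⟨ sym (trans (∑-multiplicity rejects) (∑-flats-affineMaps rejects)) ⟩
  ∑ (flats κ n) rejects * M                            ≡⟨ cong (_* M) (sym (length-filter (λ A → ¬? (accepts? d f A)) (flats κ n))) ⟩
  length (filter (λ A → ¬? (accepts? d f A)) (flats κ n)) * M ∎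
  where
  open ℕ.≤-Reasoning
  κ = suc d
  open Flats κ n
  rejects : (F₂^ n → Bool) → ℕ
  rejects A = 𝟙 (does (¬? (accepts? d f A)))

  pointwise : ∀ φ b → derivative f φ ≡ b → 𝟙 b ≤ ∑ (flats κ n) (λ A → rejects A * 𝟙 (does (parametrizes? φ A)))
  pointwise φ        false _  = z≤n
  pointwise (a , vs) true  Dφ = rejected (flat-of (a , vs) (⟦⟧-injective vs a (D⇒Independent vs f a Dφ)))
    where
    rejected : (∃ λ A → A ∈ flats κ n × (a , vs) Parametrizes A) →
               1 ≤ ∑ (flats κ n) (λ A → rejects A * 𝟙 (does (parametrizes? (a , vs) A)))
    rejected (A , A∈ , φA) = begin
      1                                                  ≡⟨ sym (cong₂ (λ b c → 𝟙 b * 𝟙 c)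
        (dec-true (¬? (accepts? d f A)) (derivative⇒¬Accepts d f φA Dφ)) (dec-true (parametrizes? (a , vs) A) φA)) ⟩
      rejects A * 𝟙 (does (parametrizes? (a , vs) A))    ≤⟨ term≤∑ (λ A → rejects A * 𝟙 (does (parametrizes? (a , vs) A))) A∈ ⟩
      ∑ (flats κ n) (λ A → rejects A * 𝟙 (does (parametrizes? (a , vs) A))) ∎

-- Cross-multiplied forms, with F flats of which J are rejecting.
#rejecting-near : ∀ {F J M V R N W} → 0 < M → F * M ≤ V → R ≤ J * M → V * W ≤ N * R → W * F ≤ J * N
#rejecting-near {F} {J} {M@(suc _)} {V} {R} {N} {W} _ F≤ R≤ near = ℕ.*-cancelʳ-≤ (W * F) (J * N) M (begin
  W * F * M      ≡⟨ solve 3 (λ W F M → W :* F :* M := (F :* M) :* W) refl W F M ⟩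
  F * M * W      ≤⟨ ℕ.*-monoˡ-≤ W F≤ ⟩
  V * W          ≤⟨ near ⟩
  N * R          ≤⟨ ℕ.*-monoʳ-≤ N R≤ ⟩
  N * (J * M)    ≡⟨ solve 3 (λ N J M → N :* (J :* M) := J :* N :* M) refl N J M ⟩
  J * N * M      ∎)
  where
  open ℕ.≤-Reasoning
  open +-*-Solver

#rejecting-far : ∀ {F J M V R c} → 0 < M → F * M ≤ V → R ≤ J * M → V ≤ c * R → 1 * F ≤ J * c
#rejecting-far {J = J} {c = c} M>0 F≤ R≤ far = #rejecting-near {J = J} {N = c} {W = 1} M>0 F≤ R≤
  (ℕ.≤-trans (ℕ.≤-reflexive (ℕ.*-identityʳ _)) far)

-- Opened only here because +_ clashes with the sections of _+_.
open import Data.Integer.Base using (+_)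

-- Passage to rational probabilities

/-mono-≤ : ∀ a b c e .{{_ : NonZero b}} .{{_ : NonZero e}} → a * e ≤ c * b → + a / b ℚ.≤ + c / e
/-mono-≤ a (suc b) c (suc e) le = ℚ.toℚᵘ-cancel-≤
  (ℚᵘ.≤-respˡ-≃ (ℚᵘ.≃-sym (ℚ.toℚᵘ-fromℚᵘ (ℚᵘ.mkℚᵘ (+ a) b)))
  (ℚᵘ.≤-respʳ-≃ (ℚᵘ.≃-sym (ℚ.toℚᵘ-fromℚᵘ (ℚᵘ.mkℚᵘ (+ c) e)))
  (ℚᵘ.*≤* (subst₂ ℤ._≤_ (ℤ.pos-* a (suc e)) (ℤ.pos-* c (suc b)) (ℤ.+≤+ le)))))

*-/ : ∀ a b c .{{_ : NonZero c}} → (+ a / 1) ℚ.* (+ b / c) ≡ + (a * b) / c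
*-/ a b (suc c) = ℚ.toℚᵘ-injective (ℚᵘ.≃-trans (ℚ.toℚᵘ-homo-* (+ a / 1) (+ b / suc c)) (ℚᵘ.≃-trans
  (ℚᵘ.*-cong (ℚ.toℚᵘ-fromℚᵘ (ℚᵘ.mkℚᵘ (+ a) 0)) (ℚ.toℚᵘ-fromℚᵘ (ℚᵘ.mkℚᵘ (+ b) c))) (ℚᵘ.≃-trans
  (ℚᵘ.*≡* (cong₂ ℤ._*_ (sym (ℤ.pos-* a b)) (cong +_ (sym (ℕ.+-identityʳ (suc c))))))
  (ℚᵘ.≃-sym (ℚ.toℚᵘ-fromℚᵘ (ℚᵘ.mkℚᵘ (+ (a * b)) c))))))

Pr≡ : ∀ {P : A → Set} (P? : Decidable P) (xs : List A) .{{_ : NonZero (length xs)}} →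
      Pr P? xs ≡ + length (filter P? xs) / length xs
Pr≡ P? (x ∷ xs) = refl

∈⇒NonZero : ∀ {x : A} {xs} → x ∈ xs → NonZero (length xs)
∈⇒NonZero (here _)  = _
∈⇒NonZero (there _) = _

#disagreements : (f g : F₂^ n → F₂) →
  length (filter (λ x → ¬? (f x Bool.≟ g x)) (cube n)) ≡ count (λ x → f x xor g x)
#disagreements {n} f g = trans (length-filter (λ x → ¬? (f x Bool.≟ g x)) (cube n))
  (∑-cong (cube n) (λ x → cong 𝟙 (bits (f x) (g x))))
  where
  bits : ∀ b c → does (¬? (b Bool.≟ c)) ≡ b xor c
  bits false false = refl
  bits false true  = refl
  bits true  false = refl
  bits true  true  = refl

rejection-bound : ∀ q → 4 ^ 5 ≤ q → .{{_ : NonZero (2 * q)}} → ∀ d n → suc d ≤ n → (f : F₂^ n → F₂) →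
  Pr[T-GN-rejects] d f ≥ ((+ (2 ^ d) / 1) ℚ.* δ[ d ] f) ⊓ (+ 1 / (2 * q))
rejection-bound q 4^5≤q d n d<n f = subst (_≥ target ⊓ ε) (sym Pr-rejects) (conclude (dichotomy q 4^5≤q d n d<n f))
  where
  open Flats (suc d) n
  F = length (flats (suc d) n)
  J = length (filter (λ A → ¬? (accepts? d f A)) (flats (suc d) n))
  target = (+ (2 ^ d) / 1) ℚ.* δ[ d ] f
  ε = + 1 / (2 * q)

  instance
    F≢0 : NonZero F
    F≢0 = ∈⇒NonZero (proj₂ (flats-nonEmpty d<n))

    cube≢0 : NonZero (length (cube n))
    cube≢0 = ∈⇒NonZero (cube-complete {n} 𝟎)

    2^d≥0 : ℚ.NonNegative (+ (2 ^ d) / 1)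
    2^d≥0 = ℚ.normalize-nonNeg (2 ^ d) 1

  Pr-rejects : Pr[T-GN-rejects] d f ≡ + J / F
  Pr-rejects = Pr≡ (λ A → ¬? (accepts? d f A)) (flats (suc d) n)

  near : ∀ P → Lo (suc d) P → let E = count (λ x → f x xor P x) in
         2 ^ d * E * F ≤ J * 2 ^ n → target ℚ.≤ + J / F
  near P LP le = begin
    target                           ≤⟨ ℚ.*-monoˡ-≤-nonNeg (+ (2 ^ d) / 1) (δ-minimal d f P (Lo⇒deg≤ d LP)) ⟩
    (+ (2 ^ d) / 1) ℚ.* δ f P        ≡⟨ cong ((+ (2 ^ d) / 1) ℚ.*_) (trans (Pr≡ (λ x → ¬? (f x Bool.≟ P x)) (cube n))
                                          (cong (λ m → + m / length (cube n)) (#disagreements f P))) ⟩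
    (+ (2 ^ d) / 1) ℚ.* (+ E / length (cube n))  ≡⟨ *-/ (2 ^ d) E (length (cube n)) ⟩
    + (2 ^ d * E) / length (cube n)  ≤⟨ /-mono-≤ (2 ^ d * E) (length (cube n)) J F
                                          (subst (λ m → 2 ^ d * E * F ≤ J * m) (sym (length-cube n)) le) ⟩
    + J / F                          ∎
    where
    open ℚ.≤-Reasoning
    E = count (λ x → f x xor P x)

  conclude : Dichotomy q d f → + J / F ≥ target ⊓ ε
  conclude (inj₁ (P , LP , bound)) = ℚ.≤-trans (ℚ.p⊓q≤p target ε)
    (near P LP (#rejecting-near {F} {J} (M>0 d<n) #flats*M≤volume (R≤#rejecting d f) bound))
  conclude (inj₂ bound) = ℚ.≤-trans (ℚ.p⊓q≤q target ε)
    (/-mono-≤ 1 (2 * q) J F (#rejecting-far {F} {J} (M>0 d<n) #flats*M≤volume (R≤#rejecting d f) bound))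

theorem1 : ∃ λ (ε₁ : ℚ) → 0ℚ ℚ.< ε₁ × ((d n : ℕ) → suc d ≤ n → (f : F₂^ n → F₂) →
    Pr[T-GN-rejects] d f ≥ ((+ (2 ^ d) / 1) ℚ.* δ[ d ] f) ⊓ ε₁)
-- `2048` is `2 * 4 ^ 5`: one factor 4 for the share of bases in full dimension, four more for the
-- crude steps up to codimension 4, and a 2 for all later steps together.
theorem1 = + 1 / 2048 , toWitness {a? = 0ℚ ℚ.<? + 1 / 2048} _ , rejection-bound 1024 ℕ.≤-refl
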